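{- Let $d\ge 2$ and $k\ge 1$ be fixed integers. Then for the even $d$-ary tree $E_k^d$ we have $$\max_{\substack{\|T\|=(d-1)n+1\\ T\text{ strictly }d\text{ -ary tree}}}\gamma(E_k^d,T)=I_d(E_k^d)+\mathcal{O}(n^{ -1})$$ as $n\to\infty$.
   Context: A $d$-ary tree is a finite rooted tree in which every internal (non-leaf) vertex has at least two and at most $d$ children; a single vertex is a $d$-ary tree with one leaf. A strictly $d$-ary tree is a rooted tree in which every internal vertex has exactly $d$ children (its number of leaves is always congruent to $1$ modulo $d-1$). Isomorphism means root-preserving isomorphism. $\|T\|$ denotes the number of leaves of $T$. A set $S$ of leaves of $T$ induces a $d$-ary tree: take the smallest subtree of $T$ containing all leaves in $S$ (rooted at the most recent common ancestor of $S$) and repeatedly suppress every vertex with exactly one child (contracting its two adjacent edges to a single edge). $c(D,T)$ is the number of sets of $\|D\|$ leaves of $T$ that induce a tree isomorphic to $D$, and $\gamma(D,T)=c(D,T)/\binom{\|T\|}{\|D\|}$. The $d$-ary inducibility of a $d$-ary tree $D$ is $$I_d(D)=\limsup_{n\to\infty}\ \max_{\substack{\|T\|=n\\ T\ d\text{ -ary tree}}}\gamma(D,T).$$ Even $d$-ary trees $E_k^d$ (with $k$ leaves) are defined recursively: $E_1^d$ is a single vertex; for $2\le k\le d$, $E_k^d$ is the star consisting of a root and $k$ leaves attached to it; for $k>d$, write $k=ds+b$ with $b\in\{0,1,\ldots,d-1\}$, take $d-b$ copies of $E_s^d$ and $b$ copies of $E_{s+1}^d$, and connect a new common root to each of their roots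 by an edge to obtain $E_k^d$. -}

module Defs where

open import Data.Empty using (⊥)
open import Data.Fin.Subset using (Subset; inside; outside; ∣_∣)
open import Data.Integer.Base using (+_)
open import Data.List.Base using (List; []; _∷_; _++_; map; filter; length; replicate; upTo; foldr; concatMap; cartesianProductWith)
open import Data.List.Membership.Propositional using (_∈_)
open import Data.List.Membership.Propositional.Properties
  using (∈-∃++; ∈-map⁺; ∈-map⁻; ∈-filter⁺; ∈-filter⁻; ∈-concatMap⁺; ∈-concatMap⁻; ∈-cartesianProductWith⁺; ∈-cartesianProductWith⁻; ∈-upTo⁺; ∈-upTo⁻)
open import Data.List.Relation.Binary.Permutation.Homogeneous as Permutation using (Permutation; prep)
import Data.List.Relation.Binary.Permutation.Setoid.Properties as PermutationProperties
open import Data.List.Relation.Binary.Pointwise.Base using (Pointwise; []; _∷_)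
open import Data.List.Relation.Unary.All as All using (All; []; _∷_)
open import Data.List.Relation.Unary.Any as Any using (here; there; any?)
open import Data.Maybe.Base as Maybe using (Maybe; just; nothing)
import Data.Maybe.Relation.Unary.Any as MaybeAny
open import Data.Nat.Base using (ℕ; zero; suc; _+_; _*_; _∸_; _≤_; _<_; z≤n; s≤s; NonZero; NonTrivial; nonTrivial⇒nonZero; nonTrivial⇒n>1)
open import Data.Nat.Combinatorics using (_C_)
open import Data.Nat.DivMod using (_/_; _%_; m≡m%n+[m/n]*n; [m+kn]%n≡m%n; m<n⇒m%n≡m)
open import Data.Nat.Properties as ℕ using (_≟_; _≤?_)
open import Data.Product using (∃-syntax; _×_; _,_; proj₁)
open import Data.Rational.Base as ℚ using (ℚ; 0ℚ)
import Data.Rational.Properties as ℚ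
open import Data.Vec.Base using ([]; _∷_; take; drop)
open import Function.Base using (_∘_)
open import Function.Bundles using (_⇔_; mk⇔)
open import Level using (0ℓ)
open import Relation.Binary.Bundles using (Setoid)
open import Relation.Binary.PropositionalEquality using (_≡_; refl; sym; trans; cong; cong₂)
open import Relation.Nullary using (Dec; yes; no; contradiction)
open import Relation.Nullary.Decidable using (_×-dec_; map′)

------------------------------------------------------------------------
-- Rooted trees

-- A rooted tree is given by the list of the branches at its root; the order
-- of that list carries no information once trees are compared with _≅_.

data Tree : Set where
  node : List Tree → Tree

pattern leaf = node []

infix 4 _≅_ _≅?_ _≅*?_

data _≅_ : Tree → Tree → Set where
  node : ∀ {ts us} → Permutation _≅_ ts us → node ts ≅ node us

mutual
  ≅-refl : ∀ t → t ≅ t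
  ≅-refl (node ts) = node (Permutation.refl (≅*-refl ts))

  ≅*-refl : ∀ ts → Pointwise _≅_ ts ts
  ≅*-refl []       = []
  ≅*-refl (t ∷ ts) = ≅-refl t ∷ ≅*-refl ts

mutual
  ≅-sym : ∀ {t u} → t ≅ u → u ≅ t
  ≅-sym (node p) = node (↭-sym p)

  ↭-sym : ∀ {ts us} → Permutation _≅_ ts us → Permutation _≅_ us ts
  ↭-sym (Permutation.refl p)     = Permutation.refl (≅*-sym p)
  ↭-sym (prep e p)               = prep (≅-sym e) (↭-sym p)
  ↭-sym (Permutation.swap e f p) = Permutation.swap (≅-sym f) (≅-sym e) (↭-sym p)
  ↭-sym (Permutation.trans p q)  = Permutation.trans (↭-sym q) (↭-sym p)

  ≅*-sym : ∀ {ts us} → Pointwise _≅_ ts us → Pointwise _≅_ us ts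
  ≅*-sym []       = []
  ≅*-sym (e ∷ es) = ≅-sym e ∷ ≅*-sym es

≅-trans : ∀ {t u v} → t ≅ u → u ≅ v → t ≅ v
≅-trans (node p) (node q) = node (Permutation.trans p q)

≅-setoid : Setoid 0ℓ 0ℓ
≅-setoid = record
  { Carrier       = Tree
  ; _≈_           = _≅_
  ; isEquivalence = record { refl = ≅-refl _ ; sym = ≅-sym ; trans = ≅-trans }
  }

private
  module ↭ = PermutationProperties ≅-setoid

  any-split : ∀ {P : Tree → Set} {us} → Any.Any P us →
              ∃[ vs ] ∃[ u ] ∃[ ws ] (us ≡ vs ++ u ∷ ws × P u)
  any-split (here p) = [] , _ , _ , refl , p
  any-split (there {x = x} p) with vs , u , ws , refl , q ← any-split p =
    x ∷ vs , u , ws , refl , q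

mutual
  _≅?_ : ∀ t u → Dec (t ≅ u)
  node ts ≅? node us = map′ node (λ { (node p) → p }) (ts ≅*? us)

  _≅*?_ : ∀ ts us → Dec (Permutation _≅_ ts us)
  []       ≅*? []       = yes (Permutation.refl [])
  []       ≅*? (u ∷ us) = no λ p → ↭.¬x∷xs↭[] (↭-sym p)
  (t ∷ ts) ≅*? us with any? (t ≅?_) us
  ... | no ∄u = no λ p → ∄u (↭.∈-resp-↭ p (here (≅-refl t)))
  ... | yes ∃u with vs , u , ws , refl , t≅u ← any-split ∃u
        with ts ≅*? (vs ++ ws)
  ...   | yes p = yes (Permutation.trans (prep t≅u p) (↭-sym (↭.↭-shift vs ws)))
  ...   | no ¬p = no λ p → ¬p (↭.drop-∷ (Permutation.trans
            (prep (≅-sym t≅u) (Permutation.refl (≅*-refl ts)))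
            (Permutation.trans p (↭.↭-shift vs ws))))

------------------------------------------------------------------------
-- Leaves and induced trees

mutual
  ‖_‖ : Tree → ℕ
  ‖ leaf ‖          = 1
  ‖ node (t ∷ ts) ‖ = ‖ t ∷ ts ‖*

  ‖_‖* : List Tree → ℕ
  ‖ [] ‖*     = 0
  ‖ t ∷ ts ‖* = ‖ t ‖ + ‖ ts ‖*

-- The leaves of T are numbered from left to right, so that a set of leaves
-- is an element of Subset ‖ T ‖.

-- The union of the paths from the root of T to the leaves in S
-- (nothing when S is empty).

mutual
  rootPaths : (T : Tree) → Subset ‖ T ‖ → Maybe Tree
  rootPaths leaf            (inside  ∷ []) = just leaf
  rootPaths leaf            (outside ∷ []) = nothing
  rootPaths (node (t ∷ ts)) S with rootPaths* (t ∷ ts) S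
  ... | []     = nothing
  ... | u ∷ us = just (node (u ∷ us))

  rootPaths* : (ts : List Tree) → Subset ‖ ts ‖* → List Tree
  rootPaths* []       S = []
  rootPaths* (t ∷ ts) S with rootPaths t (take ‖ t ‖ S)
  ... | nothing = rootPaths* ts (drop ‖ t ‖ S)
  ... | just u  = u ∷ rootPaths* ts (drop ‖ t ‖ S)

-- As long as the root has a single child, all leaves lie below that child;
-- the vertex reached at the end is their most recent common ancestor.

fromMRCA : Tree → Tree
fromMRCA leaf                = leaf
fromMRCA (node (t ∷ []))     = fromMRCA t
fromMRCA (node (t ∷ u ∷ us)) = node (t ∷ u ∷ us)

minimalSubtree : (T : Tree) → Subset ‖ T ‖ → Maybe Tree
minimalSubtree T S = Maybe.map fromMRCA (rootPaths T S)

mutual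
  suppress : Tree → Tree
  suppress leaf                = leaf
  suppress (node (t ∷ []))     = suppress t
  suppress (node (t ∷ u ∷ us)) = node (suppress t ∷ suppress u ∷ suppress* us)

  suppress* : List Tree → List Tree
  suppress* []       = []
  suppress* (t ∷ ts) = suppress t ∷ suppress* ts

induced : (T : Tree) → Subset ‖ T ‖ → Maybe Tree
induced T S = Maybe.map suppress (minimalSubtree T S)

Induces : Tree → (T : Tree) → Subset ‖ T ‖ → Set
Induces D T S = MaybeAny.Any (_≅ D) (induced T S)

IsCopy : Tree → (T : Tree) → Subset ‖ T ‖ → Set
IsCopy D T S = ∣ S ∣ ≡ ‖ D ‖ × Induces D T S

isCopy? : ∀ D T S → Dec (IsCopy D T S)
isCopy? D T S = (∣ S ∣ ≟ ‖ D ‖) ×-dec MaybeAny.dec (_≅? D) (induced T S)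

-- Every subset of Fin n, listed exactly once.

subsets : ∀ n → List (Subset n)
subsets zero    = [] ∷ []
subsets (suc n) = map (outside ∷_) (subsets n) ++ map (inside ∷_) (subsets n)

c : Tree → Tree → ℕ
c D T = length (filter (isCopy? D T) (subsets ‖ T ‖))

-- A denominator 0 gives the value 0.  In γ this happens only if T has fewer
-- leaves than D, where the density is not defined.

ratio : ℕ → ℕ → ℚ
ratio a zero    = 0ℚ
ratio a (suc b) = (+ a) ℚ./ suc b

γ : Tree → Tree → ℚ
γ D T = ratio (c D T) (‖ T ‖ C ‖ D ‖)

------------------------------------------------------------------------
-- d-ary trees and strictly d-ary trees

data Arities (P : ℕ → Set) : Tree → Set where
  isLeaf : Arities P leaf
  isNode : ∀ {t ts} → P (length (t ∷ ts)) → All (Arities P) (t ∷ ts) →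
           Arities P (node (t ∷ ts))

Ary StrictlyAry : ℕ → Tree → Set
Ary         d = Arities (λ m → 2 ≤ m × m ≤ d)
StrictlyAry d = Arities (_≡ d)

------------------------------------------------------------------------
-- Maximum density over the trees with n leaves

-- Trees of height at most h all of whose internal vertices have their number
-- of children in ms.  Several plane orderings of one tree may be listed; this
-- does not affect a maximum.

words : ∀ {A : Set} → ℕ → List A → List (List A)
words zero    xs = [] ∷ []
words (suc m) xs = cartesianProductWith _∷_ xs (words m xs)

ofHeight : List ℕ → ℕ → List Tree
ofHeight ms zero    = leaf ∷ []
ofHeight ms (suc h) = leaf ∷ map node (concatMap (λ m → words m (ofHeight ms h)) ms)

-- If every m ∈ ms is at least 2, a tree with n leaves has height at most n,
-- so no tree is missed; see aryTrees-correct and strictlyAryTrees-correct.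

withLeaves : List ℕ → ℕ → List Tree
withLeaves ms n = filter (λ T → ‖ T ‖ ≟ n) (ofHeight ms n)

aryTrees strictlyAryTrees : ℕ → ℕ → List Tree
aryTrees         d = withLeaves (map (λ i → 2 + i) (upTo (d ∸ 1)))
strictlyAryTrees d = withLeaves (d ∷ [])

-- Densities are nonnegative, so 0 as a starting value is harmless; it is the
-- result only if every density is 0 or there are no trees to consider.

maxγ : Tree → List Tree → ℚ
maxγ D Ts = foldr ℚ._⊔_ 0ℚ (map (γ D) Ts)

private
  words⁻ : ∀ {A : Set} m (xs : List A) {ts} → ts ∈ words m xs →
           length ts ≡ m × All (_∈ xs) ts
  words⁻ zero    xs (here refl) = refl , []
  words⁻ (suc m) xs p
    with _ , _ , a∈ , b∈ , refl ← ∈-cartesianProductWith⁻ _∷_ xs (words m xs) p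
    with e , as ← words⁻ m xs b∈ = cong suc e , a∈ ∷ as

  words⁺ : ∀ {A : Set} {xs ts : List A} → All (_∈ xs) ts → ts ∈ words (length ts) xs
  words⁺ []       = here refl
  words⁺ (p ∷ ps) = ∈-cartesianProductWith⁺ _∷_ p (words⁺ ps)

  any⁻ : ∀ {A : Set} {P : A → Set} {xs : List A} → Any.Any P xs → ∃[ x ] (x ∈ xs × P x)
  any⁻ (here p)  = _ , here refl , p
  any⁻ (there p) with x , x∈ , q ← any⁻ p = x , there x∈ , q

  any⁺ : ∀ {A : Set} {P : A → Set} {xs : List A} {x} → x ∈ xs → P x → Any.Any P xs
  any⁺ (here refl) p = here p
  any⁺ (there x∈)  p = there (any⁺ x∈ p)

  ofHeight⁻ : ∀ ms h {T} → T ∈ ofHeight ms h → Arities (_∈ ms) T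
  ofHeight⁻ ms zero    (here refl) = isLeaf
  ofHeight⁻ ms (suc h) (here refl) = isLeaf
  ofHeight⁻ ms (suc h) (there T∈)
    with ts , ts∈ , refl ← ∈-map⁻ node T∈
    with m , m∈ , ts∈w ← any⁻ (∈-concatMap⁻ (λ m → words m (ofHeight ms h)) {xs = ms} ts∈)
    with words⁻ m (ofHeight ms h) ts∈w
  ... | refl , []     = isLeaf
  ... | refl , a ∷ as = isNode m∈ (All.map (ofHeight⁻ ms h) (a ∷ as))

  mutual
    ‖‖>0 : ∀ T → 1 ≤ ‖ T ‖
    ‖‖>0 leaf            = s≤s z≤n
    ‖‖>0 (node (t ∷ ts)) = ℕ.≤-trans (‖‖>0 t) (ℕ.m≤m+n _ _)

    ‖‖*≥ : ∀ ts → length ts ≤ ‖ ts ‖*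
    ‖‖*≥ []       = z≤n
    ‖‖*≥ (t ∷ ts) = ℕ.+-mono-≤ (‖‖>0 t) (‖‖*≥ ts)

  child≤ : ∀ {ts n} → ‖ ts ‖* ≤ n → All (λ t → ‖ t ‖ ≤ n) ts
  child≤ {[]}     p = []
  child≤ {t ∷ ts} p = ℕ.≤-trans (ℕ.m≤m+n _ _) p ∷ child≤ (ℕ.≤-trans (ℕ.m≤n+m _ _) p)

  child< : ∀ {ts h} → 2 ≤ length ts → ‖ ts ‖* ≤ suc h → All (λ t → ‖ t ‖ ≤ h) ts
  child< {t ∷ []} (s≤s ()) _
  child< {t ∷ u ∷ us} {h} _ p =
    ℕ.≤-pred (ℕ.≤-trans (ℕ.≤-trans (ℕ.≤-reflexive (ℕ.+-comm 1 ‖ t ‖))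
      (ℕ.+-monoʳ-≤ ‖ t ‖ (ℕ.≤-trans (s≤s z≤n) (‖‖*≥ (u ∷ us))))) p)
    ∷ child≤ (ℕ.≤-pred (ℕ.≤-trans (ℕ.+-monoˡ-≤ ‖ u ∷ us ‖* (‖‖>0 t)) p))

  mutual
    ofHeight⁺ : ∀ ms → All (2 ≤_) ms → ∀ h {T} → Arities (_∈ ms) T →
                ‖ T ‖ ≤ h → T ∈ ofHeight ms h
    ofHeight⁺ ms ≥2 zero    isLeaf ()
    ofHeight⁺ ms ≥2 (suc h) isLeaf _ = here refl
    ofHeight⁺ ms ≥2 zero    {T} (isNode _ _) p with () ← ℕ.≤-trans (‖‖>0 T) p
    ofHeight⁺ ms ≥2 (suc h) (isNode m∈ as) p =
      there (∈-map⁺ node (∈-concatMap⁺ (λ m → words m (ofHeight ms h)) {xs = ms}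
        (any⁺ m∈ (words⁺ (ofHeight⁺* ms ≥2 h as (child< (All.lookup ≥2 m∈) p))))))

    ofHeight⁺* : ∀ ms → All (2 ≤_) ms → ∀ h {ts} → All (Arities (_∈ ms)) ts →
                 All (λ t → ‖ t ‖ ≤ h) ts → All (_∈ ofHeight ms h) ts
    ofHeight⁺* ms ≥2 h []       []       = []
    ofHeight⁺* ms ≥2 h (a ∷ as) (p ∷ ps) = ofHeight⁺ ms ≥2 h a p ∷ ofHeight⁺* ms ≥2 h as ps

  mutual
    mapArities : ∀ {P Q : ℕ → Set} → (∀ {m} → P m → Q m) → ∀ {T} → Arities P T → Arities Q T
    mapArities f isLeaf        = isLeaf
    mapArities f (isNode p as) = isNode (f p) (mapArities* f as)

    mapArities* : ∀ {P Q : ℕ → Set} → (∀ {m} → P m → Q m) →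
                  ∀ {ts} → All (Arities P) ts → All (Arities Q) ts
    mapArities* f []       = []
    mapArities* f (a ∷ as) = mapArities f a ∷ mapArities* f as

  withLeaves-correct : ∀ {P : ℕ → Set} ms → All (2 ≤_) ms → (∀ {m} → m ∈ ms → P m) →
    (∀ {m} → P m → m ∈ ms) → ∀ n T → T ∈ withLeaves ms n ⇔ (Arities P T × ‖ T ‖ ≡ n)
  withLeaves-correct ms ≥2 f g n T = mk⇔
    (λ T∈ → let T∈′ , e = ∈-filter⁻ (λ U → ‖ U ‖ ≟ n) {xs = ofHeight ms n} T∈
            in mapArities f (ofHeight⁻ ms n T∈′) , e)
    (λ (a , e) → ∈-filter⁺ (λ U → ‖ U ‖ ≟ n)
                   (ofHeight⁺ ms ≥2 n (mapArities g a) (ℕ.≤-reflexive e)) e)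

  2…d⁻ : ∀ d {m} → m ∈ map (λ i → 2 + i) (upTo (d ∸ 1)) → 2 ≤ m × m ≤ d
  2…d⁻ zero    ()
  2…d⁻ (suc d) m∈ with i , i∈ , refl ← ∈-map⁻ (λ i → 2 + i) m∈ =
    s≤s (s≤s z≤n) , s≤s (∈-upTo⁻ i∈)

  2…d⁺ : ∀ d {m} → 2 ≤ m × m ≤ d → m ∈ map (λ i → 2 + i) (upTo (d ∸ 1))
  2…d⁺ (suc d) {suc (suc i)} (_ , s≤s i<d) = ∈-map⁺ (λ i → 2 + i) (∈-upTo⁺ i<d)
  2…d⁺ (suc d) {suc zero} (s≤s () , _)

aryTrees-correct : ∀ d n T → T ∈ aryTrees d n ⇔ (Ary d T × ‖ T ‖ ≡ n)
aryTrees-correct d = withLeaves-correct _ (All.tabulate (proj₁ ∘ 2…d⁻ d)) (2…d⁻ d) (2…d⁺ d)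

strictlyAryTrees-correct : ∀ d .{{_ : NonTrivial d}} n T →
  T ∈ strictlyAryTrees d n ⇔ (StrictlyAry d T × ‖ T ‖ ≡ n)
strictlyAryTrees-correct d = withLeaves-correct (d ∷ []) (nonTrivial⇒n>1 d ∷ [])
  (λ { (here e) → e }) here

------------------------------------------------------------------------
-- Limit superior and inducibility

-- A real number is represented by the sets of the rationals strictly below
-- it and strictly above it.  No field requires inhabitedness or locatedness
-- (q < r implies q ∈ lower or r ∈ upper), so that the limit superior of every
-- rational sequence exists; it may be infinite, and constructively it need
-- not be located.  If ∣ x - L ∣≤ ε holds for arbitrarily small ε, then L is
-- an inhabited, located Dedekind cut.

record Cut : Set₁ where
  field
    lower upper   : ℚ → Set
    lower-closed  : ∀ {q r} → q ℚ.< r → lower r → lower q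
    upper-closed  : ∀ {q r} → q ℚ.< r → upper q → upper r
    lower-rounded : ∀ {q} → lower q → ∃[ r ] (q ℚ.< r × lower r)
    upper-rounded : ∀ {r} → upper r → ∃[ q ] (q ℚ.< r × upper q)
    disjoint      : ∀ {q} → lower q → upper q → ⊥

-- q < lim sup a iff, for some r > q, r ≤ a n for infinitely many n;
-- lim sup a < q iff, for some r < q, a n ≤ r for all but finitely many n.

limsup : (ℕ → ℚ) → Cut
limsup a = record
  { lower         = λ q → ∃[ r ] (q ℚ.< r × (∀ N → ∃[ n ] (N ≤ n × r ℚ.≤ a n)))
  ; upper         = λ q → ∃[ r ] (r ℚ.< q × (∃[ N ] (∀ n → N ≤ n → a n ℚ.≤ r)))
  ; lower-closed  = λ q<r (s , r<s , p) → s , ℚ.<-trans q<r r<s , p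
  ; upper-closed  = λ q<r (s , s<q , p) → s , ℚ.<-trans s<q q<r , p
  ; lower-rounded = λ (s , q<s , p) → let r , q<r , r<s = ℚ.<-dense q<s in r , q<r , s , r<s , p
  ; upper-rounded = λ (s , s<q , p) → let r , s<r , r<q = ℚ.<-dense s<q in r , r<q , s , s<r , p
  ; disjoint      = λ (s , q<s , p) (r , r<q , N , f) → let n , N≤n , s≤an = p N in
      ℚ.<-irrefl refl (ℚ.<-≤-trans (ℚ.<-trans r<q q<s) (ℚ.≤-trans s≤an (f n N≤n)))
  }

-- x - ε ≤ L and L ≤ x + ε

∣_-_∣≤_ : ℚ → Cut → ℚ → Set
∣ x - L ∣≤ ε = (∀ q → q ℚ.< x ℚ.- ε → lower q) × (∀ q → x ℚ.+ ε ℚ.< q → upper q)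
  where open Cut L

I : ℕ → Tree → Cut
I d D = limsup (λ n → maxγ D (aryTrees d n))

------------------------------------------------------------------------
-- Even d-ary trees

-- The argument after d bounds the depth of the recursion; any bound
-- that is at least k gives the same tree (see E-step).

even : ∀ d .{{_ : NonZero d}} → ℕ → ℕ → Tree
even d zero    k = leaf
even d (suc f) k with k ≤? 1 | k ≤? d
... | yes _ | _     = leaf
... | no  _ | yes _ = node (replicate k leaf)
... | no  _ | no  _ = node (replicate (d ∸ k % d) (even d f (k / d)) ++
                            replicate (k % d) (even d f (suc (k / d))))

private
  instance
    nonTrivial→nonZero : ∀ {d} → .{{NonTrivial d}} → NonZero d
    nonTrivial→nonZero {d} = nonTrivial⇒nonZero d

E : ∀ d .{{_ : NonTrivial d}} → ℕ → Tree
E d k = even d k k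

1+k/d<k : ∀ d .{{_ : NonTrivial d}} k → d < k → suc (k / d) < k
1+k/d<k d k d<k with k / d | ℕ.≤-trans (ℕ.m≤n+m _ (k % d)) (ℕ.≤-reflexive (sym (m≡m%n+[m/n]*n k d)))
... | zero        | _    = ℕ.<-trans (nonTrivial⇒n>1 d) d<k
... | suc zero    | _    = ℕ.≤-trans (s≤s (nonTrivial⇒n>1 d)) d<k
... | suc (suc s) | sd≤k = ℕ.≤-trans (ℕ.≤-trans
  (ℕ.≤-trans (ℕ.≤-reflexive (ℕ.+-comm 2 (2 + s))) (ℕ.+-monoʳ-≤ (2 + s) (ℕ.≤-trans (s≤s (s≤s z≤n)) (ℕ.m≤m+n (2 + s) 0))))
  (ℕ.≤-trans (ℕ.≤-reflexive (ℕ.*-comm 2 (2 + s))) (ℕ.*-monoʳ-≤ (2 + s) (nonTrivial⇒n>1 d)))) sd≤k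

even-cong : ∀ d .{{_ : NonTrivial d}} f g k → k ≤ f → k ≤ g → even d f k ≡ even d g k
even-cong d zero    zero    k    _   _ = refl
even-cong d zero    (suc g) zero _   _ = refl
even-cong d (suc f) zero    zero _   _ = refl
even-cong d (suc f) (suc g) k    k≤f k≤g with k ≤? 1 | k ≤? d
... | yes _ | _     = refl
... | no  _ | yes _ = refl
... | no  _ | no k≰d =
  let s<f = ℕ.≤-pred (ℕ.≤-trans (1+k/d<k d k (ℕ.≰⇒> k≰d)) k≤f)
      s<g = ℕ.≤-pred (ℕ.≤-trans (1+k/d<k d k (ℕ.≰⇒> k≰d)) k≤g)
  in cong₂ (λ T U → node (replicate (d ∸ k % d) T ++ replicate (k % d) U))
       (even-cong d f g (k / d) (ℕ.<⇒≤ s<f) (ℕ.<⇒≤ s<g))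
       (even-cong d f g (suc (k / d)) s<f s<g)

E-leaf : ∀ d .{{_ : NonTrivial d}} → E d 1 ≡ leaf
E-leaf d = refl

E-star : ∀ d .{{_ : NonTrivial d}} k → 2 ≤ k → k ≤ d → E d k ≡ node (replicate k leaf)
E-star d (suc k) 2≤k k≤d with suc k ≤? 1 | suc k ≤? d
... | yes k≤1 | _      = contradiction k≤1 (ℕ.<⇒≱ 2≤k)
... | no  _   | yes _  = refl
... | no  _   | no k≰d = contradiction k≤d k≰d

E-step : ∀ d .{{_ : NonTrivial d}} s b → b < d → d < d * s + b →
  E d (d * s + b) ≡ node (replicate (d ∸ b) (E d s) ++ replicate b (E d (suc s)))
E-step d s b b<d d<k = trans unfold (cong₂
    (λ q r → node (replicate (d ∸ r) (E d q) ++ replicate r (E d (suc q)))) k/d≡s k%d≡b)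
  where
  k = d * s + b

  k≡ : k ≡ b + s * d
  k≡ = trans (ℕ.+-comm (d * s) b) (cong (_+_ b) (ℕ.*-comm d s))

  k%d≡b : k % d ≡ b
  k%d≡b = trans (cong (_% d) k≡) (trans ([m+kn]%n≡m%n b s d) (m<n⇒m%n≡m b<d))

  k/d≡s : k / d ≡ s
  k/d≡s = ℕ.*-cancelʳ-≡ (k / d) s d (ℕ.+-cancelˡ-≡ b _ _
    (trans (cong (_+ k / d * d) (sym k%d≡b)) (trans (sym (m≡m%n+[m/n]*n k d)) k≡)))

  unfold′ : ∀ f j → d < j → j ≤ f → even d f j ≡
    node (replicate (d ∸ j % d) (E d (j / d)) ++ replicate (j % d) (E d (suc (j / d))))
  unfold′ zero    j d<j j≤f = contradiction (ℕ.≤-trans d<j j≤f) λ ()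
  unfold′ (suc f) j d<j j≤f with j ≤? 1 | j ≤? d
  ... | yes j≤1 | _       = contradiction (ℕ.<-trans (nonTrivial⇒n>1 d) d<j) (ℕ.≤⇒≯ j≤1)
  ... | no _    | yes j≤d = contradiction d<j (ℕ.≤⇒≯ j≤d)
  ... | no _    | no _    =
    let s<f = ℕ.≤-pred (ℕ.≤-trans (1+k/d<k d j d<j) j≤f)
    in cong₂ (λ T U → node (replicate (d ∸ j % d) T ++ replicate (j % d) U))
         (even-cong d f (j / d) (j / d) (ℕ.<⇒≤ s<f) ℕ.≤-refl)
         (even-cong d f (suc (j / d)) (suc (j / d)) s<f ℕ.≤-refl)

  unfold = unfold′ k k d<k ℕ.≤-refl

{-# OPTIONS --safe #-}

-- With k = d s + b and 1 ≤ b ≤ d, the branches of E d k are d - b copies of E d s and b copies of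
-- E d (s + 1), where E d 0 stands for the empty tree.  If the branches of T have n₁, …, n_d leaves,
-- with sum n, an inductive bound c(E d k, T) ≤ a_k n^k therefore amounts to
--   a_s^(d-b) a_(s+1)^b Π nᵢ^s e_b(n₁, …, n_d) ≤ a_k (n^k - Σ nᵢ^k).
-- The exponents on the left are balanced, so by Muirhead's inequality it is enough that this holds
-- with equality when all nᵢ are equal, which defines a_k.
-- Conversely, in strictly d-ary trees whose branches are as equal as possible,
--   c(E d k, T) ≥ z^(k-1) (a_k z - γ),   z = ‖T‖ + 2 d - 3.
-- Here z(T) ≤ d z(U) for every branch U of T, and then the bound passes from the branches to T if
-- k ≥ 3 and γ is large; the case k = 2 is exact.  Both maxima are therefore k! a_k + O(1/n).

module Submission where

open import Defs
open import Data.Bool.Base using (true; false)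
open import Data.Fin.Subset using (Subset; inside; outside; ∣_∣)
open import Data.Integer.Base as ℤ using (+_)
import Data.Integer.Properties as ℤ
open import Data.List.Base as List using (List; []; _∷_; map; length; replicate; filter)
open import Data.List.Membership.Propositional using (_∈_)
open import Data.List.Properties using (length-++; length-map; length-replicate; map-++; map-∘; ++-identityʳ)
open import Data.List.Relation.Binary.Permutation.Homogeneous as Permutation using (Permutation; prep)
import Data.List.Relation.Binary.Permutation.Setoid.Properties as PermutationProperties
open import Data.List.Relation.Binary.Pointwise.Base using (Pointwise; []; _∷_)
open import Data.List.Relation.Unary.All as All using (All; []; _∷_)
import Data.List.Relation.Unary.All.Properties as All
open import Data.List.Relation.Unary.AllPairs using (AllPairs; []; _∷_)
open import Data.List.Relation.Unary.Any using (here; there)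
open import Data.Maybe.Base as Maybe using (Maybe; just; nothing)
import Data.Maybe.Relation.Unary.Any as MaybeAny
open import Data.Nat.Base
open import Data.Nat.Combinatorics using (_C_; nCk+nC[k+1]≡[n+1]C[k+1])
open import Data.Nat.DivMod using (m≡m%n+[m/n]*n; m%n<n)
open import Data.Nat.Induction using (<-rec)
open import Data.Nat.ListAction using (sum; product)
open import Data.Nat.ListAction.Properties using (sum-++)
open import Data.Nat.Properties
open import Data.Nat.Tactic.RingSolver using (solve-∀)
open import Data.Product using (_×_; _,_; ∃-syntax; proj₁; proj₂)
open import Data.Rational.Base as ℚ using (ℚ; mkℚ; 0ℚ; toℚᵘ)
import Data.Rational.Properties as ℚ
open import Data.Rational.Unnormalised.Base as ℚᵘ using (mkℚᵘ)
import Data.Rational.Unnormalised.Properties as ℚᵘ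
open import Data.Sum.Base as Sum using (_⊎_; inj₁; inj₂)
open import Data.Vec.Base using ([]; _∷_; _++_; take; drop)
open import Data.Vec.Properties using (take++drop≡id; ++-injective)
open import Function.Base using (_∘_)
open import Function.Bundles using (module Equivalence)
open import Relation.Binary.PropositionalEquality using (_≡_; refl; sym; trans; cong; cong₂; subst; subst₂; module ≡-Reasoning)
open import Relation.Nullary using (Dec; yes; no; ¬_; contradiction)
open import Relation.Unary using (Decidable)

-- Newton's inequality for elementary symmetric sums

-- Muirhead's inequality is reached one degree at a time. With σ = Σ xᵢ and p_k = Σ xᵢ^k, the gap
-- satisfies σ^(k+1) - p_(k+1) = σ (σ^k - p_k) + Σ xᵢ^k (σ - xᵢ). Per degree, the mean of the
-- balanced monomials grows by at most the factor σ / d (Newton), and the last sum by at least that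
-- factor (Chebyshev). The induction therefore carries a bound for that sum along with the bound for
-- the gap. A root of a d-ary tree may have fewer than d branches; branches of size 0 fill it up, so
-- that one constant a_k serves all trees. For the lower bound, rounding must not accumulate over
-- the levels. The shift in z makes z(T) ≤ d z(U) hold without an error term, so the only new loss
-- at a level comes from the copies at its root. All bounds are kept in ℕ, with a_k = α / β and
-- truncated subtraction: a lower bound that is truncated to 0 holds trivially, so lower bounds can
-- be multiplied without sign conditions. No limit is assumed to exist: the limit superior is pinned
-- down by an upper bound at all large sizes and a lower bound at the sizes (d - 1) n + 1 alone.

esym : ℕ → List ℕ → ℕ
esym zero    xs       = 1
esym (suc b) []       = 0
esym (suc b) (x ∷ xs) = esym (suc b) xs + x * esym b xs

-- The sum of x² * esym (b ∸ 1) over the ways of removing an element x from the list.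
usym : ℕ → List ℕ → ℕ
usym zero    xs       = 0
usym (suc b) []       = 0
usym (suc b) (x ∷ xs) = usym (suc b) xs + x * usym b xs + x * x * esym b xs

-- Choose one element and a set of b elements. If the element is outside the set, each set of b + 1
-- elements arises b + 1 times; if it is inside, its square splits off, which gives `usym`.
sum*esym : ∀ b xs → sum xs * esym b xs ≡ suc b * esym (suc b) xs + usym b xs
sum*esym zero    []       = refl
sum*esym (suc b) []       = sym (trans (+-identityʳ _) (*-zeroʳ b))
sum*esym zero    (x ∷ xs) with eq ← sum*esym zero xs =
  trans (lem₁ x (sum xs)) (trans (cong (_+_ x) eq) (lem₂ x (esym 1 xs)))
  where
  lem₁ : ∀ x s → (x + s) * 1 ≡ x + s * 1
  lem₁ = solve-∀
  lem₂ : ∀ x e → x + (e + 0 + 0) ≡ e + x * 1 + 0 + 0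
  lem₂ = solve-∀
sum*esym (suc b) (x ∷ xs) =
  trans (lem₁ x (sum xs) (esym (suc b) xs) (esym b xs))
  (trans (cong₂ (λ u v → u + x * esym (suc b) xs + x * x * esym b xs + x * v) (sum*esym (suc b) xs) (sum*esym b xs))
  (lem₂ b x (esym b xs) (esym (suc b) xs) (esym (2 + b) xs) (usym (suc b) xs) (usym b xs)))
  where
  lem₁ : ∀ x s e₁ e₀ → (x + s) * (e₁ + x * e₀) ≡ s * e₁ + x * e₁ + x * x * e₀ + x * (s * e₀)
  lem₁ = solve-∀
  lem₂ : ∀ b x e₀ e₁ e₂ u₁ u₀ →
    (2 + b) * e₂ + u₁ + x * e₁ + x * x * e₀ + x * (suc b * e₁ + u₀) ≡
    (2 + b) * (e₂ + x * e₁) + (u₁ + x * u₀ + x * x * e₀)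
  lem₂ = solve-∀

2xy≤x²+y² : ∀ x y → 2 * x * y ≤ x * x + y * y
2xy≤x²+y² x y with ≤-total x y
... | inj₁ x≤y with t , refl ← m≤n⇒∃[o]m+o≡n x≤y =
  ≤-trans (m≤m+n _ (t * t)) (≤-reflexive (lem x t))
  where
  lem : ∀ x t → 2 * x * (x + t) + t * t ≡ x * x + (x + t) * (x + t)
  lem = solve-∀
... | inj₂ y≤x with t , refl ← m≤n⇒∃[o]m+o≡n y≤x =
  ≤-trans (m≤m+n _ (t * t)) (≤-reflexive (lem y t))
  where
  lem : ∀ x t → 2 * (x + t) * x + t * t ≡ (x + t) * (x + t) + x * x
  lem = solve-∀

-- The difference of the two sides is the sum of (x - y)² * esym b over the ways of removing an
-- element y from xs.
usym-square : ∀ b x xs →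
  2 * suc b * x * esym (suc b) xs + suc b * (x * x) * esym b xs ≤
  suc (length xs) * (x * x) * esym b xs + usym (suc b) xs
usym-square zero x [] = ≤-reflexive (lem x)
  where
  lem : ∀ x → 2 * 1 * x * 0 + 1 * (x * x) * 1 ≡ 1 * (x * x) * 1 + 0
  lem = solve-∀
usym-square (suc b) x [] = ≤-trans (≤-reflexive (lem b x)) z≤n
  where
  lem : ∀ b x → 2 * (2 + b) * x * 0 + (2 + b) * (x * x) * 0 ≡ 0
  lem = solve-∀
usym-square zero x (y ∷ xs) = ≤-trans (≤-reflexive (lem₁ x y (esym 1 xs)))
  (≤-trans (+-mono-≤ (usym-square zero x xs) (2xy≤x²+y² x y))
  (≤-reflexive (lem₂ x y (length xs) (usym 1 xs))))
  where
  lem₁ : ∀ x y e → 2 * 1 * x * (e + y * 1) + 1 * (x * x) * 1 ≡ 2 * 1 * x * e + 1 * (x * x) * 1 + 2 * x * y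
  lem₁ = solve-∀
  lem₂ : ∀ x y n u → suc n * (x * x) * 1 + u + (x * x + y * y) ≡ (2 + n) * (x * x) * 1 + (u + y * 0 + y * y * 1)
  lem₂ = solve-∀
usym-square (suc b) x (y ∷ xs) = ≤-trans
  (≤-reflexive (lem₁ x y b (esym b xs) (esym (suc b) xs) (esym (2 + b) xs)))
  (≤-trans (+-monoʳ-≤ (x * x * (y * esym b xs)) (+-mono-≤
    (+-mono-≤ (usym-square (suc b) x xs) (*-monoʳ-≤ y (usym-square b x xs)))
    (*-monoˡ-≤ (esym (suc b) xs) (2xy≤x²+y² x y))))
  (≤-reflexive (lem₂ x y (length xs) (esym b xs) (esym (suc b) xs) (usym (suc b) xs) (usym (2 + b) xs))))
  where
  lem₁ : ∀ x y b e₀ e₁ e₂ →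
    2 * (2 + b) * x * (e₂ + y * e₁) + (2 + b) * (x * x) * (e₁ + y * e₀) ≡
    x * x * (y * e₀) +
    ((2 * (2 + b) * x * e₂ + (2 + b) * (x * x) * e₁)
    + y * (2 * suc b * x * e₁ + suc b * (x * x) * e₀)
    + 2 * x * y * e₁)
  lem₁ = solve-∀
  lem₂ : ∀ x y n e₀ e₁ u₁ u₂ →
    x * x * (y * e₀) + ((suc n * (x * x) * e₁ + u₂) + y * (suc n * (x * x) * e₀ + u₁) + (x * x + y * y) * e₁) ≡
    (2 + n) * (x * x) * (e₁ + y * e₀) + (u₂ + y * u₁ + y * y * e₁)
  lem₂ = solve-∀

-- Adding x to the list leaves both induction hypotheses and one spare term x σ e_b. Once `sum*esym`
-- has rewritten that term, the remaining quadratic terms are exactly those of `usym-square`.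
esym-usym : ∀ b xs → b * (sum xs * esym b xs) ≤ length xs * usym b xs
esym-usym zero    xs       = z≤n
esym-usym (suc b) []       = ≤-reflexive (*-zeroʳ b)
esym-usym (suc b) (x ∷ xs) = ≤-trans
  (≤-reflexive (lem₁ b x (sum xs) (esym b xs) (esym (suc b) xs)))
  (≤-trans (+-monoʳ-≤ _ (≤-reflexive (cong (x *_) (sum*esym b xs))))
  (≤-trans (≤-reflexive (lem₂ b x (sum xs) (esym b xs) (esym (suc b) xs) (usym b xs)))
  (≤-trans (+-monoˡ-≤ (x * usym b xs) (+-mono-≤ (+-mono-≤ (esym-usym (suc b) xs) (*-monoʳ-≤ x (esym-usym b xs))) (usym-square b x xs)))
  (≤-reflexive (lem₃ x (length xs) (esym b xs) (usym b xs) (usym (suc b) xs))))))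
  where
  lem₁ : ∀ b x s e₀ e₁ → suc b * ((x + s) * (e₁ + x * e₀)) ≡
    suc b * (s * e₁) + x * (b * (s * e₀)) + suc b * x * e₁ + suc b * (x * x) * e₀ + x * (s * e₀)
  lem₁ = solve-∀
  lem₂ : ∀ b x s e₀ e₁ u₀ →
    suc b * (s * e₁) + x * (b * (s * e₀)) + suc b * x * e₁ + suc b * (x * x) * e₀ + x * (suc b * e₁ + u₀) ≡
    suc b * (s * e₁) + x * (b * (s * e₀)) + (2 * suc b * x * e₁ + suc b * (x * x) * e₀) + x * u₀
  lem₂ = solve-∀
  lem₃ : ∀ x n e₀ u₀ u₁ →
    n * u₁ + x * (n * u₀) + (suc n * (x * x) * e₀ + u₁) + x * u₀ ≡
    suc n * (u₁ + x * u₀ + x * x * e₀)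
  lem₃ = solve-∀

-- This is (b + 1) n e_(b+1) ≤ (n - b) σ e_b without subtraction; `sum*esym` trades the term
-- `usym b xs` of `esym-usym` for e_(b+1).
newton : ∀ b xs → length xs * (suc b * esym (suc b) xs) + b * (sum xs * esym b xs) ≤ length xs * (sum xs * esym b xs)
newton b xs = ≤-trans (+-monoʳ-≤ _ (esym-usym b xs)) (≤-reflexive
  (trans (sym (*-distribˡ-+ (length xs) _ _)) (cong (length xs *_) (sym (sum*esym b xs)))))

-- The binomial coefficient as a symmetric sum at equal arguments: its recurrence `binom-step` is
-- then an instance of `sum*esym`, the equality case of `newton`. It is identified with `_C_` in
-- `binom≡C`.
binom : ℕ → ℕ → ℕ
binom n b = esym b (replicate n 1)

usym-ones : ∀ n b → usym b (replicate n 1) ≡ b * binom n b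
usym-ones n       zero    = refl
usym-ones zero    (suc b) = sym (*-zeroʳ b)
usym-ones (suc n) (suc b) = trans
  (cong₂ (λ u v → u + 1 * v + 1 * binom n b) (usym-ones n (suc b)) (usym-ones n b))
  (lem b (binom n b) (binom n (suc b)))
  where
  lem : ∀ b e₀ e₁ → suc b * e₁ + 1 * (b * e₀) + 1 * e₀ ≡ suc b * (e₁ + 1 * e₀)
  lem = solve-∀

sum-ones : ∀ n → sum (replicate n 1) ≡ n
sum-ones zero    = refl
sum-ones (suc n) = cong suc (sum-ones n)

binom-step : ∀ n b → suc b * binom n (suc b) + b * binom n b ≡ n * binom n b
binom-step n b = trans (cong (_+_ (suc b * binom n (suc b))) (sym (usym-ones n b)))
  (trans (sym (sum*esym b (replicate n 1))) (cong (_* binom n b) (sum-ones n)))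

binom>0 : ∀ n b → b ≤ n → 0 < binom n b
binom>0 n       zero    _         = s≤s z≤n
binom>0 (suc n) (suc b) (s≤s b≤n) =
  ≤-trans (binom>0 n b b≤n) (≤-trans (≤-reflexive (sym (*-identityˡ _))) (m≤n+m _ (binom n (suc b))))

-- The means esym b xs / binom n b satisfy mean (1 + b) ≤ (sum xs / n) * mean b.
esym-mean : ∀ b xs → b < length xs →
  length xs * (binom (length xs) b * esym (suc b) xs) ≤ sum xs * (esym b xs * binom (length xs) (suc b))
esym-mean b xs b<n with t , eq ← m≤n⇒∃[o]m+o≡n b<n = *-cancelˡ-≤ (suc b * suc t) (begin
  suc b * suc t * (n * (B₀ * e₁))                      ≡⟨ lem₁ b t n B₀ e₁ ⟩
  suc t * B₀ * (n * (suc b * e₁))                      ≤⟨ *-monoʳ-≤ (suc t * B₀) step ⟩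
  suc t * B₀ * (suc t * (σ * e₀))                      ≡⟨ lem₂ t B₀ σ e₀ ⟩
  suc t * (σ * e₀) * (suc t * B₀)                      ≡⟨ cong (suc t * (σ * e₀) *_) (sym Bstep) ⟩
  suc t * (σ * e₀) * (suc b * B₁)                      ≡⟨ lem₃ b t σ e₀ B₁ ⟩
  suc b * suc t * (σ * (e₀ * B₁))                      ∎)
  where
  open ≤-Reasoning
  n = length xs
  σ = sum xs
  e₀ = esym b xs
  e₁ = esym (suc b) xs
  B₀ = binom n b
  B₁ = binom n (suc b)
  n≡ : n ≡ b + suc t
  n≡ = trans (sym eq) (sym (+-suc b t))
  split : ∀ m → n * m ≡ suc t * m + b * m
  split m = trans (cong (_* m) (trans n≡ (+-comm b (suc t)))) (*-distribʳ-+ m (suc t) b)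
  step : n * (suc b * e₁) ≤ suc t * (σ * e₀)
  step = +-cancelʳ-≤ (b * (σ * e₀)) _ _ (≤-trans (newton b xs) (≤-reflexive (split (σ * e₀))))
  Bstep : suc b * B₁ ≡ suc t * B₀
  Bstep = +-cancelʳ-≡ (b * B₀) _ _ (trans (binom-step n b) (split B₀))
  lem₁ : ∀ b t n B e → suc b * suc t * (n * (B * e)) ≡ suc t * B * (n * (suc b * e))
  lem₁ = solve-∀
  lem₂ : ∀ t B s e → suc t * B * (suc t * (s * e)) ≡ suc t * (s * e) * (suc t * B)
  lem₂ = solve-∀
  lem₃ : ∀ b t s e B → suc t * (s * e) * (suc b * B) ≡ suc b * suc t * (s * (e * B))
  lem₃ = solve-∀

-- Muirhead's inequality for balanced exponents

-- The expanded form of (f - f′) (g - g′) ≥ 0. Chebyshev's inequality is the sum of these over all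
-- pairs, so no sorting of the list is involved.
SimilarlyOrdered : ℕ × ℕ → ℕ × ℕ → Set
SimilarlyOrdered (f , g) (f′ , g′) = f * g′ + f′ * g ≤ f * g + f′ * g′

similarlyOrdered : ∀ {f g f′ g′} → f ≤ f′ → g ≤ g′ → SimilarlyOrdered (f , g) (f′ , g′)
similarlyOrdered {f} {g} f≤f′ g≤g′
  with s , refl ← m≤n⇒∃[o]m+o≡n f≤f′ | t , refl ← m≤n⇒∃[o]m+o≡n g≤g′ =
  ≤-trans (m≤m+n _ (s * t)) (≤-reflexive (lem f g s t))
  where
  lem : ∀ f g s t → f * (g + t) + (f + s) * g + s * t ≡ f * g + (f + s) * (g + t)
  lem = solve-∀

similarlyOrdered-sym : ∀ {p q} → SimilarlyOrdered p q → SimilarlyOrdered q p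
similarlyOrdered-sym {f , g} {f′ , g′} =
  subst₂ _≤_ (+-comm (f * g′) (f′ * g)) (+-comm (f * g) (f′ * g′))

chebyshev : ∀ {ps} → AllPairs SimilarlyOrdered ps →
  sum (map proj₁ ps) * sum (map proj₂ ps) ≤ length ps * sum (map (λ p → proj₁ p * proj₂ p) ps)
chebyshev []                                  = z≤n
chebyshev (_∷_ {f , g} {ps} so sos) = ≤-trans (≤-reflexive (lem₁ f g (sum (map proj₁ ps)) (sum (map proj₂ ps))))
  (≤-trans (+-monoˡ-≤ _ (+-mono-≤ (chebyshev sos) (cross f g so)))
  (≤-reflexive (lem₂ f g (length ps) (sum (map (λ p → proj₁ p * proj₂ p) ps)))))
  where
  lem₁ : ∀ f g F G → (f + F) * (g + G) ≡ F * G + (f * G + F * g) + f * g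
  lem₁ = solve-∀
  lem₂ : ∀ f g n H → n * H + (n * (f * g) + H) + f * g ≡ suc n * (f * g + H)
  lem₂ = solve-∀
  lem₃ : ∀ f g f′ g′ F G → f * (g′ + G) + (f′ + F) * g ≡ f * g′ + f′ * g + (f * G + F * g)
  lem₃ = solve-∀
  lem₄ : ∀ f g n fg′ H → f * g + fg′ + (n * (f * g) + H) ≡ suc n * (f * g) + (fg′ + H)
  lem₄ = solve-∀
  cross : ∀ f g {ps} → All (SimilarlyOrdered (f , g)) ps →
    f * sum (map proj₂ ps) + sum (map proj₁ ps) * g ≤
    length ps * (f * g) + sum (map (λ p → proj₁ p * proj₂ p) ps)
  cross f g []                        = ≤-reflexive (trans (+-identityʳ _) (*-zeroʳ f))
  cross f g (_∷_ {f′ , g′} {ps} p ps′) = ≤-trans (≤-reflexive (lem₃ f g f′ g′ (sum (map proj₁ ps)) (sum (map proj₂ ps))))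
    (≤-trans (+-mono-≤ p (cross f g ps′))
    (≤-reflexive (lem₄ f g (length ps) (f′ * g′) (sum (map (λ p → proj₁ p * proj₂ p) ps)))))

powerSum : ℕ → List ℕ → ℕ
powerSum k xs = sum (map (_^ k) xs)

-- The pairs (x , x ^ k * c) with x in xs and c the sum of r and the other elements of xs.
withComplement : ℕ → ℕ → List ℕ → List (ℕ × ℕ)
withComplement k r []       = []
withComplement k r (x ∷ xs) = (x , x ^ k * (r + sum xs)) ∷ withComplement k (r + x) xs

rsum : ℕ → ℕ → List ℕ → ℕ
rsum k r xs = sum (map proj₂ (withComplement k r xs))

rsum-powerSum : ∀ k r xs → rsum k r xs + powerSum (suc k) xs ≡ (r + sum xs) * powerSum k xs
rsum-powerSum k r []       = sym (*-zeroʳ (r + 0))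
rsum-powerSum k r (x ∷ xs) = trans (lem₁ r x (sum xs) (x ^ k) (rsum k (r + x) xs) (powerSum (suc k) xs))
  (trans (cong (_+_ (x ^ k * (r + x + sum xs))) (rsum-powerSum k (r + x) xs))
         (lem₂ r x (sum xs) (x ^ k) (powerSum k xs)))
  where
  lem₁ : ∀ r x s y R p → y * (r + s) + R + (x * y + p) ≡ y * (r + x + s) + (R + p)
  lem₁ = solve-∀
  lem₂ : ∀ r x s y p → y * (r + x + s) + (r + x + s) * p ≡ (r + (x + s)) * (y + p)
  lem₂ = solve-∀

map-proj₁-withComplement : ∀ k r xs → map proj₁ (withComplement k r xs) ≡ xs
map-proj₁-withComplement k r []       = refl
map-proj₁-withComplement k r (x ∷ xs) = cong (x ∷_) (map-proj₁-withComplement k (r + x) xs)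

rsum-suc : ∀ k r xs → sum (map (λ p → proj₁ p * proj₂ p) (withComplement k r xs)) ≡ rsum (suc k) r xs
rsum-suc k r []       = refl
rsum-suc k r (x ∷ xs) = cong₂ _+_ (sym (*-assoc x (x ^ k) _)) (rsum-suc k (r + x) xs)

-- The weight x^(k+1) (σ - x) is not monotone on [0, σ], but two entries x, y of the list leave σ =
-- x + y + t, and then the weights differ by x y (y^k - x^k) + t (y^(k+1) - x^(k+1)). The exponent
-- has to be positive: σ - x alone is decreasing.
withComplement-similarlyOrdered : ∀ k r xs → AllPairs SimilarlyOrdered (withComplement (suc k) r xs)
withComplement-similarlyOrdered k r []       = []
withComplement-similarlyOrdered k r (x ∷ xs) =
  All.map (λ (c , c+y≡ , r+x≤c , g≡) → ordered c+y≡ r+x≤c g≡) (shape (r + x) xs) ∷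
  withComplement-similarlyOrdered k (r + x) xs
  where
  Shape : ℕ → ℕ → ℕ × ℕ → Set
  Shape r t (y , g) = ∃[ c ] (c + y ≡ t × r ≤ c × g ≡ y ^ suc k * c)
  shape : ∀ r xs → All (Shape r (r + sum xs)) (withComplement (suc k) r xs)
  shape r []       = []
  shape r (y ∷ ys) = (r + sum ys , lem r y (sum ys) , m≤m+n _ _ , refl) ∷
    All.map (λ (c , eq , r+y≤c , g≡) → c , trans eq (+-assoc r y (sum ys)) , ≤-trans (m≤m+n r y) r+y≤c , g≡)
            (shape (r + y) ys)
    where
    lem : ∀ r y s → r + s + y ≡ r + (y + s)
    lem = solve-∀
  -- x ^ (1 + k) * (t - x) increases with x as long as the two elements x, y satisfy x + y ≤ t.
  mono : ∀ {x y} t → x ≤ y → x ^ suc k * (y + t) ≤ y ^ suc k * (x + t)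
  mono {x} {y} t x≤y = begin
    x * x ^ k * (y + t)                 ≡⟨ lem x y t (x ^ k) ⟩
    x * y * x ^ k + t * (x * x ^ k)
      ≤⟨ +-mono-≤ (*-monoʳ-≤ (x * y) (^-monoˡ-≤ k x≤y)) (*-monoʳ-≤ t (^-monoˡ-≤ (suc k) x≤y)) ⟩
    x * y * y ^ k + t * (y * y ^ k)     ≡⟨ lem′ x y t (y ^ k) ⟩
    y * y ^ k * (x + t)                 ∎
    where
    open ≤-Reasoning
    lem : ∀ x y t z → x * z * (y + t) ≡ x * y * z + t * (x * z)
    lem = solve-∀
    lem′ : ∀ x y t z → x * y * z + t * (y * z) ≡ y * z * (x + t)
    lem′ = solve-∀
  lem₁ : ∀ r x s → x + (r + s) ≡ r + x + s
  lem₁ = solve-∀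
  lem₂ : ∀ x y t → x + t + y ≡ x + (y + t)
  lem₂ = solve-∀
  ordered : ∀ {y g c} → c + y ≡ r + x + sum xs → r + x ≤ c → g ≡ y ^ suc k * c →
            SimilarlyOrdered (x , x ^ suc k * (r + sum xs)) (y , g)
  ordered {y} {_} {c} eq r+x≤c refl
    -- The complement c of y contains x; t is the sum of everything besides x and y.
    with t , refl ← m≤n⇒∃[o]m+o≡n (≤-trans (m≤n+m x r) r+x≤c)
    with c≡ ← +-cancelˡ-≡ x (r + sum xs) (y + t) (trans (lem₁ r x (sum xs)) (trans (sym eq) (lem₂ x y t)))
    rewrite c≡ with ≤-total x y
  ... | inj₁ x≤y = similarlyOrdered x≤y (mono t x≤y)
  ... | inj₂ y≤x = similarlyOrdered-sym {y , y ^ suc k * (x + t)} {x , x ^ suc k * (y + t)} (similarlyOrdered y≤x (mono t y≤x))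

length-withComplement : ∀ k r xs → length (withComplement k r xs) ≡ length xs
length-withComplement k r []       = refl
length-withComplement k r (x ∷ xs) = cong suc (length-withComplement k (r + x) xs)

-- Chebyshev's inequality for x and its weight x^(k+1) (σ - x): multiplying the weight by x raises
-- the exponent by one.
rsum-mean : ∀ k r xs → sum xs * rsum (suc k) r xs ≤ length xs * rsum (2 + k) r xs
rsum-mean k r xs = subst₂ _≤_
  (cong (λ ys → sum ys * rsum (suc k) r xs) (map-proj₁-withComplement (suc k) r xs))
  (cong₂ _*_ (length-withComplement (suc k) r xs) (rsum-suc (suc k) r xs))
  (chebyshev (withComplement-similarlyOrdered k r xs))

-- d ^ suc j ∸ d
excess : ℕ → ℕ → ℕ
excess d zero    = 0
excess d (suc j) = d * excess d j + d * (d ∸ 1)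

excess-^ : ∀ d j → excess d j + d ≡ d ^ suc j
excess-^ zero    zero    = refl
excess-^ zero    (suc j) = refl
excess-^ (suc d) zero    = sym (*-identityʳ _)
excess-^ (suc d) (suc j) = trans (lem d (excess (suc d) j)) (cong (suc d *_) (excess-^ (suc d) j))
  where
  lem : ∀ d x → suc d * x + suc d * d + suc d ≡ suc d * (x + suc d)
  lem = solve-∀

esym-1 : ∀ xs → esym 1 xs ≡ sum xs
esym-1 []       = refl
esym-1 (x ∷ xs) = trans (cong₂ _+_ (esym-1 xs) (*-identityʳ x)) (+-comm (sum xs) x)

usym-1 : ∀ xs → usym 1 xs ≡ powerSum 2 xs
usym-1 []       = refl
usym-1 (x ∷ xs) = trans (cong (λ u → u + x * 0 + x * x * 1) (usym-1 xs)) (lem x (powerSum 2 xs))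
  where
  lem : ∀ x p → p + x * 0 + x * x * 1 ≡ x * (x * 1) + p
  lem = solve-∀

powerSum-1 : ∀ xs → powerSum 1 xs ≡ sum xs
powerSum-1 []       = refl
powerSum-1 (x ∷ xs) = cong₂ _+_ (*-identityʳ x) (powerSum-1 xs)

square-sum : ∀ xs → sum xs * sum xs ≡ 2 * esym 2 xs + powerSum 2 xs
square-sum xs = trans (cong (sum xs *_) (sym (esym-1 xs)))
  (trans (sum*esym 1 xs) (cong (_+_ (2 * esym 2 xs)) (usym-1 xs)))

-- The symmetric means of the balanced monomials, scaled by the number B of monomials: N is
-- product xs ^ s * esym b xs, of degree 2 + j = d * s + b.
BalancedBound : List ℕ → ℕ → ℕ → ℕ → Set
BalancedBound xs j N B =
  N * excess n (suc j) + B * powerSum (2 + j) xs ≤ B * sum xs ^ (2 + j) ×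
  n * (n ∸ 1) * N ≤ B * rsum (suc j) 0 xs
  where n = length xs

-- The hypothesis on N′ and B′ says that the mean N / B grows by at most σ / n. The second bound
-- survives because `rsum-mean` provides the same factor. For the first, the gap σ^k - p_k is
-- multiplied by σ and gains the sum that the second bound controls; the two contributions n *
-- excess and n (n - 1) are the recurrence of `excess`.
balancedBound-step : ∀ xs j {N B N′ B′} → 0 < length xs → 0 < B →
  length xs * (B * N′) ≤ sum xs * (N * B′) → BalancedBound xs j N B → BalancedBound xs (suc j) N′ B′
balancedBound-step xs j {N} {B} {N′} {B′} 0<n 0<B mean (S , T) = S′ , T′
  where
  open ≤-Reasoning
  n = length xs
  σ = sum xs
  R = rsum (suc j) 0 xs
  R′ = rsum (2 + j) 0 xs
  n₂ = n * (n ∸ 1)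
  ex = excess n (suc j)
  p = powerSum (2 + j) xs
  p′ = powerSum (3 + j) xs
  instance
    n≢0 : NonZero n
    n≢0 = >-nonZero 0<n
    B≢0 : NonZero B
    B≢0 = >-nonZero 0<B
  T′ : n₂ * N′ ≤ B′ * R′
  T′ = *-cancelˡ-≤ n (*-cancelˡ-≤ B (begin
    B * (n * (n₂ * N′))     ≡⟨ lem₁ B n n₂ N′ ⟩
    n₂ * (n * (B * N′))     ≤⟨ *-monoʳ-≤ n₂ mean ⟩
    n₂ * (σ * (N * B′))     ≡⟨ lem₂ n₂ σ N B′ ⟩
    σ * B′ * (n₂ * N)       ≤⟨ *-monoʳ-≤ (σ * B′) T ⟩
    σ * B′ * (B * R)        ≡⟨ lem₃ σ B′ B R ⟩
    B * B′ * (σ * R)        ≤⟨ *-monoʳ-≤ (B * B′) (rsum-mean j 0 xs) ⟩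
    B * B′ * (n * R′)       ≡⟨ lem₄ B B′ n R′ ⟩
    B * (n * (B′ * R′))     ∎))
    where
    lem₁ : ∀ B n m N → B * (n * (m * N)) ≡ m * (n * (B * N))
    lem₁ = solve-∀
    lem₂ : ∀ m s N B → m * (s * (N * B)) ≡ s * B * (m * N)
    lem₂ = solve-∀
    lem₃ : ∀ s B′ B R → s * B′ * (B * R) ≡ B * B′ * (s * R)
    lem₃ = solve-∀
    lem₄ : ∀ B B′ n R → B * B′ * (n * R) ≡ B * (n * (B′ * R))
    lem₄ = solve-∀
  S′ : N′ * excess n (2 + j) + B′ * p′ ≤ B′ * σ ^ (3 + j)
  S′ = *-cancelˡ-≤ B (begin
    B * (N′ * (n * ex + n₂) + B′ * p′)                  ≡⟨ lem₁ B N′ n ex n₂ B′ p′ ⟩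
    ex * (n * (B * N′)) + B * (n₂ * N′) + B * (B′ * p′)
      ≤⟨ +-monoˡ-≤ _ (+-mono-≤ (*-monoʳ-≤ ex mean) (*-monoʳ-≤ B T′)) ⟩
    ex * (σ * (N * B′)) + B * (B′ * R′) + B * (B′ * p′) ≡⟨ lem₂ ex σ N B B′ R′ p′ ⟩
    ex * (σ * (N * B′)) + B * B′ * (R′ + p′)
      ≡⟨ cong (λ z → ex * (σ * (N * B′)) + B * B′ * z) (rsum-powerSum (2 + j) 0 xs) ⟩
    ex * (σ * (N * B′)) + B * B′ * (σ * p)              ≡⟨ lem₃ ex σ N B B′ p ⟩
    σ * B′ * (N * ex + B * p)                           ≤⟨ *-monoʳ-≤ (σ * B′) S ⟩
    σ * B′ * (B * σ ^ (2 + j))                          ≡⟨ lem₄ σ B′ B (σ ^ (2 + j)) ⟩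
    B * (B′ * σ ^ (3 + j))                              ∎)
    where
    lem₁ : ∀ B N′ n ex m B′ p → B * (N′ * (n * ex + m) + B′ * p) ≡ ex * (n * (B * N′)) + B * (m * N′) + B * (B′ * p)
    lem₁ = solve-∀
    lem₂ : ∀ ex s N B B′ R p → ex * (s * (N * B′)) + B * (B′ * R) + B * (B′ * p) ≡ ex * (s * (N * B′)) + B * B′ * (R + p)
    lem₂ = solve-∀
    lem₃ : ∀ ex s N B B′ p → ex * (s * (N * B′)) + B * B′ * (s * p) ≡ s * B′ * (N * ex + B * p)
    lem₃ = solve-∀
    lem₄ : ∀ s B′ B q → s * B′ * (B * q) ≡ B * (B′ * (s * q))
    lem₄ = solve-∀

n[n∸1]≡2binom : ∀ n → n * (n ∸ 1) ≡ 2 * binom n 2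
n[n∸1]≡2binom zero    = refl
n[n∸1]≡2binom (suc n) = +-cancelʳ-≡ (suc n) _ _ (trans (lem n) (sym
  (subst (λ m → 2 * binom (suc n) 2 + m ≡ suc n * m) (trans (esym-1 (replicate (suc n) 1)) (sum-ones (suc n)))
    (trans (cong (_+_ (2 * binom (suc n) 2)) (sym (*-identityˡ _))) (binom-step (suc n) 1)))))
  where
  lem : ∀ n → suc n * n + suc n ≡ suc n * suc n
  lem = solve-∀

-- In degree 2 both bounds are equalities, by σ² = 2 e₂ + p₂.
balancedBound-2 : ∀ xs → BalancedBound xs 0 (1 * esym 2 xs) (binom (length xs) 2)
balancedBound-2 xs = ≤-reflexive S , ≤-reflexive T
  where
  open ≡-Reasoning
  n = length xs
  B = binom n 2
  R≡ : rsum 1 0 xs ≡ 2 * esym 2 xs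
  R≡ = +-cancelʳ-≡ (powerSum 2 xs) _ _ (trans (rsum-powerSum 1 0 xs)
    (trans (cong (sum xs *_) (powerSum-1 xs)) (square-sum xs)))
  T : n * (n ∸ 1) * (1 * esym 2 xs) ≡ B * rsum 1 0 xs
  T = begin
    n * (n ∸ 1) * (1 * esym 2 xs)   ≡⟨ cong (_* (1 * esym 2 xs)) (n[n∸1]≡2binom n) ⟩
    2 * B * (1 * esym 2 xs)         ≡⟨ lem B (esym 2 xs) ⟩
    B * (2 * esym 2 xs)             ≡⟨ cong (B *_) R≡ ⟨
    B * rsum 1 0 xs                 ∎
    where
    lem : ∀ B e → 2 * B * (1 * e) ≡ B * (2 * e)
    lem = solve-∀
  S : 1 * esym 2 xs * excess n 1 + B * powerSum 2 xs ≡ B * sum xs ^ 2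
  S = begin
    1 * esym 2 xs * (n * 0 + n * (n ∸ 1)) + B * powerSum 2 xs
      ≡⟨ cong (λ z → 1 * esym 2 xs * (n * 0 + z) + B * powerSum 2 xs) (n[n∸1]≡2binom n) ⟩
    1 * esym 2 xs * (n * 0 + 2 * B) + B * powerSum 2 xs
      ≡⟨ lem₁ (esym 2 xs) n B (powerSum 2 xs) ⟩
    B * (2 * esym 2 xs + powerSum 2 xs)
      ≡⟨ cong (B *_) (square-sum xs) ⟨
    B * (sum xs * sum xs)
      ≡⟨ lem₂ B (sum xs) ⟩
    B * (sum xs * (sum xs * 1)) ∎
    where
    lem₁ : ∀ e n B p → 1 * e * (n * 0 + 2 * B) + B * p ≡ B * (2 * e + p)
    lem₁ = solve-∀
    lem₂ : ∀ B s → B * (s * s) ≡ B * (s * (s * 1))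
    lem₂ = solve-∀

esym->length : ∀ b xs → length xs < b → esym b xs ≡ 0
esym->length (suc b) []       _         = refl
esym->length (suc b) (x ∷ xs) (s≤s n<b) =
  trans (cong₂ (λ u v → u + x * v) (esym->length (suc b) xs (m<n⇒m<1+n n<b)) (esym->length b xs n<b)) (*-zeroʳ x)

esym-length : ∀ xs → esym (length xs) xs ≡ product xs
esym-length []       = refl
esym-length (x ∷ xs) = cong₂ (λ u v → u + x * v) (esym->length (suc (length xs)) xs ≤-refl) (esym-length xs)

product-ones : ∀ n → product (replicate n 1) ≡ 1
product-ones zero    = refl
product-ones (suc n) = trans (*-identityˡ _) (product-ones n)

binom-n : ∀ n → binom n n ≡ 1
binom-n n = trans (subst (λ m → esym n (replicate n 1) ≡ esym m (replicate n 1)) (sym (length-replicate n)) refl)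
  (trans (esym-length (replicate n 1)) (product-ones n))

-- The degree rises from 2 by increasing b at fixed s. At b = n the monomial is complete, and
-- product^s * e_n is read as product^(s+1) * e_0 to start the next s; the clause for `suc s` and
-- `zero` undoes this.
balancedBound : ∀ xs s b j → 2 ≤ length xs → b ≤ length xs → length xs * s + b ≡ 2 + j →
  BalancedBound xs j (product xs ^ s * esym b xs) (binom (length xs) b)
balancedBound xs zero zero j _ _ eq with () ← trans (sym eq) (trans (+-identityʳ _) (*-zeroʳ (length xs)))
balancedBound xs zero (suc zero) j _ _ eq with () ← trans (sym eq) (cong (_+ 1) (*-zeroʳ (length xs)))
balancedBound xs zero (suc (suc zero)) j _ _ eq
  with refl ← trans (sym (cong (_+ 2) (*-zeroʳ (length xs)))) eq = balancedBound-2 xs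
balancedBound xs (suc s) zero j 2≤n _ eq =
  subst₂ (BalancedBound xs j) (trans (cong (product xs ^ s *_) (esym-length xs))
      (trans (*-comm (product xs ^ s) (product xs)) (sym (*-identityʳ _))))
    (binom-n (length xs))
    (balancedBound xs s (length xs) j 2≤n ≤-refl (trans (lem (length xs) s) eq))
  where
  lem : ∀ n s → n * s + n ≡ n * suc s + 0
  lem = solve-∀
balancedBound xs zero (suc (suc (suc b))) zero _ _ eq
  with () ← trans (sym (cong (_+ (3 + b)) (*-zeroʳ (length xs)))) eq
balancedBound xs (suc s) (suc b) zero 2≤n _ eq = contradiction (≤-reflexive eq) (<⇒≱
  (≤-trans (≤-reflexive (+-comm 1 2)) (+-mono-≤ (≤-trans 2≤n (m≤m*n (length xs) (suc s))) (s≤s z≤n))))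
balancedBound xs s (suc b) (suc j) 2≤n b<n eq =
  balancedBound-step xs j (≤-trans (s≤s z≤n) 2≤n) (binom>0 (length xs) b (<⇒≤ b<n))
    (begin
      n * (binom n b * (product xs ^ s * esym (suc b) xs))
        ≡⟨ lem₁ n (binom n b) (product xs ^ s) (esym (suc b) xs) ⟩
      product xs ^ s * (n * (binom n b * esym (suc b) xs))
        ≤⟨ *-monoʳ-≤ (product xs ^ s) (esym-mean b xs b<n) ⟩
      product xs ^ s * (sum xs * (esym b xs * binom n (suc b)))
        ≡⟨ lem₂ (sum xs) (product xs ^ s) (esym b xs) (binom n (suc b)) ⟩
      sum xs * (product xs ^ s * esym b xs * binom n (suc b))  ∎)
    (balancedBound xs s b j 2≤n (<⇒≤ b<n) (suc-injective (trans (sym (+-suc (n * s) b)) eq)))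
  where
  open ≤-Reasoning
  n = length xs
  lem₁ : ∀ n B P e → n * (B * (P * e)) ≡ P * (n * (B * e))
  lem₁ = solve-∀
  lem₂ : ∀ σ P e B → P * (σ * (e * B)) ≡ σ * (P * e * B)
  lem₂ = solve-∀

-- Summing over sets of leaves

module ≅↭ = PermutationProperties ≅-setoid

𝟙 : {P : Set} → Dec P → ℕ
𝟙 (yes _) = 1
𝟙 (no _)  = 0

𝟙-yes : {P : Set} (p? : Dec P) → P → 𝟙 p? ≡ 1
𝟙-yes (yes _) _ = refl
𝟙-yes (no ¬p) p = contradiction p ¬p

𝟙-no : {P : Set} (p? : Dec P) → ¬ P → 𝟙 p? ≡ 0
𝟙-no (yes p) ¬p = contradiction p ¬p
𝟙-no (no _)  _  = refl

𝟙-cong : {P Q : Set} (p? : Dec P) (q? : Dec Q) → (P → Q) → (Q → P) → 𝟙 p? ≡ 𝟙 q?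
𝟙-cong p? (yes q) f g = 𝟙-yes p? (g q)
𝟙-cong p? (no ¬q) f g = 𝟙-no p? (¬q ∘ f)

sumSubsets : ∀ n → (Subset n → ℕ) → ℕ
sumSubsets zero    f = f []
sumSubsets (suc n) f = sumSubsets n (f ∘ (outside ∷_)) + sumSubsets n (f ∘ (inside ∷_))

sumSubsets-cong : ∀ n {f g : Subset n → ℕ} → (∀ S → f S ≡ g S) → sumSubsets n f ≡ sumSubsets n g
sumSubsets-cong zero    eq = eq []
sumSubsets-cong (suc n) eq = cong₂ _+_ (sumSubsets-cong n λ S → eq (outside ∷ S)) (sumSubsets-cong n λ S → eq (inside ∷ S))

sumSubsets-+ : ∀ n (f g : Subset n → ℕ) → sumSubsets n (λ S → f S + g S) ≡ sumSubsets n f + sumSubsets n g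
sumSubsets-+ zero    f g = refl
sumSubsets-+ (suc n) f g = trans
  (cong₂ _+_ (sumSubsets-+ n (f ∘ (outside ∷_)) (g ∘ (outside ∷_))) (sumSubsets-+ n (f ∘ (inside ∷_)) (g ∘ (inside ∷_))))
  (lem (sumSubsets n (f ∘ (outside ∷_))) (sumSubsets n (g ∘ (outside ∷_))) (sumSubsets n (f ∘ (inside ∷_))) (sumSubsets n (g ∘ (inside ∷_))))
  where
  lem : ∀ a b c d → (a + b) + (c + d) ≡ (a + c) + (b + d)
  lem = solve-∀

sumSubsets-* : ∀ n (f : Subset n → ℕ) y → sumSubsets n (λ S → f S * y) ≡ sumSubsets n f * y
sumSubsets-* zero    f y = refl
sumSubsets-* (suc n) f y = trans
  (cong₂ _+_ (sumSubsets-* n (f ∘ (outside ∷_)) y) (sumSubsets-* n (f ∘ (inside ∷_)) y))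
  (sym (*-distribʳ-+ y (sumSubsets n (f ∘ (outside ∷_))) _))

sumSubsets-++ : ∀ m n (f : Subset (m + n) → ℕ) →
  sumSubsets (m + n) f ≡ sumSubsets m (λ A → sumSubsets n (λ B → f (A ++ B)))
sumSubsets-++ zero    n f = refl
sumSubsets-++ (suc m) n f = cong₂ _+_ (sumSubsets-++ m n (f ∘ (outside ∷_))) (sumSubsets-++ m n (f ∘ (inside ∷_)))

length-filter : {A : Set} {P : A → Set} (P? : Decidable P) → ∀ xs → length (filter P? xs) ≡ sum (map (𝟙 ∘ P?) xs)
length-filter P? []       = refl
length-filter P? (x ∷ xs) with P? x
... | yes _ = cong suc (length-filter P? xs)
... | no  _ = length-filter P? xs

sum-subsets : ∀ n (f : Subset n → ℕ) → sum (map f (subsets n)) ≡ sumSubsets n f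
sum-subsets zero    f = +-identityʳ _
sum-subsets (suc n) f = begin
  sum (map f (map (outside ∷_) (subsets n) List.++ map (inside ∷_) (subsets n)))
    ≡⟨ cong sum (map-++ f (map (outside ∷_) (subsets n)) _) ⟩
  sum (map f (map (outside ∷_) (subsets n)) List.++ map f (map (inside ∷_) (subsets n)))
    ≡⟨ sum-++ (map f (map (outside ∷_) (subsets n))) _ ⟩
  sum (map f (map (outside ∷_) (subsets n))) + sum (map f (map (inside ∷_) (subsets n)))
    ≡⟨ cong₂ (λ u v → sum u + sum v) (map-∘ (subsets n)) (map-∘ (subsets n)) ⟨
  sum (map (f ∘ (outside ∷_)) (subsets n)) + sum (map (f ∘ (inside ∷_)) (subsets n))
    ≡⟨ cong₂ _+_ (sum-subsets n (f ∘ (outside ∷_))) (sum-subsets n (f ∘ (inside ∷_))) ⟩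
  sumSubsets (suc n) f ∎
  where open ≡-Reasoning

-- `induced` without the passage to the most recent common ancestor, which `suppress` performs
-- anyway. This form can be computed branch by branch.
inducedTree : (T : Tree) → Subset ‖ T ‖ → Maybe Tree
inducedTree T S = Maybe.map suppress (rootPaths T S)

inducedTrees : (ts : List Tree) → Subset ‖ ts ‖* → List Tree
inducedTrees ts S = suppress* (rootPaths* ts S)

suppress-fromMRCA : ∀ t → suppress (fromMRCA t) ≡ suppress t
suppress-fromMRCA leaf                = refl
suppress-fromMRCA (node (t ∷ []))     = suppress-fromMRCA t
suppress-fromMRCA (node (t ∷ u ∷ us)) = refl

induced≡ : ∀ T S → induced T S ≡ inducedTree T S
induced≡ T S with rootPaths T S
... | nothing = refl
... | just t  = cong just (suppress-fromMRCA t)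

_∷?_ : Maybe Tree → List Tree → List Tree
nothing ∷? us = us
just u  ∷? us = u ∷ us

-- What becomes of a root when its branches have induced these trees: a root with a single branch is
-- itself suppressed.
join : List Tree → Maybe Tree
join []           = nothing
join (u ∷ [])     = just u
join (u ∷ v ∷ us) = just (node (u ∷ v ∷ us))

inducedTree-node : ∀ t ts S → inducedTree (node (t ∷ ts)) S ≡ join (inducedTrees (t ∷ ts) S)
inducedTree-node t ts S with rootPaths* (t ∷ ts) S
... | []         = refl
... | u ∷ []     = refl
... | u ∷ v ∷ us = refl

take-drop-++ : ∀ {m n} (A : Subset m) (B : Subset n) → take m (A ++ B) ≡ A × drop m (A ++ B) ≡ B
take-drop-++ {m} A B = ++-injective (take m (A ++ B)) A (take++drop≡id m (A ++ B))

inducedTrees-∷ : ∀ t ts A B → inducedTrees (t ∷ ts) (A ++ B) ≡ inducedTree t A ∷? inducedTrees ts B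
inducedTrees-∷ t ts A B
  rewrite proj₁ (take-drop-++ A B) with rootPaths t A
... | nothing = cong (inducedTrees ts) (proj₂ (take-drop-++ A B))
... | just u  = cong (λ C → suppress u ∷ inducedTrees ts C) (proj₂ (take-drop-++ A B))

‖_‖? : Maybe Tree → ℕ
‖ nothing ‖? = 0
‖ just u ‖?  = ‖ u ‖

‖∷?‖ : ∀ m us → ‖ m ∷? us ‖* ≡ ‖ m ‖? + ‖ us ‖*
‖∷?‖ nothing  us = refl
‖∷?‖ (just u) us = refl

‖join‖ : ∀ us → ‖ join us ‖? ≡ ‖ us ‖*
‖join‖ []           = refl
‖join‖ (u ∷ [])     = sym (+-identityʳ _)
‖join‖ (u ∷ v ∷ us) = refl

∣++∣ : ∀ {m n} (A : Subset m) (B : Subset n) → ∣ A ++ B ∣ ≡ ∣ A ∣ + ∣ B ∣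
∣++∣ []            B = refl
∣++∣ (true ∷ A)  B = cong suc (∣++∣ A B)
∣++∣ (false ∷ A) B = ∣++∣ A B

mutual
  -- This makes the size condition of `IsCopy` a consequence of the isomorphism, so that `c` becomes
  -- an unrestricted sum over all subsets.
  ‖inducedTree‖ : ∀ T S → ‖ inducedTree T S ‖? ≡ ∣ S ∣
  ‖inducedTree‖ leaf            (true ∷ [])  = refl
  ‖inducedTree‖ leaf            (false ∷ []) = refl
  ‖inducedTree‖ (node (t ∷ ts)) S = trans (cong ‖_‖? (inducedTree-node t ts S))
    (trans (‖join‖ (inducedTrees (t ∷ ts) S)) (‖inducedTrees‖ (t ∷ ts) S))

  ‖inducedTrees‖ : ∀ ts S → ‖ inducedTrees ts S ‖* ≡ ∣ S ∣
  ‖inducedTrees‖ []       []  = refl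
  ‖inducedTrees‖ (t ∷ ts) S = subst (λ S → ‖ inducedTrees (t ∷ ts) S ‖* ≡ ∣ S ∣) (take++drop≡id ‖ t ‖ S)
    (trans (cong ‖_‖* (inducedTrees-∷ t ts A B)) (trans (‖∷?‖ (inducedTree t A) (inducedTrees ts B))
    (trans (cong₂ _+_ (‖inducedTree‖ t A) (‖inducedTrees‖ ts B)) (sym (∣++∣ A B)))))
    where
    A = take ‖ t ‖ S
    B = drop ‖ t ‖ S

‖_‖>0 : ∀ T → 0 < ‖ T ‖
‖ leaf ‖>0          = s≤s z≤n
‖ node (t ∷ ts) ‖>0 = ≤-trans ‖ t ‖>0 (m≤m+n _ _)

mutual
  ≅⇒‖‖≡ : ∀ {t u} → t ≅ u → ‖ t ‖ ≡ ‖ u ‖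
  ≅⇒‖‖≡ {node []}      {node []}      (node p) = refl
  ≅⇒‖‖≡ {node []}      {node (u ∷ _)} (node p) = contradiction (↭⇒‖‖*≡ p) (<⇒≢ (≤-trans ‖ u ‖>0 (m≤m+n _ _)))
  ≅⇒‖‖≡ {node (t ∷ _)} {node []}      (node p) = contradiction (sym (↭⇒‖‖*≡ p)) (<⇒≢ (≤-trans ‖ t ‖>0 (m≤m+n _ _)))
  ≅⇒‖‖≡ {node (_ ∷ _)} {node (_ ∷ _)} (node p) = ↭⇒‖‖*≡ p

  ↭⇒‖‖*≡ : ∀ {ts us} → Permutation _≅_ ts us → ‖ ts ‖* ≡ ‖ us ‖*
  ↭⇒‖‖*≡ (Permutation.refl es)    = ≅*⇒‖‖*≡ es
  ↭⇒‖‖*≡ (prep e p)               = cong₂ _+_ (≅⇒‖‖≡ e) (↭⇒‖‖*≡ p)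
  ↭⇒‖‖*≡ {_} {_} (Permutation.swap {x = x} {y = y} {x′} {y′} e f p) = trans
    (cong₂ _+_ (≅⇒‖‖≡ e) (cong₂ _+_ (≅⇒‖‖≡ f) (↭⇒‖‖*≡ p)))
    (lem ‖ x′ ‖ ‖ y′ ‖ _)
    where
    lem : ∀ a b c → a + (b + c) ≡ b + (a + c)
    lem = solve-∀
  ↭⇒‖‖*≡ (Permutation.trans p q)  = trans (↭⇒‖‖*≡ p) (↭⇒‖‖*≡ q)

  ≅*⇒‖‖*≡ : ∀ {ts us} → Pointwise _≅_ ts us → ‖ ts ‖* ≡ ‖ us ‖*
  ≅*⇒‖‖*≡ []       = refl
  ≅*⇒‖‖*≡ (e ∷ es) = cong₂ _+_ (≅⇒‖‖≡ e) (≅*⇒‖‖*≡ es)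

hit : Tree → Maybe Tree → ℕ
hit D nothing  = 0
hit D (just u) = 𝟙 (u ≅? D)

empty? : Maybe Tree → ℕ
empty? nothing  = 1
empty? (just _) = 0

sumTree : (T : Tree) → (Maybe Tree → ℕ) → ℕ
sumTree T φ = sumSubsets ‖ T ‖ (φ ∘ inducedTree T)

sumForest : (ts : List Tree) → (List Tree → ℕ) → ℕ
sumForest ts ψ = sumSubsets ‖ ts ‖* (ψ ∘ inducedTrees ts)

sumForest-∷ : ∀ t ts ψ → sumForest (t ∷ ts) ψ ≡ sumTree t (λ m → sumForest ts (ψ ∘ (m ∷?_)))
sumForest-∷ t ts ψ = trans (sumSubsets-++ ‖ t ‖ ‖ ts ‖* _)
  (sumSubsets-cong ‖ t ‖ λ A → sumSubsets-cong ‖ ts ‖* λ B → cong ψ (inducedTrees-∷ t ts A B))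

sumTree-node : ∀ t ts φ → sumTree (node (t ∷ ts)) φ ≡ sumForest (t ∷ ts) (φ ∘ join)
sumTree-node t ts φ = sumSubsets-cong ‖ t ∷ ts ‖* λ S → cong φ (inducedTree-node t ts S)

c≡sumTree : ∀ D T → c D T ≡ sumTree T (hit D)
c≡sumTree D T = trans (length-filter (isCopy? D T) (subsets ‖ T ‖))
  (trans (sum-subsets ‖ T ‖ _) (sumSubsets-cong ‖ T ‖ pointwise))
  where
  hit? : ∀ m → 𝟙 (MaybeAny.dec (_≅? D) m) ≡ hit D m
  hit? nothing  = refl
  hit? (just u) = 𝟙-cong (MaybeAny.dec (_≅? D) (just u)) (u ≅? D) (λ { (MaybeAny.just e) → e }) MaybeAny.just
  size : ∀ {m} → MaybeAny.Any (_≅ D) m → ‖ m ‖? ≡ ‖ D ‖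
  size (MaybeAny.just e) = ≅⇒‖‖≡ e
  pointwise : ∀ S → 𝟙 (isCopy? D T S) ≡ hit D (inducedTree T S)
  pointwise S = trans (𝟙-cong (isCopy? D T S) (MaybeAny.dec (_≅? D) (inducedTree T S))
      (λ (_ , e) → subst (MaybeAny.Any (_≅ D)) (induced≡ T S) e)
      (λ e → trans (sym (‖inducedTree‖ T S)) (size e) , subst (MaybeAny.Any (_≅ D)) (sym (induced≡ T S)) e))
    (hit? (inducedTree T S))

isNil : List Tree → ℕ
isNil []      = 1
isNil (_ ∷ _) = 0

mutual
  sumTree-empty : ∀ T → sumTree T empty? ≡ 1
  sumTree-empty leaf            = refl
  sumTree-empty (node (t ∷ ts)) = trans (sumTree-node t ts empty?)
    (trans (sumSubsets-cong ‖ t ∷ ts ‖* (λ S → lem (inducedTrees (t ∷ ts) S))) (sumForest-isNil (t ∷ ts)))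
    where
    lem : ∀ us → empty? (join us) ≡ isNil us
    lem []           = refl
    lem (_ ∷ [])     = refl
    lem (_ ∷ _ ∷ _)  = refl

  sumForest-isNil : ∀ ts → sumForest ts isNil ≡ 1
  sumForest-isNil []       = refl
  sumForest-isNil (t ∷ ts) = trans (sumForest-∷ t ts isNil)
    (trans (sumSubsets-cong ‖ t ‖ (λ A → lem (inducedTree t A))) (sumTree-empty t))
    where
    zeros : ∀ n → sumSubsets n (λ _ → 0) ≡ 0
    zeros zero    = refl
    zeros (suc n) = cong₂ _+_ (zeros n) (zeros n)
    lem : ∀ m → sumForest ts (isNil ∘ (m ∷?_)) ≡ empty? m
    lem nothing  = sumForest-isNil ts
    lem (just _) = zeros ‖ ts ‖*

-- If φ distinguishes only X and Y among the nonempty induced trees, its sum is determined by two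
-- counts; the empty set of leaves contributes `φ nothing` once.
sumTree-hits : ∀ X Y T (φ : Maybe Tree → ℕ) y z → (∀ u → φ (just u) ≡ 𝟙 (u ≅? X) * y + 𝟙 (u ≅? Y) * z) →
  sumTree T φ ≡ φ nothing + c X T * y + c Y T * z
sumTree-hits X Y T φ y z eq = begin
  sumTree T φ
    ≡⟨ sumSubsets-cong ‖ T ‖ (λ S → pointwise (inducedTree T S)) ⟩
  sumTree T (λ m → empty? m * φ nothing + hit X m * y + hit Y m * z)
    ≡⟨ trans (sumSubsets-+ ‖ T ‖ _ _) (cong (_+ sumTree T (λ m → hit Y m * z)) (sumSubsets-+ ‖ T ‖ _ _)) ⟩
  sumTree T (λ m → empty? m * φ nothing) + sumTree T (λ m → hit X m * y) + sumTree T (λ m → hit Y m * z)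
    ≡⟨ cong₂ _+_ (cong₂ _+_ (sumSubsets-* ‖ T ‖ _ _) (sumSubsets-* ‖ T ‖ _ _)) (sumSubsets-* ‖ T ‖ _ _) ⟩
  sumTree T empty? * φ nothing + sumTree T (hit X) * y + sumTree T (hit Y) * z
    ≡⟨ cong₂ _+_ (cong₂ _+_ (trans (cong (_* φ nothing) (sumTree-empty T)) (*-identityˡ _))
         (cong (_* y) (sym (c≡sumTree X T)))) (cong (_* z) (sym (c≡sumTree Y T))) ⟩
  φ nothing + c X T * y + c Y T * z ∎
  where
  open ≡-Reasoning
  pointwise : ∀ m → φ m ≡ empty? m * φ nothing + hit X m * y + hit Y m * z
  pointwise nothing  = sym (trans (+-identityʳ _) (trans (+-identityʳ _) (*-identityˡ _)))
  pointwise (just u) = eq u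

-- Copies of a tree with branches of two shapes

solo : Tree → List Tree → ℕ
solo D []          = 0
solo D (u ∷ [])    = 𝟙 (u ≅? D)
solo D (_ ∷ _ ∷ _) = 0

sumForest-solo : ∀ D ts → sumForest ts (solo D) ≡ sum (map (c D) ts)
sumForest-solo D []       = refl
sumForest-solo D (t ∷ ts) = begin
  sumForest (t ∷ ts) (solo D)                                ≡⟨ sumForest-∷ t ts (solo D) ⟩
  sumTree t (λ m → sumForest ts (solo D ∘ (m ∷?_)))
    ≡⟨ sumTree-hits D D t (λ m → sumForest ts (solo D ∘ (m ∷?_))) 1 0 below ⟩
  sumForest ts (solo D) + c D t * 1 + c D t * 0              ≡⟨ lem (sumForest ts (solo D)) (c D t) ⟩
  c D t + sumForest ts (solo D)                              ≡⟨ cong (_+_ (c D t)) (sumForest-solo D ts) ⟩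
  c D t + sum (map (c D) ts)                                 ∎
  where
  open ≡-Reasoning
  lem : ∀ a b → a + b * 1 + b * 0 ≡ b + a
  lem = solve-∀
  isNil* : ∀ u us → solo D (u ∷ us) ≡ isNil us * 𝟙 (u ≅? D)
  isNil* u []      = sym (*-identityˡ _)
  isNil* u (_ ∷ _) = refl
  below : ∀ u → sumForest ts (solo D ∘ (u ∷_)) ≡ 𝟙 (u ≅? D) * 1 + 𝟙 (u ≅? D) * 0
  below u = begin
    sumForest ts (solo D ∘ (u ∷_))
      ≡⟨ sumSubsets-cong ‖ ts ‖* (λ S → isNil* u (inducedTrees ts S)) ⟩
    sumForest ts (λ us → isNil us * 𝟙 (u ≅? D))      ≡⟨ sumSubsets-* ‖ ts ‖* _ _ ⟩
    sumForest ts isNil * 𝟙 (u ≅? D)                  ≡⟨ cong (_* 𝟙 (u ≅? D)) (sumForest-isNil ts) ⟩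
    1 * 𝟙 (u ≅? D)                                   ≡⟨ lem′ (𝟙 (u ≅? D)) ⟩
    𝟙 (u ≅? D) * 1 + 𝟙 (u ≅? D) * 0                  ∎
    where
    lem′ : ∀ a → 1 * a ≡ a * 1 + a * 0
    lem′ = solve-∀

rootCopies : List Tree → List Tree → ℕ
rootCopies Ds ts = sumForest ts (λ us → 𝟙 (us ≅*? Ds))

-- The leaves of a copy either lie in a single branch, where they form a copy, or meet several
-- branches. In the latter case the roots coincide and the induced trees match Ds. Two branches in
-- Ds exclude an overlap of the cases.
c-node : ∀ Ds → 2 ≤ length Ds → ∀ t ts →
  c (node Ds) (node (t ∷ ts)) ≡ sum (map (c (node Ds)) (t ∷ ts)) + rootCopies Ds (t ∷ ts)
c-node Ds 2≤ t ts = begin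
  c (node Ds) (node (t ∷ ts))                                  ≡⟨ c≡sumTree (node Ds) (node (t ∷ ts)) ⟩
  sumTree (node (t ∷ ts)) (hit (node Ds))                      ≡⟨ sumTree-node t ts (hit (node Ds)) ⟩
  sumForest (t ∷ ts) (hit (node Ds) ∘ join)
    ≡⟨ sumSubsets-cong ‖ t ∷ ts ‖* (λ S → split (inducedTrees (t ∷ ts) S)) ⟩
  sumForest (t ∷ ts) (λ us → solo (node Ds) us + 𝟙 (us ≅*? Ds)) ≡⟨ sumSubsets-+ ‖ t ∷ ts ‖* _ _ ⟩
  sumForest (t ∷ ts) (solo (node Ds)) + rootCopies Ds (t ∷ ts)
    ≡⟨ cong (_+ rootCopies Ds (t ∷ ts)) (sumForest-solo (node Ds) (t ∷ ts)) ⟩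
  sum (map (c (node Ds)) (t ∷ ts)) + rootCopies Ds (t ∷ ts)    ∎
  where
  open ≡-Reasoning
  short : ∀ {us} → length us < 2 → ¬ Permutation _≅_ us Ds
  short us<2 p = <⇒≱ us<2 (≤-trans 2≤ (≤-reflexive (sym (≅↭.xs↭ys⇒|xs|≡|ys| p))))
  split : ∀ us → hit (node Ds) (join us) ≡ solo (node Ds) us + 𝟙 (us ≅*? Ds)
  split []           = sym (𝟙-no ([] ≅*? Ds) (short (s≤s z≤n)))
  split (u ∷ [])     = sym (trans (cong (_+_ (𝟙 (u ≅? node Ds))) (𝟙-no ((u ∷ []) ≅*? Ds) (short ≤-refl))) (+-identityʳ _))
  split (u ∷ v ∷ us) = 𝟙-cong (node (u ∷ v ∷ us) ≅? node Ds) ((u ∷ v ∷ us) ≅*? Ds) (λ { (node p) → p }) node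

mutual
  c-leaf : ∀ T → c leaf T ≡ ‖ T ‖
  c-leaf leaf            = refl
  c-leaf (node (t ∷ ts)) = begin
    c leaf (node (t ∷ ts))                ≡⟨ c≡sumTree leaf (node (t ∷ ts)) ⟩
    sumTree (node (t ∷ ts)) (hit leaf)    ≡⟨ sumTree-node t ts (hit leaf) ⟩
    sumForest (t ∷ ts) (hit leaf ∘ join)
      ≡⟨ sumSubsets-cong ‖ t ∷ ts ‖* (λ S → split (inducedTrees (t ∷ ts) S)) ⟩
    sumForest (t ∷ ts) (solo leaf)        ≡⟨ sumForest-solo leaf (t ∷ ts) ⟩
    sum (map (c leaf) (t ∷ ts))           ≡⟨ c-leaf* (t ∷ ts) ⟩
    ‖ t ∷ ts ‖*                           ∎
    where
    open ≡-Reasoning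
    split : ∀ us → hit leaf (join us) ≡ solo leaf us
    split []           = refl
    split (u ∷ [])     = refl
    split (u ∷ v ∷ us) = 𝟙-no (node (u ∷ v ∷ us) ≅? leaf) (λ { (node p) → ≅↭.¬x∷xs↭[] p })

  c-leaf* : ∀ ts → sum (map (c leaf) ts) ≡ ‖ ts ‖*
  c-leaf* []       = refl
  c-leaf* (t ∷ ts) = cong₂ _+_ (c-leaf t) (c-leaf* ts)

-- The coefficient of x ^ q in the product of the a t + b t * x over the members t of the list.
coeff : {A : Set} (a b : A → ℕ) → List A → ℕ → ℕ
coeff a b []       zero    = 1
coeff a b []       (suc q) = 0
coeff a b (t ∷ ts) zero    = a t * coeff a b ts zero
coeff a b (t ∷ ts) (suc q) = a t * coeff a b ts (suc q) + b t * coeff a b ts q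

coeff->length : {A : Set} (a b : A → ℕ) → ∀ ts q → length ts < q → coeff a b ts q ≡ 0
coeff->length a b []       (suc q) _       = refl
coeff->length a b (t ∷ ts) (suc q) (s≤s l) =
  trans (cong₂ (λ u v → a t * u + b t * v) (coeff->length a b ts (suc q) (m<n⇒m<1+n l)) (coeff->length a b ts q l))
  (trans (cong₂ _+_ (*-zeroʳ (a t)) (*-zeroʳ (b t))) refl)

module TwoShapes {X Y : Tree} (X≇Y : ¬ X ≅ Y) where

  branches : ℕ → ℕ → List Tree
  branches p q = replicate p X List.++ replicate q Y

  copies : List Tree → ℕ → ℕ → ℕ
  copies ts p q = rootCopies (branches p q) ts

  -- The copies of what remains of the pattern after one branch X, or one branch Y, has been used
  -- up.
  pred-copiesˣ pred-copiesʸ : List Tree → ℕ → ℕ → ℕ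
  pred-copiesˣ ts zero    q = 0
  pred-copiesˣ ts (suc p) q = copies ts p q
  pred-copiesʸ ts p zero    = 0
  pred-copiesʸ ts p (suc q) = copies ts p q

  private
    shape : ∀ {Z} {P : Tree → Set} m → (Z ≅ Z × 0 < m → P Z) → All P (replicate m Z)
    shape zero    f = []
    shape (suc m) f = All.replicate⁺ (suc m) (f (≅-refl _ , s≤s z≤n))

    all-branches : ∀ p q {u us} → Permutation _≅_ (u ∷ us) (branches p q) → (u ≅ X × 0 < p) ⊎ (u ≅ Y × 0 < q)
    all-branches p q π with ≅↭.All-resp-↭ (λ e f → Sum.map (λ (g , l) → ≅-trans (≅-sym e) g , l) (λ (g , l) → ≅-trans (≅-sym e) g , l) f) (↭-sym π)
      (All.++⁺ (shape p inj₁) (shape q inj₂))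
    ... | p ∷ _ = p

    unprep : ∀ {u v us vs} → u ≅ v → Permutation _≅_ (u ∷ us) (v ∷ vs) → Permutation _≅_ us vs
    unprep e π = ≅↭.drop-∷ (Permutation.trans (prep (≅-sym e) (Permutation.refl (≅*-refl _))) π)

    shift : ∀ p q → Permutation _≅_ (branches p (suc q)) (Y ∷ branches p q)
    shift p q = ≅↭.↭-shift (replicate p X) (replicate q Y)

    zeros : ∀ ts → sumForest ts (λ _ → 0) ≡ 0
    zeros ts = trans (sumSubsets-* ‖ ts ‖* (λ _ → 0) 0) (*-zeroʳ (sumSubsets ‖ ts ‖* (λ _ → 0)))

    below : ∀ ts p q u → sumForest ts (λ us → 𝟙 ((u ∷ us) ≅*? branches p q)) ≡
      𝟙 (u ≅? X) * pred-copiesˣ ts p q + 𝟙 (u ≅? Y) * pred-copiesʸ ts p q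
    below ts p q u with u ≅? X | u ≅? Y
    ... | yes u≅X | yes u≅Y = contradiction (≅-trans (≅-sym u≅X) u≅Y) X≇Y
    ... | no u≇X  | no u≇Y  = trans (sumSubsets-cong ‖ ts ‖* (λ S → 𝟙-no (_ ≅*? branches p q) (none S))) (zeros ts)
      where
      none : ∀ S → ¬ Permutation _≅_ (u ∷ inducedTrees ts S) (branches p q)
      none S π with all-branches p q π
      ... | inj₁ (e , _) = u≇X e
      ... | inj₂ (e , _) = u≇Y e
    ... | yes u≅X | no u≇Y with p
    ...   | zero  = trans (sumSubsets-cong ‖ ts ‖* (λ S → 𝟙-no (_ ≅*? branches 0 q) (none S))) (zeros ts)
      where
      none : ∀ S → ¬ Permutation _≅_ (u ∷ inducedTrees ts S) (branches 0 q)
      none S π with all-branches 0 q π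
      ... | inj₂ (e , _) = u≇Y e
    ...   | suc p = trans (sumSubsets-cong ‖ ts ‖* (λ S →
      𝟙-cong (_ ≅*? branches (suc p) q) (inducedTrees ts S ≅*? branches p q) (unprep u≅X) (prep u≅X)))
      (sym (trans (+-identityʳ _) (*-identityˡ _)))
    below ts p q u | no u≇X | yes u≅Y with q
    ...   | zero  = trans (sumSubsets-cong ‖ ts ‖* (λ S → 𝟙-no (_ ≅*? branches p 0) (none S))) (zeros ts)
      where
      none : ∀ S → ¬ Permutation _≅_ (u ∷ inducedTrees ts S) (branches p 0)
      none S π with all-branches p 0 π
      ... | inj₁ (e , _) = u≇X e
    ...   | suc q = trans (sumSubsets-cong ‖ ts ‖* (λ S →
      𝟙-cong (_ ≅*? branches p (suc q)) (inducedTrees ts S ≅*? branches p q)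
        (λ π → unprep u≅Y (Permutation.trans π (shift p q)))
        (λ π → Permutation.trans (prep u≅Y π) (↭-sym (shift p q)))))
      (sym (*-identityˡ _))

  -- The branch t is skipped, or supplies an X, or supplies a Y; these are exclusive since X and Y
  -- are not isomorphic.
  copies-∷ : ∀ t ts p q → copies (t ∷ ts) p q ≡
    copies ts p q + c X t * pred-copiesˣ ts p q + c Y t * pred-copiesʸ ts p q
  copies-∷ t ts p q = trans (sumForest-∷ t ts ψ)
    (sumTree-hits X Y t (λ m → sumForest ts (ψ ∘ (m ∷?_))) _ _ (below ts p q))
    where
    ψ : List Tree → ℕ
    ψ us = 𝟙 (us ≅*? branches p q)

  copies-<length : ∀ ts p q → length ts < p + q → copies ts p q ≡ 0
  copies-<length []       zero    (suc q) _ = 𝟙-no ([] ≅*? branches 0 (suc q)) (≅↭.¬x∷xs↭[] ∘ ↭-sym)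
  copies-<length []       (suc p) q       _ = 𝟙-no ([] ≅*? branches (suc p) q) (≅↭.¬x∷xs↭[] ∘ ↭-sym)
  copies-<length (t ∷ ts) p q l = trans (copies-∷ t ts p q)
    (trans (cong₂ _+_ (cong₂ (λ u v → u + c X t * v) (copies-<length ts p q (<-trans (n<1+n _) l)) (left p l)) (cong (c Y t *_) (right q l)))
    (trans (cong (_+ c Y t * 0) (*-zeroʳ (c X t))) (*-zeroʳ (c Y t))))
    where
    left : ∀ p → suc (length ts) < p + q → pred-copiesˣ ts p q ≡ 0
    left zero    l       = refl
    left (suc p) (s≤s l) = copies-<length ts p q l
    right : ∀ q → suc (length ts) < p + q → pred-copiesʸ ts p q ≡ 0
    right zero    l = refl
    right (suc q) l = copies-<length ts p q (≤-pred (≤-trans l (≤-reflexive (+-suc p q))))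

  -- No branch can be skipped, so the first term of `copies-∷` vanishes and what remains is the
  -- recurrence of `coeff`.
  copies-length : ∀ ts p q → length ts ≡ p + q → copies ts p q ≡ coeff (c X) (c Y) ts q
  copies-length []       zero    zero    _  = 𝟙-yes ([] ≅*? []) (Permutation.refl (≅*-refl []))
  copies-length (t ∷ ts) p       q       eq = trans (copies-∷ t ts p q)
    (trans (cong (λ z → z + c X t * pred-copiesˣ ts p q + c Y t * pred-copiesʸ ts p q) (copies-<length ts p q (≤-reflexive eq)))
    (rest p q eq))
    where
    rest : ∀ p q → suc (length ts) ≡ p + q →
      c X t * pred-copiesˣ ts p q + c Y t * pred-copiesʸ ts p q ≡ coeff (c X) (c Y) (t ∷ ts) q
    rest (suc p) zero    eq = trans (cong₂ _+_ (cong (c X t *_) (copies-length ts p 0 (suc-injective eq))) (*-zeroʳ (c Y t))) (+-identityʳ _)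
    rest zero    (suc q) eq = cong₂ (λ u v → c X t * u + c Y t * v)
      (sym (coeff->length (c X) (c Y) ts (suc q) (≤-reflexive eq))) (copies-length ts 0 q (suc-injective eq))
    rest (suc p) (suc q) eq = cong₂ (λ u v → c X t * u + c Y t * v)
      (copies-length ts p (suc q) (suc-injective eq)) (copies-length ts (suc p) q (trans (suc-injective eq) (+-suc p q)))

  -- With only Y in the pattern every branch may be skipped, with weight 1. This is the coefficient
  -- that an empty tree in the place of X would give.
  copies-0 : ∀ ts q → copies ts 0 q ≡ coeff (λ _ → 1) (c Y) ts q
  copies-0 []       zero    = 𝟙-yes ([] ≅*? []) (Permutation.refl (≅*-refl []))
  copies-0 []       (suc q) = copies-<length [] 0 (suc q) (s≤s z≤n)
  copies-0 (t ∷ ts) zero    = trans (copies-∷ t ts 0 0)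
    (trans (cong₂ (λ u v → copies ts 0 0 + u + v) (*-zeroʳ (c X t)) (*-zeroʳ (c Y t)))
    (trans (+-identityʳ _) (cong (_+ 0) (copies-0 ts 0))))
  copies-0 (t ∷ ts) (suc q) = trans (copies-∷ t ts 0 (suc q))
    (trans (cong (λ u → copies ts 0 (suc q) + u + c Y t * copies ts 0 q) (*-zeroʳ (c X t)))
    (cong₂ (λ u v → u + c Y t * v) (cong (_+ 0) (copies-0 ts (suc q))) (copies-0 ts q)))

-- Even trees

‖++‖ : ∀ ts us → ‖ ts List.++ us ‖* ≡ ‖ ts ‖* + ‖ us ‖*
‖++‖ []       us = refl
‖++‖ (t ∷ ts) us = trans (cong (_+_ ‖ t ‖) (‖++‖ ts us)) (sym (+-assoc ‖ t ‖ _ _))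

‖replicate‖ : ∀ n t → ‖ replicate n t ‖* ≡ n * ‖ t ‖
‖replicate‖ zero    t = refl
‖replicate‖ (suc n) t = cong (_+_ ‖ t ‖) (‖replicate‖ n t)

‖node‖ : ∀ ts → 0 < length ts → ‖ node ts ‖ ≡ ‖ ts ‖*
‖node‖ (t ∷ ts) _ = refl

c-node-leaf : ∀ Ds → 0 < length Ds → c (node Ds) leaf ≡ 0
c-node-leaf (t ∷ ts) _ = trans (c≡sumTree (node (t ∷ ts)) leaf)
  (𝟙-no (leaf ≅? node (t ∷ ts)) (λ { (node p) → ≅↭.¬x∷xs↭[] (↭-sym p) }))

module Even (d′ : ℕ) where

  d : ℕ
  d = 2 + d′

  -- The branches of E d (d * s + b), for 1 ≤ b ≤ d.
  branchesOf : ℕ → ℕ → List Tree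
  branchesOf zero    b = replicate b leaf
  branchesOf (suc s) b = replicate (d ∸ b) (E d (suc s)) List.++ replicate b (E d (2 + s))

  E-branches : ∀ s b → 1 ≤ b → b ≤ d → 2 ≤ d * s + b → E d (d * s + b) ≡ node (branchesOf s b)
  E-branches zero b _ b≤d 2≤k = subst (λ k → 2 ≤ k → E d k ≡ node (replicate b leaf)) (sym (cong (_+ b) (*-zeroʳ d)))
    (λ 2≤b → E-star d b 2≤b b≤d) 2≤k
  E-branches (suc s) b 1≤b b≤d _ with m≤n⇒m<n∨m≡n b≤d
  ... | inj₁ b<d  = E-step d (suc s) b b<d (≤-trans (≤-reflexive (+-comm 1 d)) (+-mono-≤ (m≤m*n d (suc s)) 1≤b))
  -- The value b = d is the remainder 0 of the definition, with quotient 2 + s and all branches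
  -- equal.
  ... | inj₂ refl = trans (cong (E d) (lem d s)) (trans (E-step d (2 + s) 0 (s≤s z≤n)
      (≤-trans (m<m*n d (2 + s) (s≤s (s≤s z≤n))) (≤-reflexive (sym (+-identityʳ _)))))
    (cong node (trans (++-identityʳ _) (cong (λ m → replicate m (E d (suc s)) List.++ replicate d (E d (2 + s))) (sym (n∸n≡0 d))))))
    where
    lem : ∀ d s → d * suc s + d ≡ d * (2 + s) + 0
    lem = solve-∀

  -- Dividing k - 1 instead of k puts the remainder into 1, ..., d. The last condition makes both s
  -- and s + 1 available to strong induction.
  split : ∀ k → 2 ≤ k → ∃[ s ] ∃[ b ] (1 ≤ b × b ≤ d × d * s + b ≡ k × suc s < k)
  split (suc k) 2≤k = k / d , suc (k % d) , s≤s z≤n , m%n<n k d , eq , small (k / d) (k % d) eq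
    where
    eq : d * (k / d) + suc (k % d) ≡ suc k
    eq = trans (+-suc _ (k % d)) (cong suc (trans (trans (+-comm _ (k % d)) (cong (_+_ (k % d)) (*-comm d (k / d)))) (sym (m≡m%n+[m/n]*n k d))))
    small : ∀ s b → d * s + suc b ≡ suc k → suc s < suc k
    small zero    b _  = 2≤k
    small (suc s) b eq = ≤-trans (≤-trans (m≤m+n (3 + s) (s + d′ * suc s + b)) (≤-reflexive (lem d′ s b))) (≤-reflexive eq)
      where
      lem : ∀ d′ s b → 3 + s + (s + d′ * suc s + b) ≡ (2 + d′) * suc s + suc b
      lem = solve-∀

  ‖E‖ : ∀ k → 1 ≤ k → ‖ E d k ‖ ≡ k
  ‖E‖ = <-rec (λ k → 1 ≤ k → ‖ E d k ‖ ≡ k) step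
    where
    step : ∀ k → (∀ {j} → j < k → 1 ≤ j → ‖ E d j ‖ ≡ j) → 1 ≤ k → ‖ E d k ‖ ≡ k
    step (suc zero)    ih _ = refl
    step k@(suc (suc _)) ih _ with split k (s≤s (s≤s z≤n))
    ... | s , b , 1≤b , b≤d , eq , s<k = begin
      ‖ E d k ‖                     ≡⟨ cong (‖_‖ ∘ E d) eq ⟨
      ‖ E d (d * s + b) ‖
        ≡⟨ cong ‖_‖ (E-branches s b 1≤b b≤d (subst (2 ≤_) (sym eq) (s≤s (s≤s z≤n)))) ⟩
      ‖ node (branchesOf s b) ‖     ≡⟨ sizes s s<k ⟩
      d * s + b                     ≡⟨ eq ⟩
      k                             ∎
      where
      open ≡-Reasoning
      lem : ∀ m b s → m * suc s + b * (2 + s) ≡ (m + b) * suc s + b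
      lem = solve-∀
      sizes : ∀ s → suc s < k → ‖ node (branchesOf s b) ‖ ≡ d * s + b
      sizes zero    _   = trans (‖node‖ (replicate b leaf) (subst (0 <_) (sym (length-replicate b)) 1≤b))
        (trans (‖replicate‖ b leaf) (trans (*-identityʳ b) (cong (_+ b) (sym (*-zeroʳ d)))))
      sizes (suc s) s<k = trans (‖node‖ (branchesOf (suc s) b)
          (subst (0 <_) (sym (trans (length-++ (replicate (d ∸ b) _)) (cong₂ _+_ (length-replicate (d ∸ b)) (length-replicate b)))) (≤-trans 1≤b (m≤n+m b (d ∸ b)))))
        (trans (‖++‖ (replicate (d ∸ b) (E d (suc s))) _)
        (trans (cong₂ _+_ (‖replicate‖ (d ∸ b) _) (‖replicate‖ b _))
        (trans (cong₂ (λ u v → (d ∸ b) * u + b * v) (ih (<-trans (n<1+n _) s<k) (s≤s z≤n)) (ih s<k (s≤s z≤n)))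
        (trans (lem (d ∸ b) b s) (cong (λ m → m * suc s + b) (m∸n+n≡m b≤d))))))

  -- The empty tree has one copy, the empty set of leaves; `E d 0` evaluates to a leaf and could not
  -- take this part.
  count : ℕ → Tree → ℕ
  count zero    = λ _ → 1
  count (suc k) = c (E d (suc k))

  E≇E : ∀ k → ¬ E d (suc k) ≅ E d (2 + k)
  E≇E k e = 1+n≢n (sym (trans (sym (‖E‖ (suc k) (s≤s z≤n))) (trans (≅⇒‖‖≡ e) (‖E‖ (2 + k) (s≤s z≤n)))))

  -- For stars the pattern consists of leaves only; the cherry fills the place of the absent shape X
  -- in `TwoShapes`.
  cherry≇leaf : ¬ node (leaf ∷ leaf ∷ []) ≅ leaf
  cherry≇leaf (node p) = ≅↭.¬x∷xs↭[] p

  rootCopies-full : ∀ s b ts → b ≤ d → length ts ≡ d →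
    rootCopies (branchesOf s b) ts ≡ coeff (count s) (count (suc s)) ts b
  rootCopies-full zero    b ts b≤d len = TwoShapes.copies-0 cherry≇leaf ts b
  rootCopies-full (suc s) b ts b≤d len = TwoShapes.copies-length (E≇E s) ts (d ∸ b) b (trans len (sym (m∸n+n≡m b≤d)))

  rootCopies-star : ∀ b ts → rootCopies (branchesOf 0 b) ts ≡ coeff (count 0) (count 1) ts b
  rootCopies-star b ts = TwoShapes.copies-0 cherry≇leaf ts b

  rootCopies-few : ∀ s b ts → b ≤ d → length ts < d → rootCopies (branchesOf (suc s) b) ts ≡ 0
  rootCopies-few s b ts b≤d len = TwoShapes.copies-<length (E≇E s) ts (d ∸ b) b (≤-trans len (≤-reflexive (sym (m∸n+n≡m b≤d))))

  length-branchesOf : ∀ s b → b ≤ d → 2 ≤ d * s + b → 2 ≤ length (branchesOf s b)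
  length-branchesOf zero    b b≤d 2≤k = subst (2 ≤_) (trans (cong (_+ b) (*-zeroʳ d)) (sym (length-replicate b))) 2≤k
  length-branchesOf (suc s) b b≤d _   = subst (2 ≤_) (sym (trans (length-++ (replicate (d ∸ b) _))
    (trans (cong₂ _+_ (length-replicate (d ∸ b)) (length-replicate b)) (m∸n+n≡m b≤d)))) (s≤s (s≤s z≤n))

-- Products of bounds

coeff-mono : {A : Set} {a b a′ b′ : A → ℕ} → ∀ {ts} → All (λ t → a t ≤ a′ t × b t ≤ b′ t) ts → ∀ q →
  coeff a b ts q ≤ coeff a′ b′ ts q
coeff-mono []              zero    = ≤-refl
coeff-mono []              (suc q) = ≤-refl
coeff-mono ((p , _) ∷ ps)  zero    = *-mono-≤ p (coeff-mono ps zero)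
coeff-mono ((p , p′) ∷ ps) (suc q) = +-mono-≤ (*-mono-≤ p (coeff-mono ps (suc q))) (*-mono-≤ p′ (coeff-mono ps q))

coeff-scaleʳ : {A : Set} (a b : A → ℕ) (y : ℕ) → ∀ ts q →
  coeff a (λ t → y * b t) ts q ≡ y ^ q * coeff a b ts q
coeff-scaleʳ a b y []       zero    = refl
coeff-scaleʳ a b y []       (suc q) = sym (*-zeroʳ (y * y ^ q))
coeff-scaleʳ a b y (t ∷ ts) zero    = trans (cong (a t *_) (coeff-scaleʳ a b y ts zero)) (lem (a t) (coeff a b ts 0))
  where
  lem : ∀ a c → a * (1 * c) ≡ 1 * (a * c)
  lem = solve-∀
coeff-scaleʳ a b y (t ∷ ts) (suc q) = trans
  (cong₂ (λ u v → a t * u + y * b t * v) (coeff-scaleʳ a b y ts (suc q)) (coeff-scaleʳ a b y ts q))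
  (lem (a t) (b t) y (y ^ q) (coeff a b ts (suc q)) (coeff a b ts q))
  where
  lem : ∀ a b y z u v → a * (y * z * u) + y * b * (z * v) ≡ y * z * (a * u + b * v)
  lem = solve-∀

-- Among p + q factors, a term of degree q takes the constant part from exactly p.
coeff-scaleˡ : {A : Set} (a b : A → ℕ) (x : ℕ) → ∀ ts p q → length ts ≡ p + q →
  coeff (λ t → x * a t) b ts q ≡ x ^ p * coeff a b ts q
coeff-scaleˡ a b x []       zero    zero    _  = refl
coeff-scaleˡ a b x (t ∷ ts) (suc p) zero    eq = trans (cong (x * a t *_) (coeff-scaleˡ a b x ts p zero (suc-injective eq)))
  (lem x (a t) (x ^ p) (coeff a b ts zero))
  where
  lem : ∀ x a z c → x * a * (z * c) ≡ x * z * (a * c)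
  lem = solve-∀
coeff-scaleˡ a b x (t ∷ ts) zero    (suc q) eq = trans
  (cong₂ (λ u v → x * a t * u + b t * v) (coeff->length (λ t → x * a t) b ts (suc q) (≤-reflexive eq)) (coeff-scaleˡ a b x ts 0 q (suc-injective eq)))
  (trans (lem x (a t) (b t) (coeff a b ts q)) (cong (λ u → 1 * (a t * u + b t * coeff a b ts q)) (sym (coeff->length a b ts (suc q) (≤-reflexive eq)))))
  where
  lem : ∀ x a b c → x * a * 0 + b * (1 * c) ≡ 1 * (a * 0 + b * c)
  lem = solve-∀
coeff-scaleˡ a b x (t ∷ ts) (suc p) (suc q) eq = trans
  (cong₂ (λ u v → x * a t * u + b t * v) (coeff-scaleˡ a b x ts p (suc q) (suc-injective eq))
    (coeff-scaleˡ a b x ts (suc p) q (trans (suc-injective eq) (+-suc p q))))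
  (lem x (a t) (b t) (x ^ p) (coeff a b ts (suc q)) (coeff a b ts q))
  where
  lem : ∀ x a b z u v → x * a * (z * u) + b * (x * z * v) ≡ x * z * (a * u + b * v)
  lem = solve-∀

coeff-scale : {A : Set} (a b : A → ℕ) (x y : ℕ) → ∀ ts p q → length ts ≡ p + q →
  coeff (λ t → x * a t) (λ t → y * b t) ts q ≡ x ^ p * y ^ q * coeff a b ts q
coeff-scale a b x y ts p q eq = trans (coeff-scaleʳ (λ t → x * a t) b y ts q)
  (trans (cong (y ^ q *_) (coeff-scaleˡ a b x ts p q eq)) (lem (x ^ p) (y ^ q) (coeff a b ts q)))
  where
  lem : ∀ x y c → y * (x * c) ≡ x * y * c
  lem = solve-∀

^-distribʳ-* : ∀ m n o → (m * n) ^ o ≡ m ^ o * n ^ o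
^-distribʳ-* m n zero    = refl
^-distribʳ-* m n (suc o) = trans (cong (m * n *_) (^-distribʳ-* m n o)) ([m*n]*[o*p]≡[m*o]*[n*p] m n (m ^ o) (n ^ o))

-- Each factor n^s + n^(s+1) x is n^s (1 + n x).
coeff-powers : {A : Set} (f : A → ℕ) (s : ℕ) → ∀ ts q →
  coeff (λ t → f t ^ s) (λ t → f t ^ suc s) ts q ≡ product (map f ts) ^ s * esym q (map f ts)
coeff-powers f s []       zero    = sym (trans (*-identityʳ _) (^-zeroˡ s))
coeff-powers f s []       (suc q) = sym (*-zeroʳ (1 ^ s))
coeff-powers f s (t ∷ ts) zero    = trans (cong (f t ^ s *_) (coeff-powers f s ts zero))
  (trans (sym (*-assoc (f t ^ s) _ 1)) (cong (_* 1) (sym (^-distribʳ-* (f t) (product (map f ts)) s))))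
coeff-powers f s (t ∷ ts) (suc q) = trans
  (cong₂ (λ u v → f t ^ s * u + f t * f t ^ s * v) (coeff-powers f s ts (suc q)) (coeff-powers f s ts q))
  (trans (lem (f t) (f t ^ s) (product (map f ts) ^ s) (esym (suc q) (map f ts)) (esym q (map f ts)))
         (cong (_* esym (suc q) (map f (t ∷ ts))) (sym (^-distribʳ-* (f t) (product (map f ts)) s))))
  where
  lem : ∀ x y p u v → y * (p * u) + x * y * (p * v) ≡ y * p * (u + x * v)
  lem = solve-∀

coeff-ones : {A : Set} → ∀ (ts : List A) q → coeff (λ _ → 1) (λ _ → 1) ts q ≡ binom (length ts) q
coeff-ones []       zero    = refl
coeff-ones []       (suc q) = refl
coeff-ones (t ∷ ts) zero    = trans (+-identityʳ _) (coeff-ones ts zero)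
coeff-ones (t ∷ ts) (suc q) = cong₂ _+_ (trans (*-identityˡ _) (coeff-ones ts (suc q))) (cong (_+ 0) (coeff-ones ts q))

-- The zeros stand for missing branches. They change neither e_b nor the power sums of positive
-- degree, and bring every list of branch sizes to length d.
pad : ℕ → List ℕ → List ℕ
pad m xs = replicate m 0 List.++ xs

esym-pad : ∀ m b xs → esym b (pad m xs) ≡ esym b xs
esym-pad m       zero    xs = refl
esym-pad zero    (suc b) xs = refl
esym-pad (suc m) (suc b) xs = trans (+-identityʳ _) (esym-pad m (suc b) xs)

sum-pad : ∀ m xs → sum (pad m xs) ≡ sum xs
sum-pad zero    xs = refl
sum-pad (suc m) xs = sum-pad m xs

powerSum-pad : ∀ m k xs → powerSum (suc k) (pad m xs) ≡ powerSum (suc k) xs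
powerSum-pad zero    k xs = refl
powerSum-pad (suc m) k xs = powerSum-pad m k xs

length-pad : ∀ {m} xs → length xs ≤ m → length (pad (m ∸ length xs) xs) ≡ m
length-pad {m} xs le = trans (length-++ (replicate (m ∸ length xs) 0))
  (trans (cong (_+ length xs) (length-replicate (m ∸ length xs))) (m∸n+n≡m le))

-- Without truncation, (A z - G) (a z - g) = z (A a z - a G - A g) + G g. If a factor on the right
-- is truncated to 0, so is the left side.
∸-*-∸ : ∀ z A G a g → z * (A * a * z ∸ (a * G + A * g)) ≤ (A * z ∸ G) * (a * z ∸ g)
∸-*-∸ z A G a g with ≤-total (A * z) G | ≤-total (a * z) g
... | inj₁ le | _ = ≤-trans (≤-reflexive (trans (cong (z *_) (m≤n⇒m∸n≡0
    (≤-trans (≤-reflexive (lem A a z)) (≤-trans (*-monoʳ-≤ a le) (m≤m+n (a * G) (A * g)))))) (*-zeroʳ z))) z≤n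
  where
  lem : ∀ A a z → A * a * z ≡ a * (A * z)
  lem = solve-∀
... | inj₂ _ | inj₁ le = ≤-trans (≤-reflexive (trans (cong (z *_) (m≤n⇒m∸n≡0
    (≤-trans (≤-reflexive (*-assoc A a z)) (≤-trans (*-monoʳ-≤ A le) (m≤n+m (A * g) (a * G)))))) (*-zeroʳ z))) z≤n
... | inj₂ le | inj₂ le′ with x , eq ← m≤n⇒∃[o]m+o≡n le | y , eq′ ← m≤n⇒∃[o]m+o≡n le′ = begin
  z * (A * a * z ∸ (a * G + A * g))               ≡⟨ *-distribˡ-∸ z (A * a * z) _ ⟩
  z * (A * a * z) ∸ z * (a * G + A * g)           ≡⟨ cong₂ _∸_ (lem₁ z A a) (lem₂ z A G a g) ⟩
  (A * z) * (a * z) ∸ ((a * z) * G + (A * z) * g)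
    ≡⟨ cong₂ (λ u v → u * v ∸ (v * G + u * g)) (sym eq) (sym eq′) ⟩
  (G + x) * (g + y) ∸ ((g + y) * G + (G + x) * g)
    ≤⟨ m≤n+o⇒m∸n≤o _ ((g + y) * G + (G + x) * g) (≤-trans (m≤m+n _ (G * g)) (≤-reflexive (lem₃ G g x y))) ⟩
  x * y                                           ≡⟨ cong₂ _*_ (diff G eq) (diff g eq′) ⟩
  (A * z ∸ G) * (a * z ∸ g)                       ∎
  where
  open ≤-Reasoning
  lem₁ : ∀ z A a → z * (A * a * z) ≡ (A * z) * (a * z)
  lem₁ = solve-∀
  lem₂ : ∀ z A G a g → z * (a * G + A * g) ≡ (a * z) * G + (A * z) * g
  lem₂ = solve-∀
  lem₃ : ∀ G g x y → (G + x) * (g + y) + G * g ≡ (g + y) * G + (G + x) * g + x * y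
  lem₃ = solve-∀
  diff : ∀ m {n o} → m + o ≡ n → o ≡ n ∸ m
  diff m {o = o} refl = sym (m+n∸m≡n m o)

-- A power of a linear lower bound is again z^(m-1) times a linear one, with a loss G independent of
-- z; the additional factor z admits m = 0.
∸-^ : ∀ a g m → ∃[ G ] (∀ z → z ^ m * (a ^ m * z ∸ G) ≤ z * (a * z ∸ g) ^ m)
∸-^ a g zero    = 0 , λ z → ≤-reflexive (trans (+-identityʳ _) (trans (+-identityʳ z) (sym (*-identityʳ z))))
∸-^ a g (suc m) with G , bound ← ∸-^ a g m = a * G + a ^ m * g , λ z → begin
  z * z ^ m * (a * a ^ m * z ∸ (a * G + a ^ m * g))
    ≡⟨ cong (λ u → z * z ^ m * (u * z ∸ (a * G + a ^ m * g))) (*-comm a (a ^ m)) ⟩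
  z * z ^ m * (a ^ m * a * z ∸ (a * G + a ^ m * g))     ≡⟨ lem z (z ^ m) _ ⟩
  z ^ m * (z * (a ^ m * a * z ∸ (a * G + a ^ m * g)))   ≤⟨ *-monoʳ-≤ (z ^ m) (∸-*-∸ z (a ^ m) G a g) ⟩
  z ^ m * ((a ^ m * z ∸ G) * (a * z ∸ g))               ≡⟨ *-assoc (z ^ m) _ _ ⟨
  z ^ m * (a ^ m * z ∸ G) * (a * z ∸ g)                 ≤⟨ *-monoˡ-≤ (a * z ∸ g) (bound z) ⟩
  z * (a * z ∸ g) ^ m * (a * z ∸ g)                     ≡⟨ lem′ z ((a * z ∸ g) ^ m) (a * z ∸ g) ⟩
  z * ((a * z ∸ g) * (a * z ∸ g) ^ m)                   ∎
  where
  open ≤-Reasoning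
  lem : ∀ z y w → z * y * w ≡ y * (z * w)
  lem = solve-∀
  lem′ : ∀ z y w → z * y * w ≡ z * (w * y)
  lem′ = solve-∀

∸-^-*-^ : ∀ a g m a′ g′ m′ → ∃[ G ] (∀ z → 0 < z →
  z ^ (m + m′) * (a ^ m * a′ ^ m′ * z ∸ G) ≤ z * ((a * z ∸ g) ^ m * (a′ * z ∸ g′) ^ m′))
∸-^-*-^ a g m a′ g′ m′ with G , bound ← ∸-^ a g m | G′ , bound′ ← ∸-^ a′ g′ m′ =
  a′ ^ m′ * G + a ^ m * G′ , λ z 0<z → let instance z≢0 = >-nonZero 0<z in *-cancelˡ-≤ z (begin
    z * (z ^ (m + m′) * (a ^ m * a′ ^ m′ * z ∸ (a′ ^ m′ * G + a ^ m * G′)))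
      ≡⟨ cong (λ u → z * (u * (a ^ m * a′ ^ m′ * z ∸ (a′ ^ m′ * G + a ^ m * G′)))) (^-distribˡ-+-* z m m′) ⟩
    z * (z ^ m * z ^ m′ * (a ^ m * a′ ^ m′ * z ∸ (a′ ^ m′ * G + a ^ m * G′)))
      ≡⟨ lem z (z ^ m * z ^ m′) _ ⟩
    z ^ m * z ^ m′ * (z * (a ^ m * a′ ^ m′ * z ∸ (a′ ^ m′ * G + a ^ m * G′)))
      ≤⟨ *-monoʳ-≤ (z ^ m * z ^ m′) (∸-*-∸ z (a ^ m) G (a′ ^ m′) G′) ⟩
    z ^ m * z ^ m′ * ((a ^ m * z ∸ G) * (a′ ^ m′ * z ∸ G′))
      ≡⟨ lem₁ (z ^ m) (z ^ m′) _ _ ⟩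
    z ^ m * (a ^ m * z ∸ G) * (z ^ m′ * (a′ ^ m′ * z ∸ G′))
      ≤⟨ *-mono-≤ (bound z) (bound′ z) ⟩
    z * (a * z ∸ g) ^ m * (z * (a′ * z ∸ g′) ^ m′)
      ≡⟨ lem₂ z ((a * z ∸ g) ^ m) ((a′ * z ∸ g′) ^ m′) ⟩
    z * (z * ((a * z ∸ g) ^ m * (a′ * z ∸ g′) ^ m′)) ∎)
  where
  open ≤-Reasoning
  lem : ∀ z y w → z * (y * w) ≡ y * (z * w)
  lem = solve-∀
  lem₁ : ∀ a b c d → a * b * (c * d) ≡ a * c * (b * d)
  lem₁ = solve-∀
  lem₂ : ∀ z x y → z * x * (z * y) ≡ z * (z * (x * y))
  lem₂ = solve-∀

-- Bounds on the number of copies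

sum-sizes : ∀ ts → sum (map ‖_‖ ts) ≡ ‖ ts ‖*
sum-sizes []       = refl
sum-sizes (t ∷ ts) = cong (_+_ ‖ t ‖) (sum-sizes ts)

sum-mono : ∀ {A : Set} {f g : A → ℕ} {x} {ts} → All (λ t → x * f t ≤ g t) ts → x * sum (map f ts) ≤ sum (map g ts)
sum-mono {x = x} []       = ≤-reflexive (*-zeroʳ x)
sum-mono {x = x} (p ∷ ps) = ≤-trans (≤-reflexive (*-distribˡ-+ x _ _)) (+-mono-≤ p (sum-mono {x = x} ps))

sum-lower : ∀ {A : Set} {f : A → ℕ} {x y} {ts} → All (λ t → y ≤ x * f t) ts → length ts * y ≤ x * sum (map f ts)
sum-lower {x = x} []       = z≤n
sum-lower {x = x} (p ∷ ps) = ≤-trans (+-mono-≤ p (sum-lower {x = x} ps)) (≤-reflexive (sym (*-distribˡ-+ x _ _)))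

powerSum-map : ∀ {A : Set} (f : A → ℕ) k (a : ℕ) ts → sum (map (λ t → a * f t ^ k) ts) ≡ a * powerSum k (map f ts)
powerSum-map f k a []       = sym (*-zeroʳ a)
powerSum-map f k a (t ∷ ts) = trans (cong (_+_ (a * f t ^ k)) (powerSum-map f k a ts)) (sym (*-distribˡ-+ a _ _))

module Bounded (d′ : ℕ) where

  open Even d′

  -- This is 2 d - 3: a strictly d-ary tree with m internal vertices has (d - 1) m + 1 leaves, hence
  -- `‖ T ‖ + e` = (d - 1) (m + 2).
  e : ℕ
  e = suc (d′ + d′)

  -- Balance enters only as a lower bound for each branch; counts from below require nothing about
  -- the largest one.
  data Balanced : Tree → Set where
    single : Balanced leaf
    branch : ∀ {t ts} → length (t ∷ ts) ≡ d →
      All (λ u → Balanced u × ‖ node (t ∷ ts) ‖ + e ≤ d * (‖ u ‖ + e)) (t ∷ ts) → Balanced (node (t ∷ ts))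

  -- The inducibility of E d k is k ! * α / β.
  record Bounds (k : ℕ) : Set where
    field
      α β γ′ : ℕ
      β>0    : 0 < β
      unit   : k ≡ 0 → α ≡ 1 × β ≡ 1
      upper  : ∀ T → Ary d T → β * count k T ≤ α * ‖ T ‖ ^ k
      lower  : ∀ T → Balanced T → ∀ z → z ≤ d * (‖ T ‖ + e) →
        z ^ k * (α * z ∸ d * γ′) ≤ d ^ k * β * z * count k T

  -- Turns the natural bound, in the size N of a tree, into the form that its parent of size z ≤ d N
  -- uses. In this form all branches get the same bound, and the exponent k in place of k - 1, paid
  -- for by the factor z on the right, covers the empty tree as well.
  rescale : ∀ k α β γ′ N x → N ^ k * (α * N ∸ γ′) ≤ β * x → ∀ z → z ≤ d * N →
    z ^ suc k * (α * z ∸ d * γ′) ≤ d ^ suc k * β * z * x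
  rescale k α β γ′ N x le z z≤dN = begin
    z * z ^ k * (α * z ∸ d * γ′)
      ≤⟨ *-mono-≤ (*-monoʳ-≤ z (^-monoˡ-≤ k z≤dN)) (∸-monoˡ-≤ (d * γ′) (*-monoʳ-≤ α z≤dN)) ⟩
    z * (d * N) ^ k * (α * (d * N) ∸ d * γ′)
      ≡⟨ cong₂ (λ u v → z * u * (v ∸ d * γ′)) (^-distribʳ-* d N k) (lem₁ α d N) ⟩
    z * (d ^ k * N ^ k) * (d * (α * N) ∸ d * γ′)
      ≡⟨ cong (z * (d ^ k * N ^ k) *_) (*-distribˡ-∸ d (α * N) γ′) ⟨
    z * (d ^ k * N ^ k) * (d * (α * N ∸ γ′)) ≡⟨ lem₂ z d (d ^ k) (N ^ k) (α * N ∸ γ′) ⟩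
    d * d ^ k * z * (N ^ k * (α * N ∸ γ′))   ≤⟨ *-monoʳ-≤ (d * d ^ k * z) le ⟩
    d * d ^ k * z * (β * x)                  ≡⟨ lem₃ (d * d ^ k) z β x ⟩
    d * d ^ k * β * z * x                    ∎
    where
    open ≤-Reasoning
    lem₁ : ∀ α d N → α * (d * N) ≡ d * (α * N)
    lem₁ = solve-∀
    lem₂ : ∀ z d y w v → z * (y * w) * (d * v) ≡ d * y * z * (w * v)
    lem₂ = solve-∀
    lem₃ : ∀ y z β x → y * z * (β * x) ≡ y * β * z * x
    lem₃ = solve-∀

  bounds-0 : Bounds 0
  bounds-0 = record
    { α = 1 ; β = 1 ; γ′ = 0 ; β>0 = s≤s z≤n ; unit = λ _ → refl , refl
    ; upper = λ _ _ → ≤-refl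
    ; lower = λ _ _ z _ → ≤-reflexive (trans (cong (λ u → 1 * (1 * z ∸ u)) (*-zeroʳ d)) (lem z))
    }
    where
    lem : ∀ z → 1 * (1 * z) ≡ 1 * 1 * z * 1
    lem = solve-∀

  bounds-1 : Bounds 1
  bounds-1 = record
    { α = 1 ; β = 1 ; γ′ = e ; β>0 = s≤s z≤n ; unit = λ ()
    ; upper = λ T _ → ≤-reflexive (trans (cong (1 *_) (c-leaf T)) (cong (1 *_) (sym (*-identityʳ _))))
    ; lower = λ T _ → rescale 0 1 1 e (‖ T ‖ + e) (c leaf T) (≤-reflexive (begin
        1 * (1 * (‖ T ‖ + e) ∸ e)   ≡⟨ *-identityˡ _ ⟩
        1 * (‖ T ‖ + e) ∸ e         ≡⟨ cong (_∸ e) (*-identityˡ (‖ T ‖ + e)) ⟩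
        ‖ T ‖ + e ∸ e               ≡⟨ m+n∸n≡m ‖ T ‖ e ⟩
        ‖ T ‖                       ≡⟨ c-leaf T ⟨
        c leaf T                    ≡⟨ *-identityˡ _ ⟨
        1 * c leaf T                ∎))
    }
    where open ≡-Reasoning

  coeff-esym : ∀ ts b → coeff (count 0) (count 1) ts b ≡ esym b (map ‖_‖ ts)
  coeff-esym []       zero    = refl
  coeff-esym []       (suc b) = refl
  coeff-esym (t ∷ ts) zero    = trans (+-identityʳ _) (coeff-esym ts zero)
  coeff-esym (t ∷ ts) (suc b) = cong₂ _+_ (trans (*-identityˡ _) (coeff-esym ts (suc b))) (cong₂ _*_ (c-leaf t) (coeff-esym ts b))

  mutual
    -- Any two leaves induce the cherry, whatever the tree.
    c-E₂ : ∀ T → 2 * c (E d 2) T + ‖ T ‖ ≡ ‖ T ‖ * ‖ T ‖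
    c-E₂ leaf            = refl
    c-E₂ (node (t ∷ ts)) = begin
      2 * c (E d 2) T + ‖ T ‖
        ≡⟨ cong (λ u → 2 * u + ‖ T ‖) (c-node (branchesOf 0 2) ≤-refl t ts) ⟩
      2 * (sum (map (c (E d 2)) (t ∷ ts)) + rootCopies (branchesOf 0 2) (t ∷ ts)) + ‖ T ‖
        ≡⟨ lem (sum (map (c (E d 2)) (t ∷ ts))) (rootCopies (branchesOf 0 2) (t ∷ ts)) ‖ T ‖ ⟩
      2 * rootCopies (branchesOf 0 2) (t ∷ ts) + (2 * sum (map (c (E d 2)) (t ∷ ts)) + ‖ T ‖)
        ≡⟨ cong₂ (λ u v → 2 * u + v) root (c-E₂* (t ∷ ts)) ⟩
      2 * esym 2 xs + powerSum 2 xs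
        ≡⟨ square-sum xs ⟨
      sum xs * sum xs
        ≡⟨ cong₂ _*_ (sum-sizes (t ∷ ts)) (sum-sizes (t ∷ ts)) ⟩
      ‖ T ‖ * ‖ T ‖ ∎
      where
      open ≡-Reasoning
      T = node (t ∷ ts)
      xs = map ‖_‖ (t ∷ ts)
      lem : ∀ a b n → 2 * (a + b) + n ≡ 2 * b + (2 * a + n)
      lem = solve-∀
      root : rootCopies (branchesOf 0 2) (t ∷ ts) ≡ esym 2 xs
      root = trans (rootCopies-star 2 (t ∷ ts)) (coeff-esym (t ∷ ts) 2)
    c-E₂* : ∀ ts → 2 * sum (map (c (E d 2)) ts) + ‖ ts ‖* ≡ powerSum 2 (map ‖_‖ ts)
    c-E₂* []       = refl
    c-E₂* (t ∷ ts) = trans (lem (c (E d 2) t) (sum (map (c (E d 2)) ts)) ‖ t ‖ ‖ ts ‖*)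
      (cong₂ _+_ (trans (c-E₂ t) (cong (‖ t ‖ *_) (sym (*-identityʳ ‖ t ‖)))) (c-E₂* ts))
      where
      lem : ∀ a b n m → 2 * (a + b) + (n + m) ≡ (2 * a + n) + (2 * b + m)
      lem = solve-∀

  bounds-2 : Bounds 2
  bounds-2 = record
    -- Here (n + e) (n + e - (2 e + 1)) = n (n - 1) - e (e + 1), which is at most 2 c by `c-E₂`.
    { α = 1 ; β = 2 ; γ′ = 2 * e + 1 ; β>0 = s≤s z≤n ; unit = λ ()
    ; upper = λ T _ → ≤-trans (m≤m+n _ ‖ T ‖) (≤-reflexive (trans (c-E₂ T) (lem₀ ‖ T ‖)))
    ; lower = λ T _ → rescale 1 1 2 (2 * e + 1) (‖ T ‖ + e) (c (E d 2) T) (low ‖ T ‖ (c (E d 2) T) (c-E₂ T))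
    }
    where
    lem₀ : ∀ n → n * n ≡ 1 * (n * (n * 1))
    lem₀ = solve-∀
    lem₁ : ∀ e t → e + 1 + t + e ≡ 2 * e + 1 + t
    lem₁ = solve-∀
    low : ∀ n x → 2 * x + n ≡ n * n → (n + e) ^ 1 * (1 * (n + e) ∸ (2 * e + 1)) ≤ 2 * x
    low n x eq with ≤-total (1 * (n + e)) (2 * e + 1)
    ... | inj₁ le = ≤-trans (≤-reflexive (trans (cong ((n + e) ^ 1 *_) (m≤n⇒m∸n≡0 le)) (*-zeroʳ ((n + e) ^ 1)))) z≤n
    ... | inj₂ le with t , eq′ ← m≤n⇒∃[o]m+o≡n le
      with refl ← +-cancelʳ-≡ e (e + 1 + t) n (trans (lem₁ e t) (trans eq′ (*-identityˡ (n + e)))) = begin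
        (e + 1 + t + e) ^ 1 * (1 * (e + 1 + t + e) ∸ (2 * e + 1))
          ≡⟨ cong (λ u → (e + 1 + t + e) ^ 1 * (u ∸ (2 * e + 1))) (sym eq′) ⟩
        (e + 1 + t + e) ^ 1 * (2 * e + 1 + t ∸ (2 * e + 1))
          ≡⟨ cong ((e + 1 + t + e) ^ 1 *_) (m+n∸m≡n (2 * e + 1) t) ⟩
        (e + 1 + t + e) ^ 1 * t
          ≤⟨ +-cancelʳ-≤ (e + 1 + t) _ _ (≤-trans (≤-trans (m≤m+n _ (e * e + e)) (≤-reflexive (lem₂ e t))) (≤-reflexive (sym eq))) ⟩
        2 * x ∎
        where
        open ≤-Reasoning
        lem₂ : ∀ e t → (e + 1 + t + e) * 1 * t + (e + 1 + t) + (e * e + e) ≡ (e + 1 + t) * (e + 1 + t)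
        lem₂ = solve-∀

-- From the bounds for s and s + 1 to those for k = d s + b

module Recursion (d′ : ℕ) where

  open Even d′
  open Bounded d′

  module Step (s b j : ℕ)
    (Bₛ : Bounds s) (Bₜ : Bounds (suc s)) (1≤b : 1 ≤ b) (b≤d : b ≤ d) (k≡ : d * s + b ≡ 3 + j) where

    open Bounds Bₛ using () renaming (α to αₛ; β to βₛ; γ′ to γₛ; β>0 to βₛ>0; unit to unitₛ; upper to upperₛ; lower to lowerₛ)
    open Bounds Bₜ using () renaming (α to αₜ; β to βₜ; γ′ to γₜ; β>0 to βₜ>0; upper to upperₜ; lower to lowerₜ)

    k p A B′ B : ℕ
    k = 3 + j
    p = d ∸ b
    A = αₛ ^ p * αₜ ^ b
    B′ = βₛ ^ p * βₜ ^ b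
    B = binom d b

    D : Tree
    D = E d k

    Ds : List Tree
    Ds = branchesOf s b

    p+b≡d : p + b ≡ d
    p+b≡d = m∸n+n≡m b≤d

    D≡ : D ≡ node Ds
    D≡ = trans (cong (E d) (sym k≡)) (E-branches s b 1≤b b≤d (subst (2 ≤_) (sym k≡) (s≤s (s≤s z≤n))))

    2≤Ds : 2 ≤ length Ds
    2≤Ds = length-branchesOf s b b≤d (subst (2 ≤_) (sym k≡) (s≤s (s≤s z≤n)))

    c-D : ∀ t ts → c D (node (t ∷ ts)) ≡ sum (map (c D) (t ∷ ts)) + rootCopies Ds (t ∷ ts)
    c-D t ts = subst (λ T → c T (node (t ∷ ts)) ≡ sum (map (c T) (t ∷ ts)) + rootCopies Ds (t ∷ ts)) (sym D≡)
      (c-node Ds 2≤Ds t ts)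

    c-D-leaf : c D leaf ≡ 0
    c-D-leaf = subst (λ T → c T leaf ≡ 0) (sym D≡) (c-node-leaf Ds (≤-trans (s≤s z≤n) 2≤Ds))

    ex : ℕ
    ex = excess d (2 + j)

    ex-^ : ex + d ≡ d ^ k
    ex-^ = excess-^ d (2 + j)

    -- With equal branches n / d the root has (A / B′) B n^k / d^k copies in the bound, to be
    -- matched with (α / β) n^k (1 - d / d^k). Hence α / β = A B / (B′ (d^k - d)).
    α β : ℕ
    α = A * B
    β = B′ * ex

    padded : List Tree → List ℕ
    padded ts = pad (d ∸ length ts) (map ‖_‖ ts)

    length-padded : ∀ ts → length ts ≤ d → length (padded ts) ≡ d
    length-padded ts le = subst (λ l → length (pad (d ∸ l) (map ‖_‖ ts)) ≡ d) (length-map ‖_‖ ts)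
      (length-pad (map ‖_‖ ts) (subst (_≤ d) (sym (length-map ‖_‖ ts)) le))

    monomials : List ℕ → ℕ
    monomials xs = product xs ^ s * esym b xs

    rootCopies-upper : ∀ ts → length ts ≤ d → All (Ary d) ts → B′ * rootCopies Ds ts ≤ A * monomials (padded ts)
    rootCopies-upper ts le as with m≤n⇒m<n∨m≡n le
    ... | inj₂ len = begin
      B′ * rootCopies Ds ts                         ≡⟨ cong (B′ *_) (rootCopies-full s b ts b≤d len) ⟩
      B′ * coeff (count s) (count (suc s)) ts b
        ≡⟨ coeff-scale (count s) (count (suc s)) βₛ βₜ ts p b len′ ⟨
      coeff (λ t → βₛ * count s t) (λ t → βₜ * count (suc s) t) ts b
        ≤⟨ coeff-mono (All.map (λ {t} a → upperₛ t a , upperₜ t a) as) b ⟩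
      coeff (λ t → αₛ * ‖ t ‖ ^ s) (λ t → αₜ * ‖ t ‖ ^ suc s) ts b
        ≡⟨ coeff-scale (λ t → ‖ t ‖ ^ s) (λ t → ‖ t ‖ ^ suc s) αₛ αₜ ts p b len′ ⟩
      A * coeff (λ t → ‖ t ‖ ^ s) (λ t → ‖ t ‖ ^ suc s) ts b
        ≡⟨ cong (A *_) (coeff-powers ‖_‖ s ts b) ⟩
      A * monomials (map ‖_‖ ts)
        ≡⟨ cong (λ m → A * monomials (pad m (map ‖_‖ ts))) (trans (sym (n∸n≡0 d)) (cong (d ∸_) (sym len))) ⟩
      A * monomials (padded ts) ∎
      where
      open ≤-Reasoning
      len′ : length ts ≡ p + b
      len′ = trans len (sym p+b≡d)
    ... | inj₁ len = few s refl
      where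
      few : ∀ r → r ≡ s → B′ * rootCopies Ds ts ≤ A * monomials (padded ts)
      -- For s ≥ 1 the pattern has d branches and does not fit at this root.
      few (suc r) refl = ≤-trans (≤-reflexive (trans (cong (B′ *_) (rootCopies-few r b ts b≤d len)) (*-zeroʳ B′))) z≤n
      -- A star still fits. Fewer than p branches may be skipped here, so the powers of αₛ and βₛ
      -- are harmless only because `unit` makes both constants 1; the product of the padded sizes
      -- has exponent 0.
      few zero    refl = begin
        B′ * rootCopies Ds ts
          ≡⟨ cong₂ (λ u v → u ^ p * βₜ ^ b * v) (proj₂ (unitₛ refl)) (rootCopies-star b ts) ⟩
        1 ^ p * βₜ ^ b * coeff (count 0) (count 1) ts b ≡⟨ one (βₜ ^ b) _ ⟩
        βₜ ^ b * coeff (count 0) (count 1) ts b       ≡⟨ coeff-scaleʳ (count 0) (count 1) βₜ ts b ⟨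
        coeff (count 0) (λ t → βₜ * count 1 t) ts b
          ≤⟨ coeff-mono (All.map (λ {t} a → ≤-refl , upperₜ t a) as) b ⟩
        coeff (λ t → ‖ t ‖ ^ 0) (λ t → αₜ * ‖ t ‖ ^ 1) ts b
          ≡⟨ coeff-scaleʳ (λ t → ‖ t ‖ ^ 0) (λ t → ‖ t ‖ ^ 1) αₜ ts b ⟩
        αₜ ^ b * coeff (λ t → ‖ t ‖ ^ 0) (λ t → ‖ t ‖ ^ 1) ts b
          ≡⟨ cong (αₜ ^ b *_) (trans (coeff-powers ‖_‖ 0 ts b) (cong (1 *_) (sym (esym-pad (d ∸ length ts) b (map ‖_‖ ts))))) ⟩
        αₜ ^ b * monomials (padded ts)                ≡⟨ one (αₜ ^ b) _ ⟨
        1 ^ p * αₜ ^ b * monomials (padded ts)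
          ≡⟨ cong (λ u → u ^ p * αₜ ^ b * monomials (padded ts)) (proj₁ (unitₛ refl)) ⟨
        A * monomials (padded ts)                     ∎
        where
        open ≤-Reasoning
        one : ∀ x y → 1 ^ p * x * y ≡ x * y
        one x y = cong (_* y) (trans (cong (_* x) (^-zeroˡ p)) (*-identityˡ x))

    monomials-bound : ∀ n xs → length xs ≡ n → b ≤ n → 2 ≤ n → n * s + b ≡ k →
      monomials xs * excess n (2 + j) + binom n b * powerSum k xs ≤ binom n b * sum xs ^ k
    monomials-bound _ xs refl b≤n 2≤n eq = proj₁ (balancedBound xs s b (suc j) 2≤n b≤n eq)

    mutual
      upper : ∀ T → Ary d T → β * c D T ≤ α * ‖ T ‖ ^ k
      upper leaf            isLeaf                  = ≤-trans (≤-reflexive (trans (cong (β *_) c-D-leaf) (*-zeroʳ β))) z≤n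
      upper (node (t ∷ ts)) (isNode (_ , len) as) = begin
        β * c D (node (t ∷ ts))                                 ≡⟨ cong (β *_) (c-D t ts) ⟩
        β * (sum (map (c D) ts′) + rootCopies Ds ts′)
          ≡⟨ lem₁ B′ ex (sum (map (c D) ts′)) (rootCopies Ds ts′) ⟩
        β * sum (map (c D) ts′) + ex * (B′ * rootCopies Ds ts′)
          ≤⟨ +-mono-≤ (sum-mono {x = β} (upper* ts′ as)) (*-monoʳ-≤ ex (rootCopies-upper ts′ len as)) ⟩
        sum (map (λ t → α * ‖ t ‖ ^ k) ts′) + ex * (A * M)
          ≡⟨ cong (_+ ex * (A * M)) (trans (powerSum-map ‖_‖ k α ts′) (cong (α *_) (sym (powerSum-pad (d ∸ length ts′) (2 + j) (map ‖_‖ ts′))))) ⟩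
        A * B * powerSum k xs + ex * (A * M)                    ≡⟨ lem₂ A B (powerSum k xs) ex M ⟩
        A * (M * ex + B * powerSum k xs)                        ≤⟨ *-monoʳ-≤ A bal ⟩
        A * (B * sum xs ^ k)                                    ≡⟨ *-assoc A B _ ⟨
        α * sum xs ^ k
          ≡⟨ cong (λ u → α * u ^ k) (trans (sum-pad (d ∸ length ts′) (map ‖_‖ ts′)) (sum-sizes ts′)) ⟩
        α * ‖ node (t ∷ ts) ‖ ^ k                               ∎
        where
        open ≤-Reasoning
        ts′ = t ∷ ts
        xs = padded ts′
        M = monomials xs
        lem₁ : ∀ B e a r → B * e * (a + r) ≡ B * e * a + e * (B * r)
        lem₁ = solve-∀
        lem₂ : ∀ A B p e M → A * B * p + e * (A * M) ≡ A * (M * e + B * p)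
        lem₂ = solve-∀
        bal : M * ex + B * powerSum k xs ≤ B * sum xs ^ k
        bal = monomials-bound d xs (length-padded ts′ len) b≤d (s≤s (s≤s z≤n)) k≡

      upper* : ∀ ts → All (Ary d) ts → All (λ t → β * c D t ≤ α * ‖ t ‖ ^ k) ts
      upper* []       []       = []
      upper* (t ∷ ts) (a ∷ as) = upper t a ∷ upper* ts as

    powers : ∀ x → (x ^ s) ^ p * (x ^ suc s) ^ b ≡ x ^ k
    powers x = begin
      (x ^ s) ^ p * (x ^ suc s) ^ b    ≡⟨ cong₂ _*_ (^-*-assoc x s p) (^-*-assoc x (suc s) b) ⟩
      x ^ (s * p) * x ^ (suc s * b)    ≡⟨ ^-distribˡ-+-* x (s * p) (suc s * b) ⟨
      x ^ (s * p + suc s * b)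
        ≡⟨ cong (x ^_) (trans (lem s p b) (trans (cong (λ m → m * s + b) p+b≡d) k≡)) ⟩
      x ^ k                            ∎
      where
      open ≡-Reasoning
      lem : ∀ s p b → s * p + suc s * b ≡ (p + b) * s + b
      lem = solve-∀

    Γ : ℕ
    Γ = proj₁ (∸-^-*-^ αₛ (d * γₛ) p αₜ (d * γₜ) b)

    Γ-bound : ∀ z → 0 < z → z ^ (p + b) * (A * z ∸ Γ) ≤ z * ((αₛ * z ∸ d * γₛ) ^ p * (αₜ * z ∸ d * γₜ) ^ b)
    Γ-bound = proj₂ (∸-^-*-^ αₛ (d * γₛ) p αₜ (d * γₜ) b)

    -- Every branch is bounded below in terms of z alone, so the coefficient collapses to B times a
    -- product of powers. Each of the d factors carries a spare z, and `Γ-bound` one more; these are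
    -- what is cancelled.
    rootCopies-lower : ∀ ts z → 0 < z → length ts ≡ d → All (λ t → Balanced t × z ≤ d * (‖ t ‖ + e)) ts →
      B * z ^ (2 + j) * (A * z ∸ Γ) ≤ d ^ k * B′ * rootCopies Ds ts
    rootCopies-lower ts z 0<z len bs = *-cancelˡ-≤ (z ^ (p + b)) (*-cancelˡ-≤ z (begin
      z * (z ^ (p + b) * (B * z ^ (2 + j) * (A * z ∸ Γ)))
        ≡⟨ lem₁ z (z ^ (p + b)) B (z ^ (2 + j)) (A * z ∸ Γ) ⟩
      B * z ^ k * (z ^ (p + b) * (A * z ∸ Γ))               ≤⟨ *-monoʳ-≤ (B * z ^ k) (Γ-bound z 0<z) ⟩
      B * z ^ k * (z * (Wₛ ^ p * Wₜ ^ b))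
        ≡⟨ cong (λ u → B * u * (z * (Wₛ ^ p * Wₜ ^ b))) (powers z) ⟨
      B * ((z ^ s) ^ p * (z ^ suc s) ^ b) * (z * (Wₛ ^ p * Wₜ ^ b))
        ≡⟨ lem₂ B ((z ^ s) ^ p) ((z ^ suc s) ^ b) z (Wₛ ^ p) (Wₜ ^ b) ⟩
      z * (((z ^ s) ^ p * Wₛ ^ p) * ((z ^ suc s) ^ b * Wₜ ^ b) * B)
        ≡⟨ cong₂ (λ u v → z * (u * v * B)) (^-distribʳ-* (z ^ s) Wₛ p) (^-distribʳ-* (z ^ suc s) Wₜ b) ⟨
      z * (Vₛ ^ p * Vₜ ^ b * B)
        ≡⟨ cong (λ m → z * (Vₛ ^ p * Vₜ ^ b * binom m b)) len ⟨
      z * (Vₛ ^ p * Vₜ ^ b * binom (length ts) b)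
        ≡⟨ cong (λ u → z * (Vₛ ^ p * Vₜ ^ b * u)) (coeff-ones ts b) ⟨
      z * (Vₛ ^ p * Vₜ ^ b * coeff (λ _ → 1) (λ _ → 1) ts b)
        ≡⟨ cong (z *_) (coeff-scale (λ _ → 1) (λ _ → 1) Vₛ Vₜ ts p b len′) ⟨
      z * coeff (λ _ → Vₛ * 1) (λ _ → Vₜ * 1) ts b          ≤⟨ *-monoʳ-≤ z (coeff-mono (All.map each bs) b) ⟩
      z * coeff (λ t → Yₛ * count s t) (λ t → Yₜ * count (suc s) t) ts b
        ≡⟨ cong (z *_) (coeff-scale (count s) (count (suc s)) Yₛ Yₜ ts p b len′) ⟩
      z * (Yₛ ^ p * Yₜ ^ b * coeff (count s) (count (suc s)) ts b)
        ≡⟨ cong₂ (λ u v → z * (u * v)) Y≡ (sym (rootCopies-full s b ts b≤d len)) ⟩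
      z * (z ^ (p + b) * (d ^ k * B′) * rootCopies Ds ts)   ≡⟨ cong (z *_) (*-assoc (z ^ (p + b)) _ _) ⟩
      z * (z ^ (p + b) * (d ^ k * B′ * rootCopies Ds ts))   ∎))
      where
      open ≤-Reasoning
      instance
        z≢0 : NonZero z
        z≢0 = >-nonZero 0<z
        z^≢0 : NonZero (z ^ (p + b))
        z^≢0 = m^n≢0 z (p + b)
      Wₛ = αₛ * z ∸ d * γₛ
      Wₜ = αₜ * z ∸ d * γₜ
      Vₛ = z ^ s * Wₛ
      Vₜ = z ^ suc s * Wₜ
      Yₛ = d ^ s * βₛ * z
      Yₜ = d ^ suc s * βₜ * z
      len′ : length ts ≡ p + b
      len′ = trans len (sym p+b≡d)
      each : ∀ {t} → Balanced t × z ≤ d * (‖ t ‖ + e) → Vₛ * 1 ≤ Yₛ * count s t × Vₜ * 1 ≤ Yₜ * count (suc s) t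
      each {t} (bal , le) = ≤-trans (≤-reflexive (*-identityʳ Vₛ)) (lowerₛ t bal z le) ,
                            ≤-trans (≤-reflexive (*-identityʳ Vₜ)) (lowerₜ t bal z le)
      lem₃ : ∀ a b c x y z → (a * b * c) * (x * y * z) ≡ c * z * (a * x * (b * y))
      lem₃ = solve-∀
      Y≡ : Yₛ ^ p * Yₜ ^ b ≡ z ^ (p + b) * (d ^ k * B′)
      Y≡ = begin-equality
        (d ^ s * βₛ * z) ^ p * (d ^ suc s * βₜ * z) ^ b
          ≡⟨ cong₂ _*_ (trans (^-distribʳ-* (d ^ s * βₛ) z p) (cong (_* z ^ p) (^-distribʳ-* (d ^ s) βₛ p)))
                       (trans (^-distribʳ-* (d ^ suc s * βₜ) z b) (cong (_* z ^ b) (^-distribʳ-* (d ^ suc s) βₜ b))) ⟩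
        ((d ^ s) ^ p * βₛ ^ p * z ^ p) * ((d ^ suc s) ^ b * βₜ ^ b * z ^ b)
          ≡⟨ lem₃ ((d ^ s) ^ p) (βₛ ^ p) (z ^ p) ((d ^ suc s) ^ b) (βₜ ^ b) (z ^ b) ⟩
        z ^ p * z ^ b * ((d ^ s) ^ p * (d ^ suc s) ^ b * B′)
          ≡⟨ cong₂ (λ u v → u * (v * B′)) (sym (^-distribˡ-+-* z p b)) (powers d) ⟩
        z ^ (p + b) * (d ^ k * B′) ∎
      lem₁ : ∀ z y B x w → z * (y * (B * x * w)) ≡ B * (z * x) * (y * w)
      lem₁ = solve-∀
      lem₂ : ∀ B u v z x y → B * (u * v) * (z * (x * y)) ≡ z * ((u * x) * (v * y) * B)
      lem₂ = solve-∀

    γ′ : ℕ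
    γ′ = ex * B * Γ + α * (1 + e)

    -- The terms of γ′ not involving Γ let the leaf satisfy the bound trivially; the others absorb the
    -- error of the copies at the root because d ^ k ∸ d ^ 2 is positive for k ≥ 3.
    error : d * (d * γ′) + ex * (B * Γ) ≤ d ^ k * γ′
    error = begin
      d * (d * γ′) + ex * (B * Γ)
        ≤⟨ +-monoʳ-≤ (d * (d * γ′)) (≤-trans (≤-reflexive (sym (*-assoc ex B Γ))) (m≤m+n _ (α * (1 + e)))) ⟩
      d * (d * γ′) + γ′              ≡⟨ lem d γ′ ⟩
      (d * d + 1) * γ′
        ≤⟨ *-monoˡ-≤ γ′ (≤-trans (≤-reflexive (+-comm (d * d) 1)) (≤-trans (m<m*n (d * d) d (s≤s (s≤s z≤n))) cube)) ⟩
      d ^ k * γ′                     ∎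
      where
      open ≤-Reasoning
      lem : ∀ d g → d * (d * g) + g ≡ (d * d + 1) * g
      lem = solve-∀
      lem′ : ∀ d x → d * d * (d * x) ≡ d * (d * (d * x))
      lem′ = solve-∀
      cube : d * d * d ≤ d ^ k
      cube = ≤-trans (*-monoʳ-≤ (d * d) (m≤m*n d (d ^ j) {{m^n≢0 d j}})) (≤-reflexive (lem′ d (d ^ j)))

    mutual
      -- The identity d^k = d + `ex` splits d^k α z: the d branches account for d α z with loss d (d
      -- γ′), the copies at the root for `ex` α z with loss `ex` B Γ. By `error`, d^k γ′ covers both
      -- losses.
      lower : ∀ T → Balanced T → (‖ T ‖ + e) ^ (2 + j) * (α * (‖ T ‖ + e) ∸ γ′) ≤ β * c D T
      lower leaf            single          = ≤-trans (≤-reflexive (trans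
        (cong ((1 + e) ^ (2 + j) *_) (m≤n⇒m∸n≡0 (m≤n+m (α * (1 + e)) (ex * B * Γ)))) (*-zeroʳ ((1 + e) ^ (2 + j))))) z≤n
      lower (node (t ∷ ts)) (branch len bs) = *-cancelˡ-≤ (d ^ k) {{m^n≢0 d k}} (begin
        d ^ k * (Z * (α * z ∸ γ′))                                  ≡⟨ lem₁ (d ^ k) Z (α * z ∸ γ′) ⟩
        Z * (d ^ k * (α * z ∸ γ′))
          ≡⟨ cong (Z *_) (*-distribˡ-∸ (d ^ k) (α * z) γ′) ⟩
        Z * (d ^ k * (α * z) ∸ d ^ k * γ′)
          ≤⟨ *-monoʳ-≤ Z (∸-monoʳ-≤ (d ^ k * (α * z)) error) ⟩
        Z * (d ^ k * (α * z) ∸ (d * (d * γ′) + ex * (B * Γ)))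
          ≡⟨ cong (λ u → Z * (u * (α * z) ∸ (d * (d * γ′) + ex * (B * Γ)))) (trans (sym ex-^) (+-comm ex d)) ⟩
        Z * ((d + ex) * (α * z) ∸ (d * (d * γ′) + ex * (B * Γ)))
          ≡⟨ cong (λ u → Z * (u ∸ (d * (d * γ′) + ex * (B * Γ)))) (lem₂ d ex A B z) ⟩
        Z * (d * (α * z) + ex * (B * (A * z)) ∸ (d * (d * γ′) + ex * (B * Γ)))
          ≤⟨ *-monoʳ-≤ Z (∸-+-∸ (d * (α * z)) (ex * (B * (A * z))) (d * (d * γ′)) (ex * (B * Γ))) ⟩
        Z * ((d * (α * z) ∸ d * (d * γ′)) + (ex * (B * (A * z)) ∸ ex * (B * Γ)))
          ≡⟨ cong (Z *_) (cong₂ _+_ (*-distribˡ-∸ d (α * z) (d * γ′)) (trans (cong (ex *_) (*-distribˡ-∸ B (A * z) Γ)) (*-distribˡ-∸ ex (B * (A * z)) (B * Γ)))) ⟨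
        Z * (d * (α * z ∸ d * γ′) + ex * (B * (A * z ∸ Γ)))
          ≡⟨ lem₃ Z d (α * z ∸ d * γ′) ex B (A * z ∸ Γ) ⟩
        d * (Z * (α * z ∸ d * γ′)) + ex * (B * Z * (A * z ∸ Γ))
          ≤⟨ +-mono-≤ below (*-monoʳ-≤ ex (rootCopies-lower ts′ z 0<z len bs)) ⟩
        d ^ k * β * sum (map (c D) ts′) + ex * (d ^ k * B′ * rootCopies Ds ts′)
          ≡⟨ lem₄ (d ^ k) B′ ex (sum (map (c D) ts′)) (rootCopies Ds ts′) ⟩
        d ^ k * (β * (sum (map (c D) ts′) + rootCopies Ds ts′))
          ≡⟨ cong (λ u → d ^ k * (β * u)) (c-D t ts) ⟨
        d ^ k * (β * c D (node ts′))                                ∎)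
        where
        open ≤-Reasoning
        ts′ = t ∷ ts
        z = ‖ node ts′ ‖ + e
        Z = z ^ (2 + j)
        0<z : 0 < z
        0<z = ≤-trans (s≤s z≤n) (m≤n+m e ‖ node ts′ ‖)
        lem₁ : ∀ x y w → x * (y * w) ≡ y * (x * w)
        lem₁ = solve-∀
        lem₂ : ∀ d ex A B z → (d + ex) * (A * B * z) ≡ d * (A * B * z) + ex * (B * (A * z))
        lem₂ = solve-∀
        lem₃ : ∀ Z d x ex B y → Z * (d * x + ex * (B * y)) ≡ d * (Z * x) + ex * (B * Z * y)
        lem₃ = solve-∀
        lem₄ : ∀ q B ex a r → q * (B * ex) * a + ex * (q * B * r) ≡ q * (B * ex * (a + r))
        lem₄ = solve-∀
        ∸-+-∸ : ∀ a b g h → a + b ∸ (g + h) ≤ (a ∸ g) + (b ∸ h)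
        ∸-+-∸ a b g h = m≤n+o⇒m∸n≤o (a + b) (g + h) (≤-trans (+-mono-≤ (m≤n+m∸n a g) (m≤n+m∸n b h))
          (≤-reflexive ([m+n]+[o+p]≡[m+o]+[n+p] g (a ∸ g) h (b ∸ h))))
          where
          [m+n]+[o+p]≡[m+o]+[n+p] : ∀ m n o p → (m + n) + (o + p) ≡ (m + o) + (n + p)
          [m+n]+[o+p]≡[m+o]+[n+p] = solve-∀
        below : d * (Z * (α * z ∸ d * γ′)) ≤ d ^ k * β * sum (map (c D) ts′)
        below = ≤-trans (≤-reflexive (cong (_* (Z * (α * z ∸ d * γ′))) (sym len))) (sum-lower {x = d ^ k * β} (lower* ts′ z 0<z bs))

      lower* : ∀ ts z → 0 < z → All (λ t → Balanced t × z ≤ d * (‖ t ‖ + e)) ts →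
        All (λ t → z ^ (2 + j) * (α * z ∸ d * γ′) ≤ d ^ k * β * c D t) ts
      lower* []       z 0<z []              = []
      lower* (t ∷ ts) z 0<z ((bal , le) ∷ bs) = *-cancelˡ-≤ z {{>-nonZero 0<z}} (begin
        z * (z ^ (2 + j) * (α * z ∸ d * γ′))   ≡⟨ *-assoc z (z ^ (2 + j)) _ ⟨
        z ^ k * (α * z ∸ d * γ′)
          ≤⟨ rescale (2 + j) α β γ′ (‖ t ‖ + e) (c D t) (lower t bal) z le ⟩
        d ^ k * β * z * c D t                  ≡⟨ lem (d ^ k * β) z (c D t) ⟩
        z * (d ^ k * β * c D t)                ∎) ∷ lower* ts z 0<z bs
        where
        open ≤-Reasoning
        lem : ∀ x z y → x * z * y ≡ z * (x * y)
        lem = solve-∀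

    bounds : Bounds (3 + j)
    bounds = record
      { α = α ; β = β ; γ′ = γ′ ; unit = λ ()
      ; β>0 = >-nonZero⁻¹ β
      ; upper = upper
      ; lower = λ T bal → rescale (2 + j) α β γ′ (‖ T ‖ + e) (c D T) (lower T bal)
      }
      where
      instance
        βₛ≢0 = >-nonZero βₛ>0
        βₜ≢0 = >-nonZero βₜ>0
        βₛ^≢0 = m^n≢0 βₛ p
        βₜ^≢0 = m^n≢0 βₜ b
        B′≢0 : NonZero B′
        B′≢0 = m*n≢0 (βₛ ^ p) (βₜ ^ b)
        ex≢0 : NonZero ex
        ex≢0 = >-nonZero (≤-trans (s≤s z≤n) (m≤n+m (d * suc d′) (d * excess d (suc j))))
        β≢0 : NonZero β
        β≢0 = m*n≢0 B′ ex

  bounds : ∀ k → Bounds k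
  bounds = <-rec Bounds step
    where
    step : ∀ k → (∀ {j} → j < k → Bounds j) → Bounds k
    step zero                ih = bounds-0
    step (suc zero)          ih = bounds-1
    step (suc (suc zero))    ih = bounds-2
    step (suc (suc (suc j))) ih with s , b , 1≤b , b≤d , k≡ , s<k ← split (3 + j) (s≤s (s≤s z≤n)) =
      Step.bounds s b j (ih (<-trans (n<1+n s) s<k)) (ih s<k) 1≤b b≤d k≡

-- Balanced strictly d-ary trees

module Construction (d′ : ℕ) where

  open Even d′
  open Bounded d′

  mutual
    strictlyAry⇒ary : ∀ {T} → StrictlyAry d T → Ary d T
    strictlyAry⇒ary isLeaf           = isLeaf
    strictlyAry⇒ary (isNode len as) = isNode (subst (2 ≤_) (sym len) (s≤s (s≤s z≤n)) , ≤-reflexive len) (strictlyAry⇒ary* as)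

    strictlyAry⇒ary* : ∀ {ts} → All (StrictlyAry d) ts → All (Ary d) ts
    strictlyAry⇒ary* []       = []
    strictlyAry⇒ary* (a ∷ as) = strictlyAry⇒ary a ∷ strictlyAry⇒ary* as

  mutual
    balanced⇒strictlyAry : ∀ {T} → Balanced T → StrictlyAry d T
    balanced⇒strictlyAry single          = isLeaf
    balanced⇒strictlyAry (branch len bs) = isNode len (balanced⇒strictlyAry* bs)

    balanced⇒strictlyAry* : ∀ {P : Tree → Set} {ts} → All (λ t → Balanced t × P t) ts → All (StrictlyAry d) ts
    balanced⇒strictlyAry* []             = []
    balanced⇒strictlyAry* ((b , _) ∷ bs) = balanced⇒strictlyAry b ∷ balanced⇒strictlyAry* bs

  BalancedTree : ℕ → Set
  BalancedTree n = ∃[ T ] (Balanced T × ‖ T ‖ ≡ suc d′ * n + 1)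

  -- The tree has n + 1 internal vertices and each branch at least the leaves for q. With the shift,
  -- the claim becomes (d - 1) (n + 3) ≤ d (d - 1) (q + 2), which follows from n + 1 ≤ d (q + 1) and
  -- 2 ≤ d.
  graft : ∀ n q ts → n < d * suc q → length ts ≡ d → ‖ ts ‖* ≡ suc d′ * suc n + 1 →
    All (λ t → Balanced t × suc d′ * q + 1 ≤ ‖ t ‖) ts → BalancedTree (suc n)
  graft n q (t ∷ ts) n< len size bs = node (t ∷ ts) , branch len (All.map (λ (b , le) → b , even-sizes le) bs) , size
    where
    open ≤-Reasoning
    even-sizes : ∀ {x} → suc d′ * q + 1 ≤ x → ‖ t ∷ ts ‖* + e ≤ d * (x + e)
    even-sizes {x} le = begin
      ‖ t ∷ ts ‖* + e                    ≡⟨ cong (_+ e) size ⟩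
      suc d′ * suc n + 1 + e             ≡⟨ lem₁ d′ n ⟩
      suc d′ * (suc n + 2)               ≤⟨ *-monoʳ-≤ (suc d′) (+-mono-≤ n< (m≤m+n 2 d′)) ⟩
      suc d′ * (d * suc q + d)           ≡⟨ lem₂ d′ q ⟩
      d * (suc d′ * q + 1 + e)           ≤⟨ *-monoʳ-≤ d (+-monoˡ-≤ e le) ⟩
      d * (x + e)                        ∎
      where
      lem₁ : ∀ d′ n → suc d′ * suc n + 1 + suc (d′ + d′) ≡ suc d′ * (suc n + 2)
      lem₁ = solve-∀
      lem₂ : ∀ d′ q → suc d′ * ((2 + d′) * suc q + (2 + d′)) ≡ (2 + d′) * (suc d′ * q + 1 + suc (d′ + d′))
      lem₂ = solve-∀

  -- The parameter is the number of internal vertices. One is the root; the others are dealt out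
  -- evenly, r branches receiving q + 1 and the other d - r receiving q.
  balancedTree : ∀ n → BalancedTree n
  balancedTree = <-rec BalancedTree step
    where
    step : ∀ n → (∀ {m} → m < n → BalancedTree m) → BalancedTree n
    step zero    ih = leaf , single , cong (_+ 1) (sym (*-zeroʳ d′))
    step (suc n) ih = build (n / d) (n % d) (m≡m%n+[m/n]*n n d) (m%n<n n d)
      where
      lem₀ : ∀ d′ q → (2 + d′) * (suc d′ * q + 1) ≡ suc d′ * suc (q * (2 + d′)) + 1
      lem₀ = solve-∀
      lem₁ : ∀ p r d′ q → p * (suc d′ * q + 1) + r * (suc d′ * suc q + 1) ≡ suc d′ * (r + q * (p + r)) + (p + r)
      lem₁ = solve-∀
      lem₂ : ∀ d′ m → suc d′ * m + (2 + d′) ≡ suc d′ * suc m + 1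
      lem₂ = solve-∀
      lem₃ : ∀ q d → d + q * d ≡ d * suc q
      lem₃ = solve-∀
      build : ∀ q r → n ≡ r + q * d → r < d → BalancedTree (suc n)
      build q r eq r<d with T , bal , size ← ih {q} (s≤s (≤-trans (m≤m*n q d) (≤-trans (m≤n+m (q * d) r) (≤-reflexive (sym eq))))) = with-rest r eq r<d
        where
        with-rest : ∀ r → n ≡ r + q * d → r < d → BalancedTree (suc n)
        -- Separate because at n = 0 a branch with q + 1 internal vertices would be no smaller than
        -- the tree under construction.
        with-rest zero eq _ = graft n q (replicate d T) n< (length-replicate d)
          (trans (‖replicate‖ d T) (trans (cong (d *_) size) (trans (lem₀ d′ q) (cong (λ m → suc d′ * suc m + 1) (sym eq)))))
          (All.replicate⁺ d (bal , ≤-reflexive (sym size)))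
          where
          n< : n < d * suc q
          n< = ≤-trans (s≤s (≤-reflexive eq)) (≤-trans (+-monoˡ-≤ (q * d) (s≤s z≤n)) (≤-reflexive (lem₃ q d)))
        with-rest (suc r) eq r<d with U , bal′ , size′ ← ih {suc q} (s≤s (≤-trans (s≤s (≤-trans (m≤m*n q d) (m≤n+m (q * d) r))) (≤-reflexive (sym eq)))) =
          graft n q (replicate p T List.++ replicate (suc r) U) n<
            (trans (length-++ (replicate p T)) (trans (cong₂ _+_ (length-replicate p) (length-replicate (suc r))) p+r≡d))
            total
            (All.++⁺ (All.replicate⁺ p (bal , ≤-reflexive (sym size)))
              (All.replicate⁺ (suc r) (bal′ , ≤-trans (+-monoˡ-≤ 1 (*-monoʳ-≤ (suc d′) (n≤1+n q))) (≤-reflexive (sym size′)))))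
          where
          p = d ∸ suc r
          p+r≡d : p + suc r ≡ d
          p+r≡d = m∸n+n≡m (<⇒≤ r<d)
          n< : n < d * suc q
          n< = ≤-trans (s≤s (≤-reflexive eq)) (≤-trans (+-monoˡ-≤ (q * d) r<d) (≤-reflexive (lem₃ q d)))
          total : ‖ replicate p T List.++ replicate (suc r) U ‖* ≡ suc d′ * suc n + 1
          total = begin
            ‖ replicate p T List.++ replicate (suc r) U ‖*   ≡⟨ ‖++‖ (replicate p T) _ ⟩
            ‖ replicate p T ‖* + ‖ replicate (suc r) U ‖*
              ≡⟨ cong₂ _+_ (‖replicate‖ p T) (‖replicate‖ (suc r) U) ⟩
            p * ‖ T ‖ + suc r * ‖ U ‖
              ≡⟨ cong₂ (λ u v → p * u + suc r * v) size size′ ⟩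
            p * (suc d′ * q + 1) + suc r * (suc d′ * suc q + 1) ≡⟨ lem₁ p (suc r) d′ q ⟩
            suc d′ * (suc r + q * (p + suc r)) + (p + suc r)
              ≡⟨ cong (λ m → suc d′ * (suc r + q * m) + m) p+r≡d ⟩
            suc d′ * (suc r + q * d) + d                      ≡⟨ cong (λ m → suc d′ * m + d) eq ⟨
            suc d′ * n + d                                    ≡⟨ lem₂ d′ n ⟩
            suc d′ * suc n + 1                                ∎
            where open ≡-Reasoning

-- Densities

binom≡C : ∀ n k → binom n k ≡ n C k
binom≡C n       zero    = refl
binom≡C zero    (suc k) = refl
binom≡C (suc n) (suc k) = trans (+-comm (binom n (suc k)) (1 * binom n k))
  (trans (cong₂ _+_ (trans (*-identityˡ _) (binom≡C n k)) (binom≡C n (suc k))) (nCk+nC[k+1]≡[n+1]C[k+1] n k))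

falling : ℕ → ℕ → ℕ
falling n k = k ! * binom n k

falling-suc : ∀ n k → falling n (suc k) + k * falling n k ≡ n * falling n k
falling-suc n k = trans (lem₁ k (k !) (binom n (suc k)) (binom n k))
  (trans (cong (k ! *_) (binom-step n k)) (lem₂ n (k !) (binom n k)))
  where
  lem₁ : ∀ k f b₁ b₀ → suc k * f * b₁ + k * (f * b₀) ≡ f * (suc k * b₁ + k * b₀)
  lem₁ = solve-∀
  lem₂ : ∀ n f b → f * (n * b) ≡ n * (f * b)
  lem₂ = solve-∀

falling≤^ : ∀ n k → falling n k ≤ n ^ k
falling≤^ n zero    = ≤-refl
falling≤^ n (suc k) = ≤-trans (m≤m+n _ (k * falling n k))
  (≤-trans (≤-reflexive (falling-suc n k)) (*-monoʳ-≤ n (falling≤^ n k)))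

^≤falling : ∀ k → ∃[ K ] (∀ n → n ^ suc k ≤ falling n (suc k) + K * n ^ k)
^≤falling zero = 0 , λ n → ≤-reflexive (sym (trans (falling-suc n 0) refl))
^≤falling (suc k) with K , bound ← ^≤falling k = suc k + K , λ n → begin
  n * n ^ suc k                                                   ≤⟨ *-monoʳ-≤ n (bound n) ⟩
  n * (falling n (suc k) + K * n ^ k)                             ≡⟨ lem₁ n (falling n (suc k)) K (n ^ k) ⟩
  n * falling n (suc k) + K * n ^ suc k
    ≡⟨ cong (_+ K * n ^ suc k) (falling-suc n (suc k)) ⟨
  falling n (2 + k) + suc k * falling n (suc k) + K * n ^ suc k
    ≤⟨ +-monoˡ-≤ _ (+-monoʳ-≤ (falling n (2 + k)) (*-monoʳ-≤ (suc k) (falling≤^ n (suc k)))) ⟩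
  falling n (2 + k) + suc k * n ^ suc k + K * n ^ suc k
    ≡⟨ lem₂ (falling n (2 + k)) (suc k) K (n ^ suc k) ⟩
  falling n (2 + k) + (suc k + K) * n ^ suc k                     ∎
  where
  open ≤-Reasoning
  lem₁ : ∀ n f K x → n * (f + K * x) ≡ n * f + K * (n * x)
  lem₁ = solve-∀
  lem₂ : ∀ f k K x → f + k * x + K * x ≡ f + (k + K) * x
  lem₂ = solve-∀

module Densities (d′ k : ℕ) where

  open Even d′
  open Bounded d′
  open Construction d′
  open Bounds (Recursion.bounds d′ (suc k)) public using (α; β; γ′; β>0; upper; lower)

  -- From N₀ on, the correction K n^k is at most half of n^(k+1), so falling factorials and powers
  -- agree up to a factor 2; the summand 1 keeps n positive.
  K N₀ : ℕ
  K = proj₁ (^≤falling k)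
  N₀ = 1 + 2 * K

  v : ℕ
  v = α * suc k !

  D : Tree
  D = E d (suc k)

  ^≤2falling : ∀ n → N₀ ≤ n → n ^ suc k ≤ 2 * falling n (suc k)
  ^≤2falling n N₀≤n = +-cancelʳ-≤ (n * n ^ k) _ _ (begin
    n * n ^ k + n * n ^ k                        ≡⟨ lem (n * n ^ k) ⟩
    2 * (n * n ^ k)                              ≤⟨ *-monoʳ-≤ 2 (proj₂ (^≤falling k) n) ⟩
    2 * (falling n (suc k) + K * n ^ k)          ≡⟨ lem′ (falling n (suc k)) K (n ^ k) ⟩
    2 * falling n (suc k) + 2 * K * n ^ k
      ≤⟨ +-monoʳ-≤ _ (*-monoˡ-≤ (n ^ k) (≤-trans (n≤1+n (2 * K)) N₀≤n)) ⟩
    2 * falling n (suc k) + n * n ^ k            ∎)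
    where
    open ≤-Reasoning
    lem : ∀ x → x + x ≡ 2 * x
    lem = solve-∀
    lem′ : ∀ f K x → 2 * (f + K * x) ≡ 2 * f + 2 * K * x
    lem′ = solve-∀

  C>0 : ∀ n → N₀ ≤ n → 0 < n C suc k
  C>0 n N₀≤n = subst (0 <_) (binom≡C n (suc k)) (n≢0⇒n>0 λ eq → <⇒≱ 0<n^ (≤-trans (^≤2falling n N₀≤n)
    (≤-reflexive (trans (cong (λ b → 2 * (suc k ! * b)) eq) (cong (2 *_) (*-zeroʳ (suc k !)))))))
    where
    0<n^ : 0 < n ^ suc k
    0<n^ = >-nonZero⁻¹ (n ^ suc k) {{m^n≢0 n (suc k) {{>-nonZero (≤-trans (s≤s z≤n) N₀≤n)}}}}

  C₁ C₂ g : ℕ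
  C₁ = α * K * 2 * suc k !
  g = γ′ * (1 + e) ^ k
  C₂ = g * 2 * suc k !

  -- The estimate γ ≤ v / β + C₁ / n with denominators cleared. C₁ comes from replacing the power of
  -- n by the falling factorial.
  upper-cross : ∀ T → Ary d T → N₀ ≤ ‖ T ‖ →
    c D T * (β * ‖ T ‖) ≤ (v * ‖ T ‖ + C₁ * β) * (‖ T ‖ C suc k)
  upper-cross T a N₀≤n = begin
    c D T * (β * n)                           ≡⟨ lem₁ (c D T) β n ⟩
    β * c D T * n                             ≤⟨ *-monoˡ-≤ n (upper T a) ⟩
    α * n ^ suc k * n                         ≤⟨ *-monoˡ-≤ n (*-monoʳ-≤ α (proj₂ (^≤falling k) n)) ⟩
    α * (falling n (suc k) + K * n ^ k) * n   ≡⟨ lem₂ α (suc k !) (binom n (suc k)) K (n ^ k) n ⟩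
    α * suc k ! * n * binom n (suc k) + α * K * n ^ suc k
      ≤⟨ +-monoʳ-≤ _ (*-monoʳ-≤ (α * K) (^≤2falling n N₀≤n)) ⟩
    α * suc k ! * n * binom n (suc k) + α * K * (2 * (suc k ! * binom n (suc k)))
      ≡⟨ lem₃ α (suc k !) n (binom n (suc k)) K ⟩
    (v * n + C₁ * 1) * binom n (suc k)
      ≤⟨ *-monoˡ-≤ (binom n (suc k)) (+-monoʳ-≤ (v * n) (*-monoʳ-≤ C₁ β>0)) ⟩
    (v * n + C₁ * β) * binom n (suc k)        ≡⟨ cong ((v * n + C₁ * β) *_) (binom≡C n (suc k)) ⟩
    (v * n + C₁ * β) * (n C suc k)            ∎
    where
    open ≤-Reasoning
    n = ‖ T ‖
    lem₁ : ∀ c b n → c * (b * n) ≡ b * c * n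
    lem₁ = solve-∀
    lem₂ : ∀ a f b K x n → a * (f * b + K * x) * n ≡ a * f * n * b + a * K * (n * x)
    lem₂ = solve-∀
    lem₃ : ∀ a f n b K → a * f * n * b + a * K * (2 * (f * b)) ≡ (a * f * n + a * K * 2 * f * 1) * b
    lem₃ = solve-∀

  lower′ : ∀ T → Balanced T → α * ‖ T ‖ ^ suc k ≤ β * c D T + g * ‖ T ‖ ^ k
  lower′ T bal = begin
    α * (n * n ^ k)
      ≤⟨ *-monoʳ-≤ α (*-mono-≤ (m≤m+n n e) (^-monoˡ-≤ k (m≤m+n n e))) ⟩
    α * (z * z ^ k)                           ≡⟨ lem₁ α z (z ^ k) ⟩
    z ^ k * (α * z)                           ≤⟨ *-monoʳ-≤ (z ^ k) (m≤n+m∸n (α * z) γ′) ⟩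
    z ^ k * (γ′ + (α * z ∸ γ′))               ≡⟨ lem₂ (z ^ k) γ′ (α * z ∸ γ′) ⟩
    z ^ k * (α * z ∸ γ′) + γ′ * z ^ k         ≤⟨ +-mono-≤ plain (*-monoʳ-≤ γ′ small) ⟩
    β * c D T + γ′ * ((1 + e) ^ k * n ^ k)    ≡⟨ cong (_+_ (β * c D T)) (*-assoc γ′ ((1 + e) ^ k) (n ^ k)) ⟨
    β * c D T + g * n ^ k                     ∎
    where
    open ≤-Reasoning
    n = ‖ T ‖
    z = n + e
    instance
      z≢0 : NonZero z
      z≢0 = >-nonZero (≤-trans (s≤s z≤n) (m≤n+m e n))
      d^≢0 : NonZero (d ^ suc k)
      d^≢0 = m^n≢0 d (suc k)
    lem₁ : ∀ a z y → a * (z * y) ≡ y * (a * z)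
    lem₁ = solve-∀
    lem₂ : ∀ y g w → y * (g + w) ≡ y * w + g * y
    lem₂ = solve-∀
    lem₃ : ∀ d p z y w → d * (p * (z * (y * w))) ≡ (p * (z * y)) * (d * w)
    lem₃ = solve-∀
    lem₄ : ∀ p b d z x → p * b * (d * z) * x ≡ d * (p * (z * (b * x)))
    lem₄ = solve-∀
    lem₅ : ∀ a d z → d * (a * z) ≡ a * (d * z)
    lem₅ = solve-∀
    -- At the largest admissible argument d z, `rescale` is undone and the factors d^(k+1), d and z
    -- cancel.
    plain : z ^ k * (α * z ∸ γ′) ≤ β * c D T
    plain = *-cancelˡ-≤ z (*-cancelˡ-≤ (d ^ suc k) (*-cancelˡ-≤ d (begin
      d * (d ^ suc k * (z * (z ^ k * (α * z ∸ γ′))))        ≡⟨ lem₃ d (d ^ suc k) z (z ^ k) (α * z ∸ γ′) ⟩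
      d ^ suc k * z ^ suc k * (d * (α * z ∸ γ′))
        ≡⟨ cong₂ _*_ (sym (^-distribʳ-* d z (suc k))) (trans (*-distribˡ-∸ d (α * z) γ′) (cong (_∸ d * γ′) (lem₅ α d z))) ⟩
      (d * z) ^ suc k * (α * (d * z) ∸ d * γ′)              ≤⟨ lower T bal (d * z) ≤-refl ⟩
      d ^ suc k * β * (d * z) * c D T                       ≡⟨ lem₄ (d ^ suc k) β d z (c D T) ⟩
      d * (d ^ suc k * (z * (β * c D T)))                   ∎)))
    small : z ^ k ≤ (1 + e) ^ k * n ^ k
    small = ≤-trans (^-monoˡ-≤ k (+-monoʳ-≤ n (m≤m*n e n {{>-nonZero ‖ T ‖>0}}))) (≤-reflexive (^-distribʳ-* (1 + e) n k))

  -- The estimate v / β ≤ γ + C₂ / n with denominators cleared. C₂ comes from the loss γ′ and from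
  -- the shift by e, which `g` combines.
  lower-cross : ∀ T → Balanced T → N₀ ≤ ‖ T ‖ →
    v * ((‖ T ‖ C suc k) * ‖ T ‖) ≤ (c D T * ‖ T ‖ + C₂ * (‖ T ‖ C suc k)) * β
  lower-cross T bal N₀≤n = begin
    v * ((n C suc k) * n)                     ≡⟨ cong (λ b → v * (b * n)) (binom≡C n (suc k)) ⟨
    v * (binom n (suc k) * n)                 ≡⟨ lem₁ α (suc k !) (binom n (suc k)) n ⟩
    α * falling n (suc k) * n                 ≤⟨ *-monoˡ-≤ n (*-monoʳ-≤ α (falling≤^ n (suc k))) ⟩
    α * n ^ suc k * n                         ≤⟨ *-monoˡ-≤ n (lower′ T bal) ⟩
    (β * c D T + g * n ^ k) * n               ≡⟨ lem₂ β (c D T) g (n ^ k) n ⟩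
    c D T * n * β + g * n ^ suc k             ≤⟨ +-monoʳ-≤ _ (*-monoʳ-≤ g (^≤2falling n N₀≤n)) ⟩
    c D T * n * β + g * (2 * (suc k ! * binom n (suc k)))
      ≡⟨ lem₃ (c D T * n * β) g (suc k !) (binom n (suc k)) ⟩
    c D T * n * β + C₂ * binom n (suc k) * 1  ≤⟨ +-monoʳ-≤ _ (*-monoʳ-≤ (C₂ * binom n (suc k)) β>0) ⟩
    c D T * n * β + C₂ * binom n (suc k) * β  ≡⟨ *-distribʳ-+ β (c D T * n) _ ⟨
    (c D T * n + C₂ * binom n (suc k)) * β    ≡⟨ cong (λ b → (c D T * n + C₂ * b) * β) (binom≡C n (suc k)) ⟩
    (c D T * n + C₂ * (n C suc k)) * β        ∎
    where
    open ≤-Reasoning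
    n = ‖ T ‖
    lem₁ : ∀ a f b n → a * f * (b * n) ≡ a * (f * b) * n
    lem₁ = solve-∀
    lem₂ : ∀ b c g x n → (b * c + g * x) * n ≡ c * n * b + g * (n * x)
    lem₂ = solve-∀
    lem₃ : ∀ m g f b → m + g * (2 * (f * b)) ≡ m + g * 2 * f * b * 1
    lem₃ = solve-∀

-- Convergence

toℚᵘ-/ : ∀ a b .{{_ : NonZero b}} → toℚᵘ (+ a ℚ./ b) ℚᵘ.≃ + a ℚᵘ./ b
toℚᵘ-/ a (suc b) = ℚ.toℚᵘ-fromℚᵘ (mkℚᵘ (+ a) b)

/-≤ : ∀ {a b m n} .{{_ : NonZero b}} .{{_ : NonZero n}} → a * n ≤ m * b → + a ℚ./ b ℚ.≤ + m ℚ./ n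
/-≤ {a} {suc b} {m} {suc n} le = ℚ.toℚᵘ-cancel-≤
  (ℚᵘ.≤-respˡ-≃ (ℚᵘ.≃-sym (toℚᵘ-/ a (suc b))) (ℚᵘ.≤-respʳ-≃ (ℚᵘ.≃-sym (toℚᵘ-/ m (suc n)))
    (ℚᵘ.*≤* (subst₂ ℤ._≤_ (ℤ.pos-* a (suc n)) (ℤ.pos-* m (suc b)) (ℤ.+≤+ le)))))

/-+ : ∀ a b m n .{{_ : NonZero b}} .{{_ : NonZero n}} →
  + a ℚ./ b ℚ.+ + m ℚ./ n ≡ (+ (a * n + m * b) ℚ./ (b * n)) {{m*n≢0 b n}}
/-+ a b@(suc _) m n@(suc _) = ℚ.toℚᵘ-injective (begin
  toℚᵘ (+ a ℚ./ b ℚ.+ + m ℚ./ n)            ≈⟨ ℚ.toℚᵘ-homo-+ (+ a ℚ./ b) (+ m ℚ./ n) ⟩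
  toℚᵘ (+ a ℚ./ b) ℚᵘ.+ toℚᵘ (+ m ℚ./ n)    ≈⟨ ℚᵘ.+-cong (toℚᵘ-/ a b) (toℚᵘ-/ m n) ⟩
  + a ℚᵘ./ b ℚᵘ.+ + m ℚᵘ./ n
    ≡⟨ cong (ℚᵘ._/ (b * n)) (trans (cong₂ ℤ._+_ (sym (ℤ.pos-* a n)) (sym (ℤ.pos-* m b))) (sym (ℤ.pos-+ (a * n) (m * b)))) ⟩
  + (a * n + m * b) ℚᵘ./ (b * n)            ≈⟨ toℚᵘ-/ (a * n + m * b) (b * n) ⟨
  toℚᵘ (+ (a * n + m * b) ℚ./ (b * n))      ∎)
  where open import Relation.Binary.Reasoning.Setoid ℚᵘ.≃-setoid

*-1/ : ∀ m n .{{_ : NonZero n}} → + m ℚ./ 1 ℚ.* (+ 1 ℚ./ n) ≡ + m ℚ./ n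
*-1/ m n@(suc n′) = ℚ.toℚᵘ-injective
  (ℚᵘ.≃-trans (ℚ.toℚᵘ-homo-* (+ m ℚ./ 1) (+ 1 ℚ./ n))
  (ℚᵘ.≃-trans (ℚᵘ.*-cong (toℚᵘ-/ m 1) (toℚᵘ-/ 1 n))
  (ℚᵘ.≃-trans (ℚᵘ.≃-reflexive (cong₂ mkℚᵘ (ℤ.*-identityʳ (+ m)) (+-identityʳ n′)))
  (ℚᵘ.≃-sym (toℚᵘ-/ m n)))))

0≤/ : ∀ a b .{{_ : NonZero b}} → 0ℚ ℚ.≤ + a ℚ./ b
0≤/ a b = /-≤ {0} {1} {a} {b} z≤n

archimedean : ∀ m {r v} → r ℚ.< v → ∃[ N ] (∀ n .{{_ : NonZero n}} → N ≤ n → r ℚ.+ + m ℚ./ n ℚ.≤ v)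
archimedean m {r} {v} r<v = threshold (v ℚ.- r) (ℚ.positive (subst (ℚ._< v ℚ.- r) (ℚ.+-inverseʳ r) (ℚ.+-monoˡ-< (ℚ.- r) r<v))) (cancel v r)
  where
  cancel : ∀ v r → r ℚ.+ (v ℚ.- r) ≡ v
  cancel v r = trans (cong (r ℚ.+_) (ℚ.+-comm v (ℚ.- r))) (trans (sym (ℚ.+-assoc r (ℚ.- r) v))
    (trans (cong (ℚ._+ v) (ℚ.+-inverseʳ r)) (ℚ.+-identityˡ v)))
  threshold : ∀ δ → ℚ.Positive δ → r ℚ.+ δ ≡ v → ∃[ N ] (∀ n .{{_ : NonZero n}} → N ≤ n → r ℚ.+ + m ℚ./ n ℚ.≤ v)
  -- Since δ = (p + 1) / (q + 1) ≥ 1 / (q + 1), it suffices that n ≥ m (q + 1).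
  threshold δ@(mkℚ (+ suc p) q _) _ eq = m * suc q , λ n mq≤n →
    ℚ.≤-trans (ℚ.+-monoʳ-≤ r (small n mq≤n)) (ℚ.≤-reflexive eq)
    where
    small : ∀ n .{{_ : NonZero n}} → m * suc q ≤ n → + m ℚ./ n ℚ.≤ δ
    small n mq≤n = ℚ.≤-trans (/-≤ {m} {n} {suc p} {suc q} (≤-trans mq≤n (m≤n*m n (suc p)))) (ℚ.≤-reflexive (ℚ.↥p/↧p≡p δ))

+-cancelʳ-≤ℚ : ∀ p q r → p ℚ.+ r ℚ.≤ q ℚ.+ r → p ℚ.≤ q
+-cancelʳ-≤ℚ p q r le = subst₂ ℚ._≤_ (lem p) (lem q) (ℚ.+-monoˡ-≤ (ℚ.- r) le)
  where
  lem : ∀ p → p ℚ.+ r ℚ.- r ≡ p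
  lem p = trans (ℚ.+-assoc p r (ℚ.- r)) (trans (cong (p ℚ.+_) (ℚ.+-inverseʳ r)) (ℚ.+-identityʳ p))

x≤p+r⇒x≤q+r : ∀ {x} p q r → x ℚ.≤ p ℚ.+ r → p ℚ.≤ q → x ℚ.≤ q ℚ.+ r
x≤p+r⇒x≤q+r p q r x≤ p≤q = ℚ.≤-trans x≤ (ℚ.+-monoˡ-≤ r p≤q)

x≤p+q⇒x≤p+r : ∀ {x} p q r → x ℚ.≤ p ℚ.+ q → q ℚ.≤ r → x ℚ.≤ p ℚ.+ r
x≤p+q⇒x≤p+r p q r x≤ q≤r = ℚ.≤-trans x≤ (ℚ.+-monoʳ-≤ p q≤r)

p-q≤r : ∀ p r q → p ℚ.≤ r ℚ.+ q → p ℚ.- q ℚ.≤ r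
p-q≤r p r q le = +-cancelʳ-≤ℚ (p ℚ.- q) r q (subst (ℚ._≤ r ℚ.+ q) (sym lem) le)
  where
  lem : p ℚ.- q ℚ.+ q ≡ p
  lem = trans (ℚ.+-assoc p (ℚ.- q) q) (trans (cong (p ℚ.+_) (ℚ.+-inverseˡ q)) (ℚ.+-identityʳ p))

maxγ-≤ : ∀ D {x} → 0ℚ ℚ.≤ x → ∀ Ts → (∀ {T} → T ∈ Ts → γ D T ℚ.≤ x) → maxγ D Ts ℚ.≤ x
maxγ-≤ D 0≤x []       le = 0≤x
maxγ-≤ D 0≤x (T ∷ Ts) le = ℚ.⊔-lub (le (here refl)) (maxγ-≤ D 0≤x Ts (le ∘ there))

≤-maxγ : ∀ D {T} {Ts} → T ∈ Ts → γ D T ℚ.≤ maxγ D Ts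
≤-maxγ D {T} {Ts = _ ∷ Ts} (here refl) = ℚ.p≤p⊔q (γ D T) (maxγ D Ts)
≤-maxγ D {T} {Ts = U ∷ Ts} (there T∈) = ℚ.≤-trans (≤-maxγ D T∈) (ℚ.p≤q⊔p (γ D U) (maxγ D Ts))

ratio≡/ : ∀ a b .{{_ : NonZero b}} → ratio a b ≡ + a ℚ./ b
ratio≡/ a (suc b) = refl

module Limit (d′ k : ℕ) where

  open Even d′
  open Bounded d′
  open Construction d′
  open Densities d′ k

  instance
    β≢0 : NonZero β
    β≢0 = >-nonZero β>0

  V : ℚ
  V = + v ℚ./ β

  γ≡ : ∀ T .{{_ : NonZero (‖ T ‖ C suc k)}} → γ D T ≡ + c D T ℚ./ (‖ T ‖ C suc k)
  γ≡ T = trans (cong (λ m → ratio (c D T) (‖ T ‖ C m)) (‖E‖ (suc k) (s≤s z≤n))) (ratio≡/ (c D T) (‖ T ‖ C suc k))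

  γ-upper : ∀ n .{{_ : NonZero n}} T → Ary d T → ‖ T ‖ ≡ n → N₀ ≤ n → γ D T ℚ.≤ V ℚ.+ + C₁ ℚ./ n
  γ-upper n T a refl N₀≤n = subst₂ ℚ._≤_ (sym (γ≡ T)) (sym (/-+ v β C₁ n))
    (/-≤ {c D T} {n C suc k} {v * n + C₁ * β} {β * n} {{Cₙ≢0}} {{m*n≢0 β n}} (upper-cross T a N₀≤n))
    where
    instance
      Cₙ≢0 : NonZero (n C suc k)
      Cₙ≢0 = >-nonZero (C>0 n N₀≤n)

  γ-lower : ∀ n .{{_ : NonZero n}} T → Balanced T → ‖ T ‖ ≡ n → N₀ ≤ n → V ℚ.≤ γ D T ℚ.+ + C₂ ℚ./ n
  γ-lower n T bal refl N₀≤n = subst (V ℚ.≤_)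
    (trans (sym (/-+ (c D T) (n C suc k) C₂ n)) (cong (ℚ._+ + C₂ ℚ./ n) (sym (γ≡ T))))
    (/-≤ {v} {β} {c D T * n + C₂ * (n C suc k)} {(n C suc k) * n} {{β≢0}} {{m*n≢0 (n C suc k) n}} (lower-cross T bal N₀≤n))
    where
    instance
      Cₙ≢0 : NonZero (n C suc k)
      Cₙ≢0 = >-nonZero (C>0 n N₀≤n)

  0≤V+ : ∀ n .{{_ : NonZero n}} → 0ℚ ℚ.≤ V ℚ.+ + C₁ ℚ./ n
  0≤V+ n = subst (0ℚ ℚ.≤_) (sym (/-+ v β C₁ n)) (0≤/ (v * n + C₁ * β) (β * n) {{m*n≢0 β n}})

  ary-upper : ∀ n .{{_ : NonZero n}} → N₀ ≤ n → maxγ D (aryTrees d n) ℚ.≤ V ℚ.+ + C₁ ℚ./ n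
  ary-upper n N₀≤n = maxγ-≤ D (0≤V+ n) (aryTrees d n) λ {T} T∈ →
    let a , size = Equivalence.to (aryTrees-correct d n T) T∈ in γ-upper n T a size N₀≤n

  strictlyAry-upper : ∀ n .{{_ : NonZero n}} → N₀ ≤ n → maxγ D (strictlyAryTrees d n) ℚ.≤ V ℚ.+ + C₁ ℚ./ n
  strictlyAry-upper n N₀≤n = maxγ-≤ D (0≤V+ n) (strictlyAryTrees d n) λ {T} T∈ →
    let a , size = Equivalence.to (strictlyAryTrees-correct d n T) T∈ in γ-upper n T (strictlyAry⇒ary a) size N₀≤n

  balancedSized : ∀ m n → m ≡ suc d′ * n + 1 → ∃[ T ] (Balanced T × ‖ T ‖ ≡ m)
  balancedSized m n eq with T , bal , size ← balancedTree n = T , bal , trans size (sym eq)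

  strictlyAry-lower : ∀ m .{{_ : NonZero m}} n → m ≡ suc d′ * n + 1 → N₀ ≤ m →
    V ℚ.≤ maxγ D (strictlyAryTrees d m) ℚ.+ + C₂ ℚ./ m
  strictlyAry-lower m n eq N₀≤m = let T , bal , size = balancedSized m n eq in
    x≤p+r⇒x≤q+r (γ D T) (maxγ D (strictlyAryTrees d m)) (+ C₂ ℚ./ m) (γ-lower m T bal size N₀≤m)
      (≤-maxγ D {T} {strictlyAryTrees d m} (Equivalence.from (strictlyAryTrees-correct d m T) (balanced⇒strictlyAry bal , size)))

  ary-lower : ∀ m .{{_ : NonZero m}} n → m ≡ suc d′ * n + 1 → N₀ ≤ m →
    V ℚ.≤ maxγ D (aryTrees d m) ℚ.+ + C₂ ℚ./ m
  ary-lower m n eq N₀≤m = let T , bal , size = balancedSized m n eq in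
    x≤p+r⇒x≤q+r (γ D T) (maxγ D (aryTrees d m)) (+ C₂ ℚ./ m) (γ-lower m T bal size N₀≤m)
      (≤-maxγ D {T} {aryTrees d m} (Equivalence.from (aryTrees-correct d m T) (strictlyAry⇒ary (balanced⇒strictlyAry bal) , size)))

  n≤leaves : ∀ {m} n → m ≡ suc d′ * n + 1 → n ≤ m
  n≤leaves n refl = ≤-trans (m≤n*m n (suc d′)) (m≤m+n _ 1)

  leaves≢0 : ∀ {m} n → m ≡ suc d′ * n + 1 → NonZero m
  leaves≢0 n refl = >-nonZero (m≤n+m 1 (suc d′ * n))

  -- The lower part of a limit superior asks for infinitely many indices only, so the sizes (d - 1)
  -- n + 1 of the balanced trees suffice, whatever happens at the other residues.
  below-V : ∀ {q} → q ℚ.< V → Cut.lower (I d D) q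
  below-V {q} q<V =
    let r , q<r , r<V = ℚ.<-dense q<V
        M , arch      = archimedean C₂ r<V
    in r , q<r , λ N → often r M arch N (N + N₀ + M) (suc d′ * (N + N₀ + M) + 1) refl refl
    where
    often : ∀ r M → (∀ n .{{_ : NonZero n}} → M ≤ n → r ℚ.+ + C₂ ℚ./ n ℚ.≤ V) →
      ∀ N n m → n ≡ N + N₀ + M → m ≡ suc d′ * n + 1 → ∃[ m ] (N ≤ m × r ℚ.≤ maxγ D (aryTrees d m))
    often r M arch N n m refl eq = m , ≤-trans (≤-trans (m≤m+n N N₀) (m≤m+n (N + N₀) M)) (n≤leaves n eq) ,
      +-cancelʳ-≤ℚ r (maxγ D (aryTrees d m)) (+ C₂ ℚ./ m) (ℚ.≤-trans (arch m (≤-trans (m≤n+m M (N + N₀)) (n≤leaves n eq)))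
        (ary-lower m n eq (≤-trans (≤-trans (m≤n+m N₀ N) (m≤m+n (N + N₀) M)) (n≤leaves n eq))))
      where
      instance
        m≢0 : NonZero m
        m≢0 = leaves≢0 n eq

  above-V : ∀ {q} → V ℚ.< q → Cut.upper (I d D) q
  above-V {q} V<q = let r , V<r , r<q = ℚ.<-dense V<q
                        M , arch      = archimedean C₁ V<r in
    r , r<q , N₀ + M , λ n le → let instance n≢0 = >-nonZero (≤-trans (s≤s z≤n) le) in
      ℚ.≤-trans (ary-upper n (≤-trans (m≤m+n N₀ M) le)) (arch n (≤-trans (m≤n+m M N₀) le))

  -- `below-V` and `above-V` place the inducibility at V; the strict maximum is at most C₁ / m above
  -- and C₂ / m below it. As n ≤ m, the sum of the constants over n covers both sides.
  close : ∀ n .{{_ : NonZero n}} m → m ≡ suc d′ * n + 1 → N₀ ≤ n →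
    ∣ maxγ D (strictlyAryTrees d m) - I d D ∣≤ (+ (C₁ + C₂) ℚ./ 1 ℚ.* (+ 1 ℚ./ n))
  close n m eq N₀≤n = subst (∣ maxγ D (strictlyAryTrees d m) - I d D ∣≤_) (sym (*-1/ (C₁ + C₂) n))
    ( (λ q q< → below-V (ℚ.<-≤-trans q< (p-q≤r S V ε (x≤p+q⇒x≤p+r V (+ C₁ ℚ./ m) ε (strictlyAry-upper m N₀≤m)
        (/-≤ {C₁} {m} {C₁ + C₂} {n} (*-mono-≤ (m≤m+n C₁ C₂) n≤m))))))
    , (λ q <q → above-V (ℚ.≤-<-trans (x≤p+q⇒x≤p+r S (+ C₂ ℚ./ m) ε (strictlyAry-lower m n eq N₀≤m)
        (/-≤ {C₂} {m} {C₁ + C₂} {n} (*-mono-≤ (m≤n+m C₂ C₁) n≤m))) <q)))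
    where
    instance
      m≢0 : NonZero m
      m≢0 = leaves≢0 n eq
    n≤m : n ≤ m
    n≤m = n≤leaves n eq
    N₀≤m : N₀ ≤ m
    N₀≤m = ≤-trans N₀≤n n≤m
    S ε : ℚ
    S = maxγ D (strictlyAryTrees d m)
    ε = + (C₁ + C₂) ℚ./ n

mainTheorem10 : (d k : ℕ) .{{_ : NonTrivial d}} .{{_ : NonZero k}} →
    ∃[ C ] ∃[ N ] ((n : ℕ) .{{_ : NonZero n}} → N ≤ n →
    ∣ maxγ (E d k) (strictlyAryTrees d ((d ∸ 1) * n + 1)) - I d (E d k) ∣≤ (C ℚ.* ((+ 1) ℚ./ n)))
mainTheorem10 (suc (suc d′)) (suc k) =
  + (C₁ + C₂) ℚ./ 1 , N₀ , λ n N₀≤n → Limit.close d′ k n _ refl N₀≤n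
  where open Densities d′ k
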